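{- Let $G$ be a plane graph without cycles of length $4$, $7$, $9$ and without $5$-cycles normally adjacent to $3$-cycles. Let $H$ be the canonical cover of $G$ with $s=2$, i.e., $V(H)=\{(v,1),(v,2): v\in V(G)\}$ and $(u,i)(v,j)\in E(H)$ if and only if $uv\in E(G)$ and $i=j$. Let $f:V(H)\to\{0,1,2,\dots\}$ be given by $f(v,1)=1$ and $f(v,2)=2$ for every $v\in V(G)$. Then $H$ has a strictly $f$-degenerate transversal.
   Context: Two cycles are normally adjacent if their intersection is isomorphic to $K_2$. A transversal of $H$ is a set $T\subseteq V(H)$ with $|T\cap\{(v,1),(v,2)\}|=1$ for each $v\in V(G)$. A transversal $T$ is strictly $f$-degenerate if every subgraph $K$ of the induced subgraph $H[T]$ has a vertex $x\in V(K)$ with $\deg_K(x)<f(x)$. -}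

module Defs where

open import Data.Nat using (ℕ; zero; suc; _+_; _*_; _<_)
open import Data.Bool using (Bool; true; false; _∧_; _∨_; not)
open import Data.Fin using (Fin; zero; suc; toℕ; _≟_) renaming (_<?_ to _<ᶠ?_)
open import Data.Product using (Σ; ∃; _×_; _,_)
open import Data.Sum using (_⊎_)
open import Relation.Nullary using (¬_)
open import Relation.Nullary.Decidable using (⌊_⌋)
open import Relation.Binary.PropositionalEquality using (_≡_; _≢_)
open import Function using (_∘_)

anyFin : ∀ {k} → (Fin k → Bool) → Bool
anyFin {zero}  _ = false
anyFin {suc k} p = p zero ∨ anyFin (p ∘ suc)

allFin : ∀ {k} → (Fin k → Bool) → Bool
allFin {zero}  _ = true
allFin {suc k} p = p zero ∧ allFin (p ∘ suc)

countB : ∀ {k} → (Fin k → Bool) → ℕ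
countB {zero}  _ = 0
countB {suc k} p = (if p zero then 1 else 0) + countB (p ∘ suc)
  where open import Data.Bool using (if_then_else_)

iter : ∀ {d} → (Fin d → Fin d) → ℕ → Fin d → Fin d
iter p zero    i = i
iter p (suc t) i = p (iter p t i)

-- j lies in the orbit of i under p (at most d steps suffice on Fin d)
reachP : ∀ {d} → (Fin d → Fin d) → Fin d → Fin d → Bool
reachP {d} p i j = anyFin {suc d} (λ t → ⌊ iter p (toℕ t) i ≟ j ⌋)

-- number of orbits of p : Fin d → Fin d (count orbit-minimal elements)
orbitCount : ∀ {d} → (Fin d → Fin d) → ℕ
orbitCount p =
  countB (λ i → allFin (λ j → not (⌊ j <ᶠ? i ⌋ ∧ reachP p j i)))

-- Combinatorial maps (rotation systems) on vertex set Fin n with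
-- dart set Fin d:  vtx h = tail vertex of dart h, α = reversal of the
-- dart (fixed-point-free involution), σ = rotation around the tail.

module RawMap {n d : ℕ} (vtx : Fin d → Fin n) (α σ : Fin d → Fin d) where

  adjB : Fin n → Fin n → Bool
  adjB u v = anyFin (λ h → ⌊ vtx h ≟ u ⌋ ∧ ⌊ vtx (α h) ≟ v ⌋)

  reachG : ℕ → Fin n → Fin n → Bool
  reachG zero    u v = ⌊ u ≟ v ⌋
  reachG (suc k) u v = reachG k u v ∨ anyFin (λ w → reachG k u w ∧ adjB w v)

  components : ℕ
  components = countB (λ v → allFin (λ u → not (⌊ u <ᶠ? v ⌋ ∧ reachG n u v)))

  isolated : ℕ
  isolated = countB (λ v → not (anyFin (λ h → ⌊ vtx h ≟ v ⌋)))

  faces : ℕ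
  faces = orbitCount (σ ∘ α)

-- A plane (simple) graph: a simple graph on Fin n together with a
-- combinatorial embedding in the sphere (rotation system whose Euler
-- characteristic is 2 on every connected component, i.e.
-- n − (d/2) + faces + isolated = 2·components).

record PlaneGraph : Set where
  field
    n d   : ℕ
    vtx   : Fin d → Fin n
    α σ   : Fin d → Fin d
    α-inv : ∀ h → α (α h) ≡ h
    α-fpf : ∀ h → α h ≢ h
    σ-inj : ∀ h h' → σ h ≡ σ h' → h ≡ h'
    σ-vtx : ∀ h → vtx (σ h) ≡ vtx h
    σ-trans : ∀ h h' → vtx h ≡ vtx h' → reachP σ h h' ≡ true
    loopless : ∀ h → vtx (α h) ≢ vtx h
    no-multi : ∀ h h' → vtx h ≡ vtx h' → vtx (α h) ≡ vtx (α h') → h ≡ h'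
    euler : let open RawMap vtx α σ in
            2 * n + 2 * faces + 2 * isolated ≡ 4 * components + d

  V : Set
  V = Fin n

  Adj : V → V → Set
  Adj u v = ∃ λ h → vtx h ≡ u × vtx (α h) ≡ v

Consec : ∀ {k} → Fin k → Fin k → Set
Consec {k} i j = (toℕ j ≡ suc (toℕ i)) ⊎ (suc (toℕ i) ≡ k × toℕ j ≡ 0)

module _ (G : PlaneGraph) where
  open PlaneGraph G

  -- a cycle of length k (k ≥ 3 when used) in G
  record Cycle (k : ℕ) : Set where
    field
      vert : Fin k → V
      inj  : ∀ i j → vert i ≡ vert j → i ≡ j
      adj  : ∀ i j → Consec i j → Adj (vert i) (vert j)

  OnC : ∀ {k} → Cycle k → V → Set
  OnC C x = ∃ λ i → Cycle.vert C i ≡ x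

  EdgeC : ∀ {k} → Cycle k → V → V → Set
  EdgeC C x y = ∃ λ i → ∃ λ j → Consec i j ×
    ((Cycle.vert C i ≡ x × Cycle.vert C j ≡ y) ⊎
     (Cycle.vert C i ≡ y × Cycle.vert C j ≡ x))

  -- two cycles are normally adjacent if their intersection is K₂:
  -- exactly two common vertices u ≠ v and the edge uv in both cycles
  NormallyAdjacent : ∀ {k l} → Cycle k → Cycle l → Set
  NormallyAdjacent C D = ∃ λ u → ∃ λ v → u ≢ v ×
    OnC C u × OnC D u × OnC C v × OnC D v ×
    (∀ w → OnC C w → OnC D w → w ≡ u ⊎ w ≡ v) ×
    EdgeC C u v × EdgeC D u v

  -- Canonical cover H with s = 2: vertices (v , i), i : Fin 2
  -- (zero ↔ copy 1, suc zero ↔ copy 2); (u,i)(v,j) ∈ E(H) iff uv ∈ E(G), i = j.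

  VH : Set
  VH = V × Fin 2

  AdjH : VH → VH → Set
  AdjH (u , i) (v , j) = Adj u v × i ≡ j

  fH : VH → ℕ
  fH (_ , zero)     = 1
  fH (_ , suc zero) = 2

  SubsetH : Set
  SubsetH = VH → Bool

  IsTransversal : SubsetH → Set
  IsTransversal T = ∀ v →
    (T (v , zero) ≡ true × T (v , suc zero) ≡ false) ⊎
    (T (v , zero) ≡ false × T (v , suc zero) ≡ true)

  record SubgraphOf (T : SubsetH) : Set where
    field
      VK : SubsetH
      EK : VH → VH → Bool
      VK⊆T  : ∀ x → VK x ≡ true → T x ≡ true
      EK-sym : ∀ x y → EK x y ≡ EK y x
      EK⊆H  : ∀ x y → EK x y ≡ true → AdjH x y × VK x ≡ true × VK y ≡ true
      nonempty : ∃ λ x → VK x ≡ true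

    degK : VH → ℕ
    degK x = countB (λ y → EK x (y , zero)) + countB (λ y → EK x (y , suc zero))

  StrictlyDegenerate : SubsetH → Set
  StrictlyDegenerate T = (K : SubgraphOf T) →
    ∃ λ x → SubgraphOf.VK K x ≡ true × SubgraphOf.degK K x < fH x

module Submission where

-- Copy 1 must carry an independent set and copy 2 a set inducing a forest. Let S be a minimal
-- vertex set without such a partition. Then the graph induced by S has minimum degree 3, and a
-- cycle of vertices of degree 3 cannot have outer neighbours of both colours: uncolour the cycle,
-- start behind an outer neighbour of the independent set and colour greedily around. Moving
-- uncoloured vertices along face boundaries then rules out that a face with all degrees 3 borders
-- a triangle or pentagon of the same kind, and restricts the neighbours of a "poor" face, a
-- 10-face with all degrees 3 that borders a triangle along every second edge.
-- This contradicts Euler's formula: give a vertex of degree d the charge 24d − 72 and a face of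
-- length ℓ the charge 12ℓ − 72, of negative total. Vertices of degree at least 4 pay to their
-- faces, and faces of length at least 8 pay across their edges to triangles, deficient pentagons
-- and poor faces. For faces of length 10 and 11 the possible patterns of degrees and neighbouring
-- faces are enumerated; for length at least 12 a local averaging suffices.

open import Defs
open import Data.Nat
open import Data.Nat.Properties
open import Data.Nat.DivMod using (_%_; _/_; m≡m%n+[m/n]*n; m%n<n)
open import Data.Nat.Tactic.RingSolver using (solve-∀)
import Data.Bool
open import Data.Bool using (Bool; true; false; _∧_; _∨_; not; if_then_else_) renaming (_≟_ to _≟B_)
open import Data.Bool.Properties using (∧-comm; ∧-zeroʳ; ∧-identityʳ)
open import Data.Fin using (Fin; zero; suc; toℕ; fromℕ<) renaming (_≟_ to _≟F_; _<?_ to _<F?_; _<_ to _<F_)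
import Data.Fin.Properties as F
open import Data.Fin.Permutation using (permutation)
open import Data.Fin.Subset using (Subset)
open import Data.Fin.Subset.Properties using (anySubset?)
open import Data.List using (List; []; _∷_; length) renaming (lookup to lookupL)
open import Data.Vec using (Vec; []; _∷_; lookup; tabulate)
open import Data.Vec.Properties using (lookup∘tabulate)
open import Data.Unit using (⊤; tt)
open import Data.Product using (Σ; ∃; ∃₂; _×_; _,_; proj₁; proj₂)
open import Data.Sum using (_⊎_; inj₁; inj₂)
open import Data.Empty using (⊥; ⊥-elim)
open import Relation.Nullary using (¬_; Dec; yes; no)
open import Relation.Nullary.Decidable using (⌊_⌋; _×-dec_; _⊎-dec_; _→-dec_; ¬?; True; toWitness; map′)
open import Relation.Binary.PropositionalEquality
open import Relation.Binary.Definitions using (tri<; tri≈; tri>)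
open import Function using (_∘_; case_of_)
open import Algebra.Properties.CommutativeMonoid.Sum +-0-commutativeMonoid
  using (sum; sum-cong-≗; ∑-distrib-+; ∑-comm; sum-replicate-zero; sum-permute)

-- The minimal set `S` may be smaller than the vertex set, so Euler's formula is needed for an
-- induced subgraph. The darts of `G` are kept and those leaving `S` become stubs; components and
-- faces are replaced by labelings, whose class counts can be followed through the deletion of
-- single edges. Excluding lengths 7 and 9 acts on glued faces: a detour over a triangle turns 6
-- into 7 and 8 into 9, while a pentagon with a hexagon, or three pentagons at a vertex of degree 3,
-- are surrounded by a closed walk of length 9. Hence a face beside a triangle has length at least
-- 10. A triangle lacks 36 and takes 12 over each edge; a pentagon lacks 12. A 10-face bordering
-- five triangles owns 48 and pays 60. If all its degrees are 3 nothing makes up for this, so it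
-- takes 3 over each of the other five edges. The recolouring rests on one fact: with a single
-- vertex of `S` uncoloured, and that one of degree 3, exactly one neighbour has the colour of copy
-- 1. So the gap can travel to any neighbour, and two colourings that differ at one neighbour only
-- cannot both occur.

true≢false : true ≢ false
true≢false ()

¬true : ∀ {b} → b ≢ true → b ≡ false
¬true {false} _ = refl
¬true {true} h = ⊥-elim (h refl)

∧-true : ∀ {a b} → a ∧ b ≡ true → a ≡ true × b ≡ true
∧-true {true} {true} _ = refl , refl

∨-true : ∀ {a b} → a ∨ b ≡ true → a ≡ true ⊎ b ≡ true
∨-true {true} _ = inj₁ refl
∨-true {false} h = inj₂ h

⌊⌋-true : ∀ {A : Set} {d : Dec A} → ⌊ d ⌋ ≡ true → A
⌊⌋-true {d = yes a} _ = a

true-⌊⌋ : ∀ {A : Set} {d : Dec A} → A → ⌊ d ⌋ ≡ true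
true-⌊⌋ {d = yes _} _ = refl
true-⌊⌋ {d = no ¬a} a = ⊥-elim (¬a a)

anyFin-sound : ∀ {k} (p : Fin k → Bool) → anyFin p ≡ true → ∃ λ i → p i ≡ true
anyFin-sound {suc k} p h with ∨-true {p zero} h
... | inj₁ e = zero , e
... | inj₂ e with anyFin-sound (p ∘ suc) e
...   | i , q = suc i , q

anyFin-complete : ∀ {k} (p : Fin k → Bool) i → p i ≡ true → anyFin p ≡ true
anyFin-complete p zero e rewrite e = refl
anyFin-complete p (suc i) e with p zero
... | true = refl
... | false = anyFin-complete (p ∘ suc) i e

allFin-sound : ∀ {k} (p : Fin k → Bool) → allFin p ≡ true → ∀ i → p i ≡ true
allFin-sound p h zero = proj₁ (∧-true h)
allFin-sound p h (suc i) = allFin-sound (p ∘ suc) (proj₂ (∧-true {p zero} h)) i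

allFin-complete : ∀ {k} (p : Fin k → Bool) → (∀ i → p i ≡ true) → allFin p ≡ true
allFin-complete {zero} p h = refl
allFin-complete {suc k} p h rewrite h zero = allFin-complete (p ∘ suc) (h ∘ suc)

-- Sums, counting and classes of labelings

bit : Bool → ℕ
bit b = if b then 1 else 0

countB-sum : ∀ {k} (p : Fin k → Bool) → countB p ≡ sum (bit ∘ p)
countB-sum {zero} p = refl
countB-sum {suc k} p = cong (bit (p zero) +_) (countB-sum (p ∘ suc))

sum-mono : ∀ {k} (f g : Fin k → ℕ) → (∀ i → f i ≤ g i) → sum f ≤ sum g
sum-mono {zero} f g h = z≤n
sum-mono {suc k} f g h = +-mono-≤ (h zero) (sum-mono (f ∘ suc) (g ∘ suc) (h ∘ suc))

sum-*ˡ : ∀ {k} c (f : Fin k → ℕ) → sum (λ i → c * f i) ≡ c * sum f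
sum-*ˡ {zero} c f = sym (*-zeroʳ c)
sum-*ˡ {suc k} c f rewrite sum-*ˡ c (f ∘ suc) = sym (*-distribˡ-+ c (f zero) _)

sum-const : ∀ k c → sum {k} (λ _ → c) ≡ k * c
sum-const zero c = refl
sum-const (suc k) c = cong (c +_) (sum-const k c)

erase : ∀ {k} → Fin k → (Fin k → ℕ) → Fin k → ℕ
erase a w x = if ⌊ x ≟F a ⌋ then 0 else w x

erase-≢ : ∀ {k} (a : Fin k) w x → x ≢ a → erase a w x ≡ w x
erase-≢ a w x ne with x ≟F a
... | yes e = ⊥-elim (ne e)
... | no _ = refl

erase-suc : ∀ {k} (a : Fin k) (w : Fin (suc k) → ℕ) x → erase (suc a) w (suc x) ≡ erase a (w ∘ suc) x
erase-suc a w x with x ≟F a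
... | yes refl = refl
... | no _ = refl

sum-erase : ∀ {k} (a : Fin k) (w : Fin k → ℕ) → sum w ≡ w a + sum (erase a w)
sum-erase zero w = refl
sum-erase (suc a) w
  rewrite sum-cong-≗ (erase-suc a w) | sum-erase a (w ∘ suc) =
  lem (w zero) (w (suc a)) (sum (erase a (w ∘ suc)))
  where
  lem : ∀ x y z → x + (y + z) ≡ y + (x + z)
  lem = solve-∀

sum-single : ∀ {k} (f : Fin k → ℕ) b → (∀ i → f i ≤ b) →
  (∀ i j → f i ≢ 0 → f j ≢ 0 → i ≡ j) → sum f ≤ b
sum-single {zero} f b _ _ = z≤n
sum-single {suc k} f b le uni with f zero in e
... | zero = sum-single (f ∘ suc) b (le ∘ suc) (λ i j p q → F.suc-injective (uni (suc i) (suc j) p q))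
... | suc m = ≤-trans (≤-reflexive (trans (cong (suc m +_) rest) (+-identityʳ _))) (≤-trans (≤-reflexive (sym e)) (le zero))
  where
  z0 : ∀ i → f (suc i) ≡ 0
  z0 i with f (suc i) in e'
  ... | zero = refl
  ... | suc _ with uni zero (suc i) (λ q → case trans (sym e) q of λ ()) (λ q → case trans (sym e') q of λ ())
  ...   | ()
  rest : sum (f ∘ suc) ≡ 0
  rest = trans (sum-cong-≗ z0) (sum-replicate-zero k)

sum-≥ : ∀ {k} (f : Fin k → ℕ) i → f i ≤ sum f
sum-≥ f i = ≤-trans (m≤m+n (f i) _) (≤-reflexive (sym (sum-erase i f)))

countB-mono : ∀ {k} (p q : Fin k → Bool) → (∀ i → p i ≡ true → q i ≡ true) → countB p ≤ countB q
countB-mono p q h rewrite countB-sum p | countB-sum q = sum-mono _ _ pt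
  where
  pt : ∀ i → bit (p i) ≤ bit (q i)
  pt i with p i in e
  ... | false = z≤n
  ... | true rewrite h i e = ≤-refl

countB-mono¹ : ∀ {k} (p q : Fin k → Bool) a → (∀ i → i ≢ a → p i ≡ true → q i ≡ true) → countB p ≤ suc (countB q)
countB-mono¹ p q a h rewrite countB-sum p | countB-sum q | sum-erase a (bit ∘ p) =
  +-mono-≤ (bit≤1 (p a)) (sum-mono _ _ pt)
  where
  bit≤1 : ∀ b → bit b ≤ 1
  bit≤1 true = ≤-refl
  bit≤1 false = z≤n
  pt : ∀ i → erase a (bit ∘ p) i ≤ bit (q i)
  pt i with i ≟F a
  ... | yes _ = z≤n
  ... | no ne with p i in e
  ...   | false = z≤n
  ...   | true rewrite h i ne e = ≤-refl

countB-strict : ∀ {k} (p q : Fin k → Bool) a → p a ≡ false → q a ≡ true →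
  (∀ i → p i ≡ true → q i ≡ true) → suc (countB p) ≤ countB q
countB-strict p q a pa qa h rewrite countB-sum p | countB-sum q | sum-erase a (bit ∘ q) | qa =
  s≤s (sum-mono _ _ pt)
  where
  pt : ∀ i → bit (p i) ≤ erase a (bit ∘ q) i
  pt i with i ≟F a
  ... | yes refl rewrite pa = z≤n
  ... | no ne with p i in e
  ...   | false = z≤n
  ...   | true rewrite h i e = ≤-refl

sumN : ℕ → (ℕ → ℕ) → ℕ
sumN zero f = 0
sumN (suc n) f = f 0 + sumN n (f ∘ suc)

sumN-cong : ∀ n {f g : ℕ → ℕ} → (∀ i → f i ≡ g i) → sumN n f ≡ sumN n g
sumN-cong zero h = refl
sumN-cong (suc n) h = cong₂ _+_ (h 0) (sumN-cong n (h ∘ suc))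

sumN-mono : ∀ n {f g : ℕ → ℕ} → (∀ i → f i ≤ g i) → sumN n f ≤ sumN n g
sumN-mono zero h = z≤n
sumN-mono (suc n) h = +-mono-≤ (h 0) (sumN-mono n (h ∘ suc))

sumN-+ : ∀ n (f g : ℕ → ℕ) → sumN n (λ i → f i + g i) ≡ sumN n f + sumN n g
sumN-+ zero f g = refl
sumN-+ (suc n) f g rewrite sumN-+ n (f ∘ suc) (g ∘ suc) = lem (f 0) (g 0) (sumN n (f ∘ suc)) (sumN n (g ∘ suc))
  where
  lem : ∀ a b c d → a + b + (c + d) ≡ a + c + (b + d)
  lem = solve-∀

sumN-const : ∀ n c → sumN n (λ _ → c) ≡ n * c
sumN-const zero c = refl
sumN-const (suc n) c = cong (c +_) (sumN-const n c)

sumN-*ˡ : ∀ n c (f : ℕ → ℕ) → sumN n (λ i → c * f i) ≡ c * sumN n f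
sumN-*ˡ zero c f = sym (*-zeroʳ c)
sumN-*ˡ (suc n) c f rewrite sumN-*ˡ n c (f ∘ suc) = sym (*-distribˡ-+ c (f 0) _)

sumN-snoc : ∀ n (f : ℕ → ℕ) → sumN (suc n) f ≡ sumN n f + f n
sumN-snoc zero f = +-comm (f 0) 0
sumN-snoc (suc n) f = trans (cong (f 0 +_) (sumN-snoc n (f ∘ suc))) (sym (+-assoc (f 0) _ _))

sumN-shift : ∀ n (f : ℕ → ℕ) → f n ≡ f 0 → sumN n (f ∘ suc) ≡ sumN n f
sumN-shift n f e = +-cancelˡ-≡ (f 0) _ _ (trans (sumN-snoc n f) (trans (+-comm (sumN n f) (f n)) (cong (_+ sumN n f) e)))

periodic : ∀ {A : Set} {k} (f : ℕ → A) → (∀ i → f (i + k) ≡ f i) → ∀ i t → f (i + t * k) ≡ f i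
periodic f per i zero = cong f (+-identityʳ i)
periodic {k = k} f per i (suc t) = trans (cong f (trans (cong (i +_) (+-comm k (t * k))) (sym (+-assoc i (t * k) k)))) (trans (per (i + t * k)) (periodic f per i t))

sumN-inj≤ : ∀ {k} m (g : ℕ → Fin k) (w : Fin k → ℕ) →
  (∀ i j → i < m → j < m → g i ≡ g j → i ≡ j) → sumN m (w ∘ g) ≤ sum w
sumN-inj≤ zero g w _ = z≤n
sumN-inj≤ (suc m) g w inj = begin
  w (g 0) + sumN m (w ∘ g ∘ suc) ≡⟨ cong (w (g 0) +_) (agree m (g ∘ suc) λ i i<m e → case inj (suc i) 0 (s≤s i<m) (s≤s z≤n) e of λ ()) ⟩
  w (g 0) + sumN m (w' ∘ g ∘ suc) ≤⟨ +-monoʳ-≤ (w (g 0)) (sumN-inj≤ m (g ∘ suc) w' λ i j p q e → suc-injective (inj (suc i) (suc j) (s≤s p) (s≤s q) e)) ⟩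
  w (g 0) + sum w' ≡⟨ sum-erase (g 0) w ⟨
  sum w ∎
  where
  open ≤-Reasoning
  w' = erase (g 0) w
  agree : ∀ n (h : ℕ → _) → (∀ i → i < n → h i ≢ g 0) → sumN n (w ∘ h) ≡ sumN n (w' ∘ h)
  agree zero h _ = refl
  agree (suc n) h ne = cong₂ _+_ (sym (erase-≢ (g 0) w (h 0) (ne 0 (s≤s z≤n)))) (agree n (h ∘ suc) λ i p → ne (suc i) (s≤s p))

firstB : ∀ {k} {A : Set} → ((x y : A) → Dec (x ≡ y)) → (Fin k → A) → Fin k → Bool
firstB _≟_ l v = allFin (λ u → not (⌊ u <F? v ⌋ ∧ ⌊ l u ≟ l v ⌋))

-- The number of distinct labels, counted by first occurrences. Components and faces enter Euler's
-- inequality only through such counts.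
classes : ∀ {k} {A : Set} → ((x y : A) → Dec (x ≡ y)) → (Fin k → A) → ℕ
classes _≟_ l = countB (firstB _≟_ l)

module _ {k : ℕ} {A : Set} (_≟_ : (x y : A) → Dec (x ≡ y)) (l : Fin k → A) where

  first-sound : ∀ v → firstB _≟_ l v ≡ true → ∀ u → u <F v → l u ≢ l v
  first-sound v h u u<v e with allFin-sound _ h u
  ... | q rewrite true-⌊⌋ {d = u <F? v} u<v | true-⌊⌋ {d = l u ≟ l v} e with q
  ...   | ()

  first-complete : ∀ v → (∀ u → u <F v → l u ≢ l v) → firstB _≟_ l v ≡ true
  first-complete v h = allFin-complete _ pt
    where
    pt : ∀ u → not (⌊ u <F? v ⌋ ∧ ⌊ l u ≟ l v ⌋) ≡ true
    pt u with u <F? v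
    ... | no _ = refl
    ... | yes p with l u ≟ l v
    ...   | no _ = refl
    ...   | yes e = ⊥-elim (h u p e)

  first-unique : ∀ u v → firstB _≟_ l u ≡ true → firstB _≟_ l v ≡ true → l u ≡ l v → u ≡ v
  first-unique u v hu hv e with F.<-cmp u v
  ... | tri< p _ _ = ⊥-elim (first-sound v hv u p e)
  ... | tri≈ _ q _ = q
  ... | tri> _ _ p = ⊥-elim (first-sound u hu v p (sym e))

  -- Double counting of the pairs of a first occurrence `r` and an element `x` of its class: every
  -- `x` belongs to one `r` only.
  classes-sum : ∀ c (w : Fin k → ℕ) →
    (∀ r → c ≤ sum (λ x → if ⌊ l x ≟ l r ⌋ then w x else 0)) → c * classes _≟_ l ≤ sum w
  classes-sum c w h = begin
    c * countB fst ≡⟨ cong (c *_) (countB-sum fst) ⟩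
    c * sum (bit ∘ fst) ≡⟨ sum-*ˡ c (bit ∘ fst) ⟨
    sum (λ r → c * bit (fst r)) ≤⟨ sum-mono _ _ step ⟩
    sum (λ r → sum (λ x → m r x)) ≡⟨ ∑-comm m ⟩
    sum (λ x → sum (λ r → m r x)) ≤⟨ sum-mono _ _ one ⟩
    sum w ∎
    where
    open ≤-Reasoning
    fst = firstB _≟_ l
    m : Fin k → Fin k → ℕ
    m r x = if fst r then (if ⌊ l x ≟ l r ⌋ then w x else 0) else 0
    step : ∀ r → c * bit (fst r) ≤ sum (m r)
    step r with fst r
    ... | true = ≤-trans (≤-reflexive (*-identityʳ c)) (h r)
    ... | false = ≤-trans (≤-reflexive (*-zeroʳ c)) z≤n
    one : ∀ x → sum (λ r → m r x) ≤ w x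
    one x = sum-single (λ r → m r x) (w x) le uni
      where
      le : ∀ r → m r x ≤ w x
      le r with fst r
      ... | false = z≤n
      ... | true with l x ≟ l r
      ...   | yes _ = ≤-refl
      ...   | no _ = z≤n
      get : ∀ r → m r x ≢ 0 → fst r ≡ true × l x ≡ l r
      get r ne with fst r
      ... | false = ⊥-elim (ne refl)
      ... | true with l x ≟ l r
      ...   | yes e = refl , e
      ...   | no _ = ⊥-elim (ne refl)
      uni : ∀ i j → m i x ≢ 0 → m j x ≢ 0 → i ≡ j
      uni i j p q = first-unique i j (proj₁ (get i p)) (proj₁ (get j q))
        (trans (sym (proj₂ (get i p))) (proj₂ (get j q)))

module _ {k : ℕ} {A B : Set} (_≟_ : (x y : A) → Dec (x ≡ y)) (_≟'_ : (x y : B) → Dec (x ≡ y)) where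

  -- A first occurrence for `l` remains one for the finer `l'`. The `l'`-classes of `a` and `b` lie
  -- in one `l`-class, so one of their two first elements is new.
  classes-strict : (l : Fin k → A) (l' : Fin k → B) → (∀ u v → l' u ≡ l' v → l u ≡ l v) →
    ∀ a b → l a ≡ l b → l' a ≢ l' b → suc (classes _≟_ l) ≤ classes _≟'_ l'
  classes-strict l l' h a b e ne = go (leastOf a) (leastOf b)
    where
    Least : Fin k → Set
    Least a = Σ (Fin k) λ m → l' m ≡ l' a × firstB _≟'_ l' m ≡ true
    leastOf : ∀ a → Least a
    leastOf a = search k a refl (F.toℕ<n a)
      where
      search : ∀ f x → l' x ≡ l' a → toℕ x < f → Least a
      search (suc f) x e (s≤s lt) with F.any? (λ u → (u <F? x) ×-dec (l' u ≟' l' x))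
      ... | yes (u , p , q) = search f u (trans q e) (≤-trans p lt)
      ... | no none = x , e , first-complete _≟'_ l' x λ u p q → none (u , p , q)
    sub : ∀ i → firstB _≟_ l i ≡ true → firstB _≟'_ l' i ≡ true
    sub v p = first-complete _≟'_ l' v λ u u<v e → first-sound _≟_ l v p u u<v (h u v e)
    go : Least a → Least b → suc (classes _≟_ l) ≤ classes _≟'_ l'
    go (m , ma , mf) (m' , mb , mf') with firstB _≟_ l m in fm | firstB _≟_ l m' in fm'
    ... | false | _ = countB-strict _ _ m fm mf sub
    ... | true | false = countB-strict _ _ m' fm' mf' sub
    ... | true | true = ⊥-elim (ne (trans (sym ma) (trans (cong l' mm) mb)))
      where
      mm : m ≡ m'
      mm = first-unique _≟_ l m m' fm fm' (trans (h _ _ ma) (trans e (sym (h _ _ mb))))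

module _ {k : ℕ} {A : Set} (_≟_ : (x y : A) → Dec (x ≡ y)) where

  merge : A → A → (Fin k → A) → Fin k → A
  merge a b l x = if ⌊ l x ≟ a ⌋ then b else l x

  merge-cong : ∀ a b l x y → l x ≡ l y → merge a b l x ≡ merge a b l y
  merge-cong a b l x y e rewrite e = refl

  merge-a : ∀ a b l x → l x ≡ a → merge a b l x ≡ b
  merge-a a b l x e with l x ≟ a
  ... | yes _ = refl
  ... | no n = ⊥-elim (n e)

  merge-b : ∀ a b l x → l x ≡ b → merge a b l x ≡ b
  merge-b a b l x e with l x ≟ a
  ... | yes _ = refl
  ... | no n = e

  -- Only one element can cease to be a first occurrence: the later of the first elements of the two
  -- merged classes.
  classes-merge : ∀ a b (l : Fin k → A) → classes _≟_ l ≤ suc (classes _≟_ (merge a b l))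
  classes-merge a b l = lem (F.any? dec)
    where
    l' = merge a b l
    AB : Fin k → Set
    AB v = l v ≡ a ⊎ l v ≡ b
    Bad : Fin k → Set
    Bad v = firstB _≟_ l v ≡ true × AB v × firstB _≟_ l' v ≡ false
    dec : ∀ v → Dec (Bad v)
    dec v = (firstB _≟_ l v ≟B true) ×-dec ((l v ≟ a) ⊎-dec (l v ≟ b)) ×-dec (firstB _≟_ l' v ≟B false)
    l'b : ∀ v → AB v → l' v ≡ b
    l'b v (inj₁ e) = merge-a a b l v e
    l'b v (inj₂ e) = merge-b a b l v e
    cases : ∀ u v → l' u ≡ l' v → l u ≡ l v ⊎ (AB u × AB v)
    cases u v e with l u ≟ a | l v ≟ a
    ... | yes p | yes q = inj₁ (trans p (sym q))
    ... | yes p | no q = inj₂ (inj₁ p , inj₂ (sym e))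
    ... | no p | yes q = inj₂ (inj₂ e , inj₁ q)
    ... | no p | no q = inj₁ e
    same : ∀ t u v → AB t → AB u → AB v → l u ≢ l v → l t ≡ l u ⊎ l t ≡ l v
    same t u v (inj₁ p) (inj₁ q) _ _ = inj₁ (trans p (sym q))
    same t u v (inj₂ p) (inj₂ q) _ _ = inj₁ (trans p (sym q))
    same t u v (inj₁ p) (inj₂ q) (inj₁ r) _ = inj₂ (trans p (sym r))
    same t u v (inj₂ p) (inj₁ q) (inj₂ r) _ = inj₂ (trans p (sym r))
    same t u v (inj₁ p) (inj₂ q) (inj₂ r) n = ⊥-elim (n (trans q (sym r)))
    same t u v (inj₂ p) (inj₁ q) (inj₁ r) n = ⊥-elim (n (trans q (sym r)))
    contra : ∀ i → firstB _≟_ l' i ≡ false → (∀ u → u <F i → l' u ≢ l' i) → ⊥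
    contra i q h = true≢false (trans (sym (first-complete _≟_ l' i h)) q)
    smaller : ∀ u v → Bad u → Bad v → u <F v → l u ≢ l v → ⊥
    smaller u v (fu , abu , nu) (fv , abv , _) u<v ne = contra u nu h
      where
      h : ∀ t → t <F u → l' t ≢ l' u
      h t t<u e with cases t u e
      ... | inj₁ e' = first-sound _≟_ l u fu t t<u e'
      ... | inj₂ (abt , _) with same t u v abt abu abv ne
      ...   | inj₁ e' = first-sound _≟_ l u fu t t<u e'
      ...   | inj₂ e' = first-sound _≟_ l v fv t (<-trans t<u u<v) e'
    unique : ∀ u v → Bad u → Bad v → u ≡ v
    unique u v bu bv with l u ≟ l v
    ... | yes e = first-unique _≟_ l u v (proj₁ bu) (proj₁ bv) e
    ... | no ne with F.<-cmp u v
    ...   | tri< p _ _ = ⊥-elim (smaller u v bu bv p ne)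
    ...   | tri≈ _ e _ = e
    ...   | tri> _ _ p = ⊥-elim (smaller v u bv bu p (ne ∘ sym))
    ok : ∀ i → ¬ Bad i → firstB _≟_ l i ≡ true → firstB _≟_ l' i ≡ true
    ok i nb p with firstB _≟_ l' i ≟B true
    ... | yes t = t
    ... | no nt = ⊥-elim (contra i q h)
      where
      q = ¬true nt
      h : ∀ u → u <F i → l' u ≢ l' i
      h u u<i e with cases u i e
      ... | inj₁ e' = first-sound _≟_ l i p u u<i e'
      ... | inj₂ (_ , abi) = nb (p , abi , q)
    lem : Dec (∃ Bad) → classes _≟_ l ≤ suc (classes _≟_ l')
    lem (no none) = ≤-trans (countB-mono _ _ λ i → ok i λ b → none (i , b)) (n≤1+n _)
    lem (yes (z , bz)) = countB-mono¹ _ _ z λ i ne → ok i λ b → ne (unique i z b bz)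

-- Orbits of injections of a finite set

record Least (P : ℕ → Set) : Set where
  constructor mkLeast
  field
    at : ℕ
    holds : P at
    below : ∀ t → t < at → ¬ P t

least : {P : ℕ → Set} → (∀ n → Dec (P n)) → ∀ N → P N → Least P
least P? zero p = mkLeast 0 p λ _ ()
least {P} P? (suc N) p with P? 0
... | yes q = mkLeast 0 q λ _ ()
... | no nq with least {P ∘ suc} (P? ∘ suc) N p
...   | mkLeast a h b = mkLeast (suc a) h λ { zero _ → nq ; (suc t) (s≤s lt) → b t lt }

least-≤ : {P : ℕ → Set} (l : Least P) → ∀ n → P n → Least.at l ≤ n
least-≤ l n p with Least.at l ≤? n
... | yes q = q
... | no nq = ⊥-elim (Least.below l n (≰⇒> nq) p)

iter-+ : ∀ {d} (π : Fin d → Fin d) m n x → iter π (m + n) x ≡ iter π m (iter π n x)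
iter-+ π zero n x = refl
iter-+ π (suc m) n x = cong π (iter-+ π m n x)

iter-suc : ∀ {d} (π : Fin d → Fin d) t x → iter π (suc t) x ≡ iter π t (π x)
iter-suc π zero x = refl
iter-suc π (suc t) x = cong π (iter-suc π t x)

iter-inv : ∀ {d} {A : Set} (π : Fin d → Fin d) (l : Fin d → A) → (∀ x → l (π x) ≡ l x) → ∀ t x → l (iter π t x) ≡ l x
iter-inv π l h zero x = refl
iter-inv π l h (suc t) x = trans (h _) (iter-inv π l h t x)

reachP-sound : ∀ {d} (p : Fin d → Fin d) i j → reachP p i j ≡ true → ∃ λ t → iter p t i ≡ j
reachP-sound {d} p i j h with anyFin-sound {suc d} (λ t → ⌊ iter p (toℕ t) i ≟F j ⌋) h
... | t , e = toℕ t , ⌊⌋-true {d = iter p (toℕ t) i ≟F j} e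

module Perm {d : ℕ} (π : Fin d → Fin d) (inj : ∀ x y → π x ≡ π y → x ≡ y) where

  iter-inj : ∀ t {x y} → iter π t x ≡ iter π t y → x ≡ y
  iter-inj zero e = e
  iter-inj (suc t) e = iter-inj t (inj _ _ e)

  iter-back : ∀ i j x → i < j → iter π i x ≡ iter π j x → iter π (j ∸ i) x ≡ x
  iter-back i j x i<j e = iter-inj i (trans (sym (iter-+ π i (j ∸ i) x)) (trans (cong (λ t → iter π t x) (m+[n∸m]≡n (<⇒≤ i<j))) (sym e)))

  returns : ∀ x → ∃ λ N → N < d × iter π (suc N) x ≡ x
  returns x with F.pigeonhole (n<1+n d) (λ t → iter π (toℕ t) x)
  ... | i , j , i<j , e with toℕ j ∸ toℕ i in q
  ...   | zero = ⊥-elim (<⇒≱ i<j (m∸n≡0⇒m≤n q))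
  ...   | suc N = N , ≤-trans (≤-trans (≤-reflexive (sym q)) (m∸n≤m (toℕ j) (toℕ i))) (F.toℕ≤pred[n] j) ,
            trans (cong (λ t → iter π t x) (sym q)) (iter-back (toℕ i) (toℕ j) x i<j e)

  private
    pl : ∀ x → Least (λ N → iter π (suc N) x ≡ x)
    pl x = least (λ N → iter π (suc N) x ≟F x) (proj₁ (returns x)) (proj₂ (proj₂ (returns x)))

  opaque
    per : Fin d → ℕ
    per x = suc (Least.at (pl x))

    per>0 : ∀ x → 0 < per x
    per>0 x = s≤s z≤n

    per-return : ∀ x → iter π (per x) x ≡ x
    per-return x = Least.holds (pl x)

    per-least : ∀ x t → 0 < t → iter π t x ≡ x → per x ≤ t
    per-least x (suc t) _ e = s≤s (least-≤ (pl x) t e)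

    per≤d : ∀ x → per x ≤ d
    per≤d x = ≤-trans (per-least x _ (s≤s z≤n) (proj₂ (proj₂ (returns x)))) (proj₁ (proj₂ (returns x)))

  iter-per : ∀ x t → iter π (t + per x) x ≡ iter π t x
  iter-per x t = trans (iter-+ π t (per x) x) (cong (iter π t) (per-return x))

  per-distinct : ∀ x i j → i < per x → j < per x → iter π i x ≡ iter π j x → i ≡ j
  per-distinct x i j i<p j<p e with <-cmp i j
  ... | tri≈ _ q _ = q
  ... | tri< lt _ _ = ⊥-elim (<⇒≱ (≤-<-trans (m∸n≤m j i) j<p) (per-least x (j ∸ i) (m<n⇒0<n∸m lt) (iter-back i j x lt e)))
  ... | tri> _ _ gt = ⊥-elim (<⇒≱ (≤-<-trans (m∸n≤m i j) i<p) (per-least x (i ∸ j) (m<n⇒0<n∸m gt) (iter-back j i x gt (sym e))))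

  per-shift : ∀ x → per (π x) ≡ per x
  per-shift x = ≤-antisym
    (per-least (π x) (per x) (per>0 x) (trans (sym (iter-suc π (per x) x)) (cong π (per-return x))))
    (per-least x (per (π x)) (per>0 (π x)) (inj _ _ (trans (iter-suc π (per (π x)) x) (per-return (π x)))))

  per-iter : ∀ t x → per (iter π t x) ≡ per x
  per-iter t x = iter-inv π per per-shift t x

  iter-below : ∀ x t → ∃ λ t' → t' < per x × iter π t' x ≡ iter π t x
  iter-below x zero = 0 , per>0 x , refl
  iter-below x (suc t) with iter-below x t
  ... | t' , lt , e with suc t' ≟ per x
  ...   | yes q = 0 , per>0 x , trans (sym (per-return x)) (trans (cong (λ s → iter π s x) (sym q)) (cong π e))
  ...   | no nq = suc t' , ≤∧≢⇒< lt nq , cong π e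

  inv : Fin d → Fin d
  inv x = iter π (pred (per x)) x

  π-inv : ∀ x → π (inv x) ≡ x
  π-inv x = trans (cong (λ t → iter π t x) (suc-pred (per x) {{>-nonZero (per>0 x)}})) (per-return x)

  inv-π : ∀ x → inv (π x) ≡ x
  inv-π x = inj _ _ (π-inv (π x))

  orbitSum : (Fin d → ℕ) → Fin d → ℕ
  orbitSum w x = sumN (per x) (λ t → w (iter π t x))

  orbitSum-shift : ∀ w x → orbitSum w (π x) ≡ orbitSum w x
  orbitSum-shift w x rewrite per-shift x =
    trans (sumN-cong (per x) λ t → cong w (sym (iter-suc π t x)))
      (sumN-shift (per x) (λ t → w (iter π t x)) (cong w (per-return x)))

  orbitSum-iter : ∀ w t x → orbitSum w (iter π t x) ≡ orbitSum w x
  orbitSum-iter w = iter-inv π (orbitSum w) (orbitSum-shift w)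

  orbitSum-π : ∀ w x → orbitSum (w ∘ π) x ≡ orbitSum w x
  orbitSum-π w x = sumN-shift (per x) (λ t → w (iter π t x)) (cong w (per-return x))

  -- A class may contain several orbits, hence only an inequality; it has the direction in which
  -- charges are bounded.
  orbitSum-class : {A : Set} (_≟_ : (x y : A) → Dec (x ≡ y)) (l : Fin d → A) → (∀ x → l (π x) ≡ l x) →
    ∀ w r → orbitSum w r ≤ sum (λ x → if ⌊ l x ≟ l r ⌋ then w x else 0)
  orbitSum-class _≟_ l h w r = ≤-trans
    (≤-reflexive (sumN-cong (per r) same))
    (sumN-inj≤ (per r) (λ t → iter π t r) (λ x → if ⌊ l x ≟ l r ⌋ then w x else 0) (per-distinct r))
    where
    same : ∀ t → w (iter π t r) ≡ (if ⌊ l (iter π t r) ≟ l r ⌋ then w (iter π t r) else 0)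
    same t with l (iter π t r) ≟ l r
    ... | yes _ = refl
    ... | no n = ⊥-elim (n (iter-inv π l h t r))

  reachP-complete : ∀ t x → reachP π x (iter π t x) ≡ true
  reachP-complete t x with iter-below x t
  ... | t' , lt , e = anyFin-complete {suc d} (λ s → ⌊ iter π (toℕ s) x ≟F iter π t x ⌋) (fromℕ< lt')
          (true-⌊⌋ {d = iter π (toℕ (fromℕ< lt')) x ≟F iter π t x} (trans (cong (λ s → iter π s x) (F.toℕ-fromℕ< lt')) e))
    where
    lt' = ≤-trans lt (≤-trans (per≤d x) (n≤1+n d))

-- Euler's inequality for subgraphs

module Euler (G : PlaneGraph) where
  open PlaneGraph G
  open RawMap vtx α σ using (components; isolated; faces; reachG; adjB)

  αOn : (Fin d → Bool) → Fin d → Fin d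
  αOn A x = if A x then α x else x

  φOn : (Fin d → Bool) → Fin d → Fin d
  φOn A x = σ (αOn A x)

  Closed : (Fin d → Bool) → Set
  Closed A = ∀ x → A (α x) ≡ A x

  αOn-inv : ∀ {A} → Closed A → ∀ x → αOn A (αOn A x) ≡ x
  αOn-inv {A} cl x with A x in e
  ... | false rewrite e = refl
  ... | true rewrite trans (cl x) e = α-inv x

  φOn-inj : ∀ {A} → Closed A → ∀ x y → φOn A x ≡ φOn A y → x ≡ y
  φOn-inj {A} cl x y e =
    trans (sym (αOn-inv cl x)) (trans (cong (αOn A) (σ-inj _ _ e)) (αOn-inv cl y))

  Constant : (Fin d → Bool) → (V → ℕ) → Set
  Constant A l = ∀ h → A h ≡ true → l (vtx h) ≡ l (vtx (α h))

  -- Euler's inequality for the subgraph with dart set A, phrased with arbitrary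
  -- vertex labelings instead of components; a dead dart stays at its vertex as a
  -- stub fixed by αOn, so that the orbits of φOn are the faces.
  EulerBound : (Fin d → Bool) → Set
  EulerBound A = ∀ l → Constant A l → ∃ λ (lam : Fin d → ℕ) → (∀ x → lam (φOn A x) ≡ lam x) ×
    4 * classes _≟_ l + countB A ≤ 2 * n + 2 * classes _≟_ lam + 2 * isolated

  remove : Fin d → (Fin d → Bool) → Fin d → Bool
  remove h A x = A x ∧ not (⌊ x ≟F h ⌋ ∨ ⌊ x ≟F α h ⌋)

  remove-keep : ∀ h A x → x ≢ h → x ≢ α h → remove h A x ≡ A x
  remove-keep h A x p q with A x | x ≟F h | x ≟F α h
  ... | true | no _ | no _ = refl
  ... | false | _ | _ = refl
  ... | true | yes e | _ = ⊥-elim (p e)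
  ... | true | no _ | yes e = ⊥-elim (q e)

  remove-h : ∀ h A → remove h A h ≡ false
  remove-h h A with A h | h ≟F h
  ... | false | _ = refl
  ... | true | yes _ = refl
  ... | true | no n = ⊥-elim (n refl)

  remove-αh : ∀ h A → remove h A (α h) ≡ false
  remove-αh h A with A (α h) | α h ≟F h | α h ≟F α h
  ... | false | _ | _ = refl
  ... | true | yes _ | _ = refl
  ... | true | no _ | yes _ = refl
  ... | true | no _ | no n = ⊥-elim (n refl)

  remove-closed : ∀ h A → Closed A → Closed (remove h A)
  remove-closed h A cl x with x ≟F h
  ... | yes refl = trans (remove-αh h A) (sym (∧-zeroʳ (A h)))
  ... | no p with x ≟F α h
  ...   | yes refl = trans (cong (remove h A) (α-inv h)) (trans (remove-h h A) (sym (∧-zeroʳ (A (α h)))))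
  ...   | no q = trans (remove-keep h A (α x) p' q') (trans (cl x) (sym (∧-identityʳ (A x))))
    where
    p' : α x ≢ h
    p' e = q (trans (sym (α-inv x)) (cong α e))
    q' : α x ≢ α h
    q' e = p (trans (sym (α-inv x)) (trans (cong α e) (α-inv h)))

  remove-count : ∀ h A → Closed A → A h ≡ true → 2 + countB (remove h A) ≤ countB A
  remove-count h A cl Ah = ≤-trans
    (s≤s (countB-strict (remove h A) B (α h) (remove-αh h A) Bα sub₁))
    (countB-strict B A h Bh Ah λ i e → proj₁ (∧-true e))
    where
    B : Fin d → Bool
    B x = A x ∧ not ⌊ x ≟F h ⌋
    Bα : B (α h) ≡ true
    Bα rewrite cl h | Ah with α h ≟F h
    ... | yes e = ⊥-elim (α-fpf h e)
    ... | no _ = refl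
    Bh : B h ≡ false
    Bh rewrite Ah with h ≟F h
    ... | yes _ = refl
    ... | no n = ⊥-elim (n refl)
    sub₁ : ∀ i → remove h A i ≡ true → B i ≡ true
    sub₁ i e with A i | i ≟F h
    ... | true | no _ = refl
    ... | true | yes _ = e
    ... | false | _ = e

  αOn-true : ∀ A x → A x ≡ true → αOn A x ≡ α x
  αOn-true A x e rewrite e = refl

  αOn-false : ∀ A x → A x ≡ false → αOn A x ≡ x
  αOn-false A x e rewrite e = refl

  module Step (A : Fin d → Bool) (cl : Closed A) (h : Fin d) (Ah : A h ≡ true) (ih : EulerBound A) where
    k = α h
    A' = remove h A
    φ = φOn A
    φ' = φOn A'
    open Perm φ (φOn-inj cl)

    Ak : A k ≡ true
    Ak = trans (cl h) Ah

    k≢h : k ≢ h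
    k≢h = α-fpf h

    φ'h : φ' h ≡ φ k
    φ'h = cong σ (trans (αOn-false A' h (remove-h h A)) (sym (trans (αOn-true A k Ak) (α-inv h))))

    φ'k : φ' k ≡ φ h
    φ'k = cong σ (trans (αOn-false A' k (remove-αh h A)) (sym (αOn-true A h Ah)))

    φ'-other : ∀ x → x ≢ h → x ≢ k → φ' x ≡ φ x
    φ'-other x p q = cong (λ b → σ (if b then α x else x)) (remove-keep h A x p q)

    u = vtx h
    w = vtx k

    constant : ∀ l → Constant A' l → l u ≡ l w → Constant A l
    constant l c e x Ax with x ≟F h
    ... | yes refl = e
    ... | no p with x ≟F k
    ...   | yes refl = trans (sym e) (cong (l ∘ vtx) (sym (α-inv h)))
    ...   | no q = c x (trans (remove-keep h A x p q) Ax)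

    cnt : 2 + countB A' ≤ countB A
    cnt = remove-count h A cl Ah

    -- Two faces merge: the loss of two darts balances the loss of one face class.
    ar₁ : ∀ {a b c f f' i} → 4 * a + b ≤ 2 * n + 2 * f + 2 * i → 2 + c ≤ b → f ≤ suc f' →
      4 * a + c ≤ 2 * n + 2 * f' + 2 * i
    ar₁ {a} {b} {c} {f} {f'} {i} p q r = +-cancelˡ-≤ 2 _ _ (begin
      2 + (4 * a + c) ≡⟨ e₁ a c ⟩
      4 * a + (2 + c) ≤⟨ +-monoʳ-≤ (4 * a) q ⟩
      4 * a + b ≤⟨ p ⟩
      2 * n + 2 * f + 2 * i ≤⟨ +-monoˡ-≤ (2 * i) (+-monoʳ-≤ (2 * n) (*-monoʳ-≤ 2 r)) ⟩
      2 * n + 2 * suc f' + 2 * i ≡⟨ e₂ n f' i ⟩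
      2 + (2 * n + 2 * f' + 2 * i) ∎)
      where
      open ≤-Reasoning
      e₁ : ∀ a c → 2 + (4 * a + c) ≡ 4 * a + (2 + c)
      e₁ = solve-∀
      e₂ : ∀ n f i → 2 * n + 2 * suc f + 2 * i ≡ 2 + (2 * n + 2 * f + 2 * i)
      e₂ = solve-∀

    -- A face splits: a possible new vertex class counts 4, balanced by the two lost darts and the
    -- new face class, 2 each.
    ar₂ : ∀ {a a' b c f f' i} → 4 * a' + b ≤ 2 * n + 2 * f + 2 * i → 2 + c ≤ b → suc f ≤ f' → a ≤ suc a' →
      4 * a + c ≤ 2 * n + 2 * f' + 2 * i
    ar₂ {a} {a'} {b} {c} {f} {f'} {i} p q r s = begin
      4 * a + c ≤⟨ +-monoˡ-≤ c (*-monoʳ-≤ 4 s) ⟩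
      4 * suc a' + c ≡⟨ e₁ a' c ⟩
      2 + (4 * a' + (2 + c)) ≤⟨ +-monoʳ-≤ 2 (+-monoʳ-≤ (4 * a') q) ⟩
      2 + (4 * a' + b) ≤⟨ +-monoʳ-≤ 2 p ⟩
      2 + (2 * n + 2 * f + 2 * i) ≡⟨ e₂ n f i ⟨
      2 * n + 2 * suc f + 2 * i ≤⟨ +-monoˡ-≤ (2 * i) (+-monoʳ-≤ (2 * n) (*-monoʳ-≤ 2 r)) ⟩
      2 * n + 2 * f' + 2 * i ∎
      where
      open ≤-Reasoning
      e₁ : ∀ a c → 4 * suc a + c ≡ 2 + (4 * a + (2 + c))
      e₁ = solve-∀
      e₂ : ∀ n f i → 2 * n + 2 * suc f + 2 * i ≡ 2 + (2 * n + 2 * f + 2 * i)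
      e₂ = solve-∀

    Result : (V → ℕ) → Set
    Result l = ∃ λ (lam : Fin d → ℕ) → (∀ x → lam (φ' x) ≡ lam x) ×
      4 * classes _≟_ l + countB A' ≤ 2 * n + 2 * classes _≟_ lam + 2 * isolated

    -- h and α h lie on different faces: the boundary of the face of h joins the ends of h
    differ : ∀ l → Constant A' l → (∀ t → iter φ t h ≢ k) → Result l
    differ l c far = lam' , inv' , ar₁ {a = classes _≟_ l} {i = isolated} (proj₂ (proj₂ old)) cnt (classes-merge _≟_ (lam h) (lam k) lam)
      where
      walk : ∀ t → t < per h → l (vtx (iter φ (suc t) h)) ≡ l w
      walk zero _ = cong l (trans (σ-vtx _) (cong vtx (αOn-true A h Ah)))
      walk (suc t) lt = trans (one (iter φ (suc t) h) ne (far (suc t))) (walk t (<-trans (n<1+n t) lt))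
        where
        ne : iter φ (suc t) h ≢ h
        ne e = <⇒≱ lt (per-least h (suc t) (s≤s z≤n) e)
        one : ∀ x → x ≢ h → x ≢ k → l (vtx (φ x)) ≡ l (vtx x)
        one x p q rewrite σ-vtx (αOn A x) with A x in e
        ... | false = refl
        ... | true = sym (c x (trans (remove-keep h A x p q) e))
      uw : l u ≡ l w
      uw with per h | per>0 h | per-return h | walk
      ... | suc t | _ | r | wk = trans (cong (l ∘ vtx) (sym r)) (wk t ≤-refl)
      old = ih l (constant l c uw)
      lam = proj₁ old
      lam-inv = proj₁ (proj₂ old)
      lam' = merge _≟_ (lam h) (lam k) lam
      lamh : lam' h ≡ lam k
      lamh = merge-a _≟_ (lam h) (lam k) lam h refl
      lamk : lam' k ≡ lam k
      lamk = merge-b _≟_ (lam h) (lam k) lam k refl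
      push : ∀ x → lam' (φ x) ≡ lam' x
      push x = merge-cong _≟_ (lam h) (lam k) lam (φ x) x (lam-inv x)
      inv'' : ∀ x → Dec (x ≡ h) → Dec (x ≡ k) → lam' (φ' x) ≡ lam' x
      inv'' x (yes refl) _ = trans (cong lam' φ'h) (trans (push k) (trans lamk (sym lamh)))
      inv'' x (no p) (yes refl) = trans (cong lam' φ'k) (trans (push h) (trans lamh (sym lamk)))
      inv'' x (no p) (no q) = trans (cong lam' (φ'-other x p q)) (push x)
      inv' : ∀ x → lam' (φ' x) ≡ lam' x
      inv' x = inv'' x (x ≟F h) (x ≟F k)

    -- Packs an old face label and one bit into a number, so that the two parts of a split face can
    -- be told apart.
    double : ℕ → Bool → ℕ
    double a b = bit b + 2 * a

    double-inj : ∀ a b a' b' → double a b ≡ double a' b' → a ≡ a' × b ≡ b'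
    double-inj a true a' true e = *-cancelˡ-≡ a a' 2 (suc-injective e) , refl
    double-inj a false a' false e = *-cancelˡ-≡ a a' 2 e , refl
    double-inj a true a' false e = ⊥-elim (odd a a' e)
      where
      odd : ∀ a b → suc (2 * a) ≢ 2 * b
      odd a zero ()
      odd zero (suc b) e with trans e (cong suc (+-suc b (b + 0)))
      ... | ()
      odd (suc a) (suc b) e = odd a b (suc-injective (suc-injective
        (trans (cong (λ z → suc (suc z)) (sym (+-suc a (a + 0)))) (trans e (cong suc (+-suc b (b + 0)))))))
    double-inj a false a' true e with double-inj a' true a false (sym e)
    ... | p , q = sym p , sym q

    -- h and α h lie on the same face, which removing the edge splits in two
    split : ∀ l → Constant A' l → ∀ t → t < per h → iter φ t h ≡ k → Result l
    split l c t t<p e = lam' , inv' , ar₂ {a = classes _≟_ l} {a' = classes _≟_ l₁} {i = isolated} (proj₂ (proj₂ old)) cnt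
        (classes-strict _≟_ _≟_ lam lam' (λ a b q → proj₁ (double-inj (lam a) (inX a) (lam b) (inX b) q)) h k
          (sym (trans (cong lam (sym e)) (iter-inv φ lam lam-inv t h)))
          λ q → true≢false (trans (sym k∈X) (trans (sym (proj₂ (double-inj (lam h) (inX h) (lam k) (inX k) q))) h∉X)))
        (classes-merge _≟_ (l u) (l w) l)
      where
      -- The deleted edge may be a bridge, so `l` need not agree on its ends; the induction
      -- hypothesis is applied after merging the two labels.
      l₁ = merge _≟_ (l u) (l w) l
      old = ih l₁ (constant l₁ (λ x q → merge-cong _≟_ (l u) (l w) l _ _ (c x q))
        (trans (merge-a _≟_ (l u) (l w) l u refl) (sym (merge-b _≟_ (l u) (l w) l w refl))))
      lam = proj₁ old
      lam-inv = proj₁ (proj₂ old)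
      t>0 : 0 < t
      t>0 = n≢0⇒n>0 λ z → k≢h (trans (sym e) (cong (λ s → iter φ s h) z))
      -- The positions 1 to `t` after `h`, of which the last is `k`. Since `φ'` sends `k` to
      -- position 1 and `h` past `k`, this set is closed under `φ'`.
      InX : Fin d → Set
      InX x = ∃ λ (j : Fin t) → iter φ (suc (toℕ j)) h ≡ x
      inX? : ∀ x → Dec (InX x)
      inX? x = F.any? λ j → iter φ (suc (toℕ j)) h ≟F x
      inX : Fin d → Bool
      inX x = ⌊ inX? x ⌋
      mkX : ∀ j → j < t → InX (iter φ (suc j) h)
      mkX j lt = fromℕ< lt , cong (λ s → iter φ (suc s) h) (F.toℕ-fromℕ< lt)
      iffX : ∀ x y → (InX x → InX y) → (InX y → InX x) → inX y ≡ inX x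
      iffX x y f g with inX? x | inX? y
      ... | yes _ | yes _ = refl
      ... | no _ | no _ = refl
      ... | yes p | no q = ⊥-elim (q (f p))
      ... | no p | yes q = ⊥-elim (p (g q))
      noX : ¬ InX h
      noX (j , q) = <⇒≱ (≤-<-trans (F.toℕ<n j) t<p) (per-least h (suc (toℕ j)) (s≤s z≤n) q)
      Xk : InX k
      Xk = subst InX (trans (cong (λ s → iter φ s h) sp) e) (mkX (pred t) (≤-reflexive sp))
        where
        sp : suc (pred t) ≡ t
        sp = suc-pred t {{>-nonZero t>0}}
      h∉X : inX h ≡ false
      h∉X with inX? h
      ... | yes p = ⊥-elim (noX p)
      ... | no _ = refl
      k∈X : inX k ≡ true
      k∈X = true-⌊⌋ {d = inX? k} Xk
      lam' : Fin d → ℕ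
      lam' x = double (lam x) (inX x)
      lamhk : lam h ≡ lam k
      lamhk = sym (trans (cong lam (sym e)) (iter-inv φ lam lam-inv t h))
      inv'' : ∀ x → Dec (x ≡ h) → Dec (x ≡ k) → lam' (φ' x) ≡ lam' x
      inv'' x (yes refl) _ = cong₂ double (trans (cong lam φ'h) (trans (lam-inv k) (sym lamhk)))
              (iffX h (φ' h) (⊥-elim ∘ noX) back)
        where
        back : InX (φ' h) → InX h
        back (j , q) with toℕ j | F.toℕ<n j | φOn-inj cl _ _ (trans q (trans φ'h (cong φ (sym e))))
        ... | i | i<t | r = ⊥-elim (<⇒≢ i<t (per-distinct h i t (<-trans i<t t<p) t<p r))
      inv'' x (no p) (yes refl) = cong₂ double (trans (cong lam φ'k) (trans (lam-inv h) lamhk))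
              (iffX k (φ' k) (λ _ → subst InX (sym φ'k) (mkX 0 t>0)) (λ _ → Xk))
      inv'' x (no p) (no q) = cong₂ double (trans (cong lam (φ'-other x p q)) (lam-inv x))
              (iffX x (φ' x) fwd bwd)
        where
        fwd : InX x → InX (φ' x)
        fwd (j , r) = subst InX (trans (cong φ r) (sym (φ'-other x p q))) (mkX (suc (toℕ j)) lt)
          where
          lt : suc (toℕ j) < t
          lt = ≤∧≢⇒< (F.toℕ<n j) λ z → q (trans (sym r) (trans (cong (λ s → iter φ s h) z) e))
        bwd : InX (φ' x) → InX x
        bwd (j , r) with toℕ j | F.toℕ<n j | φOn-inj cl _ _ (trans r (φ'-other x p q))
        ... | zero | _ | z = ⊥-elim (p (sym z))
        ... | suc i | i<t | z = subst InX z (mkX i (<-trans (n<1+n i) i<t))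
      inv' : ∀ x → lam' (φ' x) ≡ lam' x
      inv' x = inv'' x (x ≟F h) (x ≟F k)

    step : EulerBound A'
    step l c with reachP φ h k in r
    ... | true with reachP-sound φ h k r
    ...   | t , e with iter-below h t
    ...     | t' , lt , e' = split l c t' lt (trans e' e)
    step l c | false = differ l c λ t q → true≢false (trans (sym (reachP-complete t h)) (trans (cong (reachP φ h) q) r))

  bound-cong : ∀ A B → (∀ x → A x ≡ B x) → EulerBound A → EulerBound B
  bound-cong A B eq b l c with b l (λ h q → c h (trans (sym (eq h)) q))
  ... | lam , i , le = lam ,
    (λ x → trans (cong (λ b → lam (σ (if b then α x else x))) (sym (eq x))) (i x)) ,
    subst (λ z → 4 * classes _≟_ l + z ≤ _) cnt le
    where
    cnt : countB A ≡ countB B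
    cnt = trans (countB-sum A) (trans (sum-cong-≗ λ i → cong bit (eq i)) (sym (countB-sum B)))

  descend : ∀ f A B → countB A < f → Closed A → Closed B → (∀ x → B x ≡ true → A x ≡ true) →
    EulerBound A → EulerBound B
  descend (suc f) A B (s≤s lt) clA clB sub b with F.any? (λ h → (A h ≟B true) ×-dec (B h ≟B false))
  ... | yes (h , Ah , Bh) = descend f (remove h A) B
        (≤-trans (≤-trans (n≤1+n _) (remove-count h A clA Ah)) lt)
        (remove-closed h A clA) clB sub' (Step.step A clA h Ah b)
    where
    sub' : ∀ x → B x ≡ true → remove h A x ≡ true
    sub' x Bx = trans (remove-keep h A x
      (λ e → true≢false (trans (sym Bx) (trans (cong B e) Bh)))
      (λ e → true≢false (trans (sym Bx) (trans (cong B e) (trans (clB h) Bh))))) (sub x Bx)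
  ... | no none = bound-cong A B eq b
    where
    eq : ∀ x → A x ≡ B x
    eq x with A x ≟B true
    ... | no q = trans (¬true q) (sym (¬true (q ∘ sub x)))
    ... | yes p with B x ≟B true
    ...   | yes q = trans p (sym q)
    ...   | no q = ⊥-elim (none (x , p , ¬true q))

  reachG-sound : ∀ (l : V → ℕ) → (∀ h → l (vtx h) ≡ l (vtx (α h))) → ∀ k u v → reachG k u v ≡ true → l u ≡ l v
  reachG-sound l c zero u v e = cong l (⌊⌋-true {d = u ≟F v} e)
  reachG-sound l c (suc k) u v e with ∨-true {reachG k u v} e
  ... | inj₁ p = reachG-sound l c k u v p
  ... | inj₂ p with anyFin-sound (λ w → reachG k u w ∧ adjB w v) p
  ...   | w , q with ∧-true {reachG k u w} q
  ...     | q₁ , q₂ with anyFin-sound (λ h → ⌊ vtx h ≟F w ⌋ ∧ ⌊ vtx (α h) ≟F v ⌋) q₂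
  ...       | h , r with ∧-true {⌊ vtx h ≟F w ⌋} r
  ...         | r₁ , r₂ = trans (reachG-sound l c k u w q₁)
    (trans (cong l (sym (⌊⌋-true {d = vtx h ≟F w} r₁))) (trans (c h) (cong l (⌊⌋-true {d = vtx (α h) ≟F v} r₂))))

  full : Fin d → Bool
  full _ = true

  -- A face is labelled by the least dart of its orbit. Two inequalities suffice: distinct orbits
  -- have distinct labels, and a labeling constant along edges has at most as many classes as there
  -- are components.
  bound-full : EulerBound full
  bound-full l c = lam , lam-inv , (begin
      4 * classes _≟_ l + countB full ≡⟨ cong (4 * classes _≟_ l +_) (trans (countB-sum full) (trans (sum-const d 1) (*-identityʳ d))) ⟩
      4 * classes _≟_ l + d ≤⟨ +-monoˡ-≤ d (*-monoʳ-≤ 4 comp) ⟩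
      4 * components + d ≡⟨ euler ⟨
      2 * n + 2 * faces + 2 * isolated ≤⟨ +-monoˡ-≤ (2 * isolated) (+-monoʳ-≤ (2 * n) (*-monoʳ-≤ 2 fac)) ⟩
      2 * n + 2 * classes _≟_ lam + 2 * isolated ∎)
    where
    open ≤-Reasoning
    φ = σ ∘ α
    φ-inj : ∀ x y → φ x ≡ φ y → x ≡ y
    φ-inj = φOn-inj {full} (λ _ → refl)
    open Perm φ φ-inj
    P : Fin d → ℕ → Set
    P x m = ∃ λ i → toℕ i ≡ m × reachP φ x i ≡ true
    P? : ∀ x m → Dec (P x m)
    P? x m = F.any? λ i → (toℕ i ≟ m) ×-dec (reachP φ x i ≟B true)
    lst : ∀ x → Least (P x)
    lst x = least (P? x) (toℕ x) (x , refl , reachP-complete 0 x)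
    lam : Fin d → ℕ
    lam x = Least.at (lst x)
    symm : ∀ x y → reachP φ x y ≡ true → ∃ λ t → iter φ t y ≡ x
    symm x y r with reachP-sound φ x y r
    ... | t , e with iter-below x t
    ...   | t' , lt , e' = per x ∸ t' , trans (cong (iter φ (per x ∸ t')) (sym (trans e' e)))
            (trans (sym (iter-+ φ (per x ∸ t') t' x)) (trans (cong (λ s → iter φ s x) (m∸n+n≡m (<⇒≤ lt))) (per-return x)))
    P-φ : ∀ x m → P (φ x) m → P x m
    P-φ x m (i , e , r) with reachP-sound φ (φ x) i r
    ... | t , q = i , e , subst (λ z → reachP φ x z ≡ true) (trans (iter-suc φ t x) q) (reachP-complete (suc t) x)
    P-φ' : ∀ x m → P x m → P (φ x) m
    P-φ' x m (i , e , r) with reachP-sound φ x i r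
    ... | t , q = i , e , subst (λ z → reachP φ (φ x) z ≡ true) z (reachP-complete (t + pred (per x)) (φ x))
      where
      z : iter φ (t + pred (per x)) (φ x) ≡ i
      z = trans (sym (iter-suc φ (t + pred (per x)) x))
        (trans (cong (λ s → iter φ s x) (trans (sym (+-suc t _)) (cong (t +_) (suc-pred (per x) {{>-nonZero (per>0 x)}}))))
          (trans (iter-per x t) q))
    lam-inv : ∀ x → lam (φ x) ≡ lam x
    lam-inv x = ≤-antisym
      (least-≤ (lst (φ x)) (lam x) (P-φ' x _ (Least.holds (lst x))))
      (least-≤ (lst x) (lam (φ x)) (P-φ x _ (Least.holds (lst (φ x)))))
    fac : faces ≤ classes _≟_ lam
    fac = countB-mono (λ i → allFin (λ j → not (⌊ j <F? i ⌋ ∧ reachP φ j i))) (firstB _≟_ lam) λ i p →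
      first-complete _≟_ lam i λ u u<i e → bad i p u u<i e
      where
      bad : ∀ i → allFin (λ j → not (⌊ j <F? i ⌋ ∧ reachP φ j i)) ≡ true → ∀ u → u <F i → lam u ≢ lam i
      bad i p u u<i e with Least.holds (lst u) | Least.holds (lst i)
      ... | a , ae , ar | b , be , br with F.toℕ-injective (trans ae (trans e (sym be)))
      ...   | refl with reachP-sound φ u a ar | symm i a br
      ...     | t , te | s , se = ⊥-elim (true≢false (sym (trans (sym q) (allFin-sound _ p u))))
        where
        r : reachP φ u i ≡ true
        r = subst (λ z → reachP φ u z ≡ true) (trans (iter-+ φ s t u) (trans (cong (iter φ s) te) se)) (reachP-complete (s + t) u)
        q : not (⌊ u <F? i ⌋ ∧ reachP φ u i) ≡ false
        q rewrite true-⌊⌋ {d = u <F? i} u<i | r = refl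
    comp : classes _≟_ l ≤ components
    comp = countB-mono (firstB _≟_ l) _ λ v p → allFin-complete _ λ u → ok v p u
      where
      ok : ∀ v → firstB _≟_ l v ≡ true → ∀ u → not (⌊ u <F? v ⌋ ∧ reachG n u v) ≡ true
      ok v p u with u <F? v
      ... | no _ = refl
      ... | yes u<v with reachG n u v in r
      ...   | false = refl
      ...   | true = ⊥-elim (first-sound _≟_ l v p u u<v (reachG-sound l (λ h → c h refl) n u v r))

  euler-bound : ∀ A → Closed A → EulerBound A
  euler-bound A cl = descend (suc (countB full)) full A ≤-refl (λ _ → refl) cl (λ _ _ → refl) bound-full

  -- S as one class and every other vertex as its own class
  euler-subset : ∀ A → Closed A → (S : V → Bool) → (∀ h → A h ≡ true → S (vtx h) ≡ true) → (∃ λ v → S v ≡ true) →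
    ∃ λ (lam : Fin d → ℕ) → (∀ x → lam (φOn A x) ≡ lam x) ×
      4 * suc (countB (not ∘ S)) + countB A ≤ 2 * n + 2 * classes _≟_ lam + 2 * isolated
  euler-subset A cl S AS (v , Sv) with euler-bound A cl l c
    where
    l : V → ℕ
    l x = if S x then 0 else suc (toℕ x)
    c : Constant A l
    c h Ah rewrite AS h Ah | AS (α h) (trans (cl h) Ah) = refl
  ... | lam , i , le = lam , i , ≤-trans (+-monoˡ-≤ (countB A) (*-monoʳ-≤ 4 many)) le
    where
    l : V → ℕ
    l x = if S x then 0 else suc (toℕ x)
    P : ℕ → Set
    P m = ∃ λ i → toℕ i ≡ m × S i ≡ true
    lst : Least P
    lst = least (λ m → F.any? λ i → (toℕ i ≟ m) ×-dec (S i ≟B true)) (toℕ v) (v , refl , Sv)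
    s = proj₁ (Least.holds lst)
    Ss = proj₂ (proj₂ (Least.holds lst))
    l-S : ∀ x → S x ≡ true → l x ≡ 0
    l-S x e rewrite e = refl
    many : suc (countB (not ∘ S)) ≤ classes _≟_ l
    many = countB-strict (not ∘ S) (firstB _≟_ l) s (cong not Ss)
      (first-complete _≟_ l s λ u u<s e → Least.below lst (toℕ u) (≤-trans u<s (≤-reflexive (proj₁ (proj₂ (Least.holds lst))))) (u , refl , inS u (trans e (l-S s Ss))))
      λ i e → first-complete _≟_ l i λ u u<i q → out i u e u<i q
      where
      inS : ∀ u → l u ≡ 0 → S u ≡ true
      inS u e with S u
      ... | true = refl
      inS u () | false
      out : ∀ i u → not (S i) ≡ true → u <F i → l u ≢ l i
      out i u e u<i q with S i | S u
      out i u e u<i q | false | false = <⇒≢ u<i (suc-injective q)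
      out i u e u<i () | false | true
      out i u () u<i q | true | _

-- Faces of an induced subgraph

module Rotation (G : PlaneGraph) (S : Fin (PlaneGraph.n G) → Bool) where
  open PlaneGraph G
  open Euler G public using (αOn; φOn; Closed; φOn-inj)
  open Perm σ σ-inj using () renaming (per to perσ; per>0 to perσ>0; per-return to perσ-return; iter-inj to iterσ-inj; iter-back to iterσ-back)

  alive : Fin d → Bool
  alive h = S (vtx h) ∧ S (vtx (α h))

  Alive : Fin d → Set
  Alive h = alive h ≡ true

  alive-closed : Closed alive
  alive-closed x rewrite α-inv x = ∧-comm (S (vtx (α x))) (S (vtx x))

  alive-α : ∀ {h} → Alive h → Alive (α h)
  alive-α {h} a = trans (alive-closed h) a

  alive-S : ∀ {h} → Alive h → S (vtx h) ≡ true
  alive-S a = proj₁ (∧-true a)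

  mkAlive : ∀ h → S (vtx h) ≡ true → S (vtx (α h)) ≡ true → Alive h
  mkAlive h p q rewrite p | q = refl

  iterσ-vtx : ∀ t h → vtx (iter σ t h) ≡ vtx h
  iterσ-vtx = iter-inv σ vtx σ-vtx

  private
    -- The second alternative makes the search end also at a dead dart whose vertex has no alive
    -- dart.
    Stop : Fin d → ℕ → Set
    Stop h t = alive (iter σ (suc t) h) ≡ true ⊎ iter σ (suc t) h ≡ h
    stop : ∀ h → Least (Stop h)
    stop h = least (λ t → (alive (iter σ (suc t) h) ≟B true) ⊎-dec (iter σ (suc t) h ≟F h)) (pred (perσ h))
      (inj₂ (trans (cong (λ s → iter σ s h) (suc-pred (perσ h) {{>-nonZero (perσ>0 h)}})) (perσ-return h)))
    gap : Fin d → ℕ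
    gap h = Least.at (stop h)

    gap-alive : ∀ h → Alive h → Alive (iter σ (suc (gap h)) h)
    gap-alive h a with Least.holds (stop h)
    ... | inj₁ e = e
    ... | inj₂ e = trans (cong alive e) a

    gap-dead : ∀ h t → t < gap h → alive (iter σ (suc t) h) ≡ false
    gap-dead h t lt = ¬true (Least.below (stop h) t lt ∘ inj₁)

  opaque
    -- The rotation of the induced subgraph. Dead darts are fixed, so that it is still an injection
    -- of `Fin d`.
    sg : Fin d → Fin d
    sg h = if alive h then iter σ (suc (gap h)) h else h

    private
      sg-alive : ∀ h → Alive h → sg h ≡ iter σ (suc (gap h)) h
      sg-alive h a rewrite a = refl

    sg-dead : ∀ h → alive h ≡ false → sg h ≡ h
    sg-dead h a rewrite a = refl

    alive-sg : ∀ {h} → Alive h → Alive (sg h)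
    alive-sg {h} a = trans (cong alive (sg-alive h a)) (gap-alive h a)

    vtx-sg : ∀ h → vtx (sg h) ≡ vtx h
    vtx-sg h with alive h
    ... | true = iterσ-vtx (suc (gap h)) h
    ... | false = refl

    private
      clash : ∀ x y → Alive x → Alive y → gap x < gap y → sg x ≡ sg y → ⊥
      clash x y p q lt e = true≢false (trans (sym p) (trans (cong alive eq) (gap-dead y (gap y ∸ suc (gap x)) below)))
        where
        m+ : suc (gap x) + suc (gap y ∸ suc (gap x)) ≡ suc (gap y)
        m+ = trans (+-suc (suc (gap x)) _) (cong suc (m+[n∸m]≡n lt))
        eq : x ≡ iter σ (suc (gap y ∸ suc (gap x))) y
        eq = iterσ-inj (suc (gap x)) (trans (sym (sg-alive x p)) (trans e (trans (sg-alive y q)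
          (trans (cong (λ s → iter σ s y) (sym m+)) (iter-+ σ (suc (gap x)) _ y)))))
        below : gap y ∸ suc (gap x) < gap y
        below = ∸-monoʳ-< (s≤s z≤n) lt

    sg-inj : ∀ x y → sg x ≡ sg y → x ≡ y
    sg-inj x y e with alive x ≟B true | alive y ≟B true
    ... | no p | no q = trans (sym (sg-dead x (¬true p))) (trans e (sg-dead y (¬true q)))
    ... | yes p | no q = ⊥-elim (q (trans (cong alive (trans (sym (sg-dead y (¬true q))) (sym e))) (alive-sg p)))
    ... | no p | yes q = ⊥-elim (p (trans (cong alive (trans (sym (sg-dead x (¬true p))) e)) (alive-sg q)))
    ... | yes p | yes q with <-cmp (gap x) (gap y)
    ...   | tri≈ _ g _ = iterσ-inj (suc (gap x)) (trans (sym (sg-alive x p)) (trans e (trans (sg-alive y q) (cong (λ t → iter σ (suc t) y) (sym g)))))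
    ...   | tri< lt _ _ = ⊥-elim (clash x y p q lt e)
    ...   | tri> _ _ gt = ⊥-elim (clash y x q p gt (sym e))

    sg-transitive : ∀ h k → Alive h → Alive k → vtx h ≡ vtx k → ∃ λ t → iter sg t h ≡ k
    sg-transitive h k ah ak e with reachP-sound σ h k (σ-trans h k e)
    ... | t , q = go (suc t) h ah t ≤-refl q
      where
      go : ∀ f h → Alive h → ∀ t → t < f → iter σ t h ≡ k → ∃ λ t → iter sg t h ≡ k
      go (suc f) h ah zero _ q = 0 , q
      go (suc f) h ah (suc t) (s≤s lt) q with gap h ≤? t
      ... | no g = ⊥-elim (true≢false (trans (sym ak) (trans (cong alive (sym q)) (gap-dead h t (≰⇒> g)))))
      ... | yes g with go f (sg h) (alive-sg ah) (t ∸ gap h) (≤-<-trans (m∸n≤m t (gap h)) lt)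
                    (trans (cong (iter σ (t ∸ gap h)) (sg-alive h ah)) (trans (sym (iter-+ σ (t ∸ gap h) (suc (gap h)) h))
                      (trans (cong (λ s → iter σ s h) (trans (+-suc (t ∸ gap h) (gap h)) (cong suc (m∸n+n≡m g)))) q)))
      ...   | s , r = suc s , trans (iter-suc sg s h) r

    -- The dead darts skipped by `sg` are stubs fixed by `αOn`: `φOn` passes them one by one without
    -- leaving the face, so its labels are constant along the shorter boundary as well.
    sg-φ : {A : Set} (l : Fin d → A) → (∀ x → l (φOn alive x) ≡ l x) → ∀ h → Alive h → l (sg (α h)) ≡ l h
    sg-φ l inv h a = trans (cong l (sg-alive (α h) (alive-α a))) (go (gap (α h)) ≤-refl)
      where
      go : ∀ t → t ≤ gap (α h) → l (iter σ (suc t) (α h)) ≡ l h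
      go zero _ = trans (cong (λ b → l (σ (if b then α h else h))) (sym a)) (inv h)
      go (suc t) lt = trans (cong (λ b → l (σ (if b then α y else y))) (sym (gap-dead (α h) t lt))) (trans (inv y) (go t (<⇒≤ lt)))
        where
        y : Fin d
        y = iter σ (suc t) (α h)

  opaque
    ψ : Fin d → Fin d
    ψ h = sg (αOn alive h)

    ψ-alive : ∀ {h} → Alive h → ψ h ≡ sg (α h)
    ψ-alive a rewrite a = refl

    ψ-inj : ∀ x y → ψ x ≡ ψ y → x ≡ y
    ψ-inj x y e = trans (sym (αOn-inv' x)) (trans (cong (αOn alive) (sg-inj _ _ e)) (αOn-inv' y))
      where
      αOn-inv' : ∀ x → αOn alive (αOn alive x) ≡ x
      αOn-inv' = Euler.αOn-inv G alive-closed

    ψ-inv : {A : Set} (l : Fin d → A) → (∀ x → l (φOn alive x) ≡ l x) → ∀ x → l (ψ x) ≡ l x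
    ψ-inv l inv x with alive x ≟B true
    ... | yes a = trans (cong l (ψ-alive a)) (sg-φ l inv x a)
    ... | no na = cong l (trans (cong (λ b → sg (if b then α x else x)) (¬true na)) (sg-dead x (¬true na)))

  alive-ψ : ∀ {h} → Alive h → Alive (ψ h)
  alive-ψ a = trans (cong alive (ψ-alive a)) (alive-sg (alive-α a))

  vtx-ψ : ∀ {h} → Alive h → vtx (ψ h) ≡ vtx (α h)
  vtx-ψ {h} a = trans (cong vtx (ψ-alive a)) (vtx-sg (α h))

  alive-iterψ : ∀ t {h} → Alive h → Alive (iter ψ t h)
  alive-iterψ zero a = a
  alive-iterψ (suc t) a = alive-ψ (alive-iterψ t a)

  alive-itersg : ∀ t {h} → Alive h → Alive (iter sg t h)
  alive-itersg zero a = a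
  alive-itersg (suc t) a = alive-sg (alive-itersg t a)

  vtx-itersg : ∀ t h → vtx (iter sg t h) ≡ vtx h
  vtx-itersg = iter-inv sg vtx vtx-sg

  module RS = Perm sg sg-inj
  module RF = Perm ψ ψ-inj

  -- Degree in the subgraph induced by `S`. Likewise `len` is the length of a boundary walk in which
  -- vertices may repeat, so that a face is not known to be a cycle.
  deg : Fin d → ℕ
  deg = RS.per

  len : Fin d → ℕ
  len = RF.per

  neighbour : ∀ h u → Alive h → Adj (vtx h) u → S u ≡ true → ∃ λ t → t < deg h × vtx (α (iter sg t h)) ≡ u
  neighbour h u a (k , e , refl) Su with sg-transitive h k a (mkAlive k (trans (cong S e) (alive-S a)) Su) (sym e)
  ... | t , q with RS.iter-below h t
  ...   | t' , lt , e' = t' , lt , cong (vtx ∘ α) (trans e' q)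

-- Partial colourings

data Col : Set where
  none cI cF : Col

_≟C_ : (a b : Col) → Dec (a ≡ b)
none ≟C none = yes refl
none ≟C cI = no λ ()
none ≟C cF = no λ ()
cI ≟C none = no λ ()
cI ≟C cI = yes refl
cI ≟C cF = no λ ()
cF ≟C none = no λ ()
cF ≟C cI = no λ ()
cF ≟C cF = yes refl

module Colouring (G : PlaneGraph) where
  open PlaneGraph G

  adj? : ∀ u v → Dec (Adj u v)
  adj? u v = F.any? λ h → (vtx h ≟F u) ×-dec (vtx (α h) ≟F v)

  adj-sym : ∀ {u v} → Adj u v → Adj v u
  adj-sym (h , refl , refl) = α h , refl , cong vtx (α-inv h)

  adj-≢ : ∀ {u v} → Adj u v → u ≢ v
  adj-≢ (h , refl , refl) e = loopless h (sym e)

  -- A finite graph has a cycle exactly when some nonempty vertex set induces minimum degree at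
  -- least 2. In this form acyclicity matches strict degeneracy with value 2 directly.
  Leafless : (V → Bool) → Set
  Leafless K = ∀ z → K z ≡ true → ∃₂ λ a b → a ≢ b × (Adj z a × K a ≡ true) × (Adj z b × K b ≡ true)

  record Valid (κ : V → Col) : Set where
    field
      ind : ∀ u v → Adj u v → κ u ≡ cI → κ v ≡ cI → ⊥
      forest : ∀ K x → K x ≡ true → (∀ y → K y ≡ true → κ y ≡ cF) → ¬ Leafless K

  _[_≔_] : (V → Col) → V → Col → V → Col
  (κ [ v ≔ c ]) x = if ⌊ x ≟F v ⌋ then c else κ x

  set-≡ : ∀ κ v c {x} → x ≡ v → (κ [ v ≔ c ]) x ≡ c
  set-≡ κ v c {x} e with x ≟F v
  ... | yes _ = refl
  ... | no n = ⊥-elim (n e)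

  set-≢ : ∀ κ v c {x} → x ≢ v → (κ [ v ≔ c ]) x ≡ κ x
  set-≢ κ v c {x} ne with x ≟F v
  ... | yes e = ⊥-elim (ne e)
  ... | no _ = refl

  restrict-valid : ∀ {κ κ'} → Valid κ → (∀ x → κ' x ≡ none ⊎ κ' x ≡ κ x) → Valid κ'
  restrict-valid {κ} {κ'} V h = record
    { ind = λ u v a p q → Valid.ind V u v a (up u p λ ()) (up v q λ ())
    ; forest = λ K x Kx f → Valid.forest V K x Kx λ y Ky → up y (f y Ky) λ () }
    where
    up : ∀ x {c} → κ' x ≡ c → c ≢ none → κ x ≡ c
    up x e n with h x
    ... | inj₁ z = ⊥-elim (n (trans (sym e) z))
    ... | inj₂ z = trans (sym z) e

  set-none : ∀ {κ} v → Valid κ → Valid (κ [ v ≔ none ])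
  set-none {κ} v V = restrict-valid V λ x → case x ≟F v of λ where
    (yes e) → inj₁ (set-≡ κ v none e)
    (no ne) → inj₂ (set-≢ κ v none ne)

  set-I : ∀ {κ} v → Valid κ → (∀ u → Adj v u → κ u ≢ cI) → Valid (κ [ v ≔ cI ])
  set-I {κ} v V h = record { ind = ind' ; forest = λ K x Kx f → Valid.forest V K x Kx λ y Ky → down y (f y Ky) }
    where
    down : ∀ y → (κ [ v ≔ cI ]) y ≡ cF → κ y ≡ cF
    down y e with y ≟F v
    ... | no _ = e
    ... | yes _ with e
    ...   | ()
    ind' : ∀ u w → Adj u w → (κ [ v ≔ cI ]) u ≡ cI → (κ [ v ≔ cI ]) w ≡ cI → ⊥
    ind' u w a p q with u ≟F v | w ≟F v
    ... | yes refl | yes refl = adj-≢ a refl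
    ... | yes refl | no _ = h w a q
    ... | no _ | yes refl = h u (adj-sym a) p
    ... | no _ | no _ = Valid.ind V u w a p q

  -- A leafless set through `v` would need two neighbours of `v` in `cF`; one that avoids `v` was
  -- present before.
  set-F : ∀ {κ} v → Valid κ → (∀ a b → Adj v a → Adj v b → κ a ≡ cF → κ b ≡ cF → a ≡ b) → Valid (κ [ v ≔ cF ])
  set-F {κ} v V h = record { ind = ind' ; forest = forest' }
    where
    ind' : ∀ u w → Adj u w → (κ [ v ≔ cF ]) u ≡ cI → (κ [ v ≔ cF ]) w ≡ cI → ⊥
    ind' u w a p q with u ≟F v | w ≟F v
    ind' u w a () q | yes _ | _
    ind' u w a p () | no _ | yes _
    ... | no _ | no _ = Valid.ind V u w a p q
    forest' : ∀ K x → K x ≡ true → (∀ y → K y ≡ true → (κ [ v ≔ cF ]) y ≡ cF) → ¬ Leafless K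
    forest' K x Kx f lf with K v ≟B true
    ... | no nKv = Valid.forest V K x Kx (λ y Ky → trans (sym (set-≢ κ v cF (λ e → nKv (trans (cong K (sym e)) Ky)))) (f y Ky)) lf
    ... | yes Kv with lf v Kv
    ...   | a , b , ne , (va , Ka) , (vb , Kb) = ne (h a b va vb (old a va Ka) (old b vb Kb))
      where
      old : ∀ y → Adj v y → K y ≡ true → κ y ≡ cF
      old y vy Ky = trans (sym (set-≢ κ v cF (λ e → adj-≢ vy (sym e)))) (f y Ky)

  record Colours (T : V → Bool) (κ : V → Col) : Set where
    field
      valid : Valid κ
      inside : ∀ v → T v ≡ true → κ v ≢ none
      outside : ∀ v → T v ≡ false → κ v ≡ none

  Colourable : (V → Bool) → Set
  Colourable T = ∃ (Colours T)

  module Decide (T : V → Bool) where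

    -- A colouring of `T` is encoded by its `cI` class, which leaves finitely many candidates.
    colOf : Subset n → V → Col
    colOf t v = if T v then (if lookup t v then cI else cF) else none

    leafless? : ∀ K → Dec (Leafless K)
    leafless? K = F.all? λ z → (K z ≟B true) →-dec F.any? λ a → F.any? λ b →
      ¬? (a ≟F b) ×-dec ((adj? z a ×-dec (K a ≟B true)) ×-dec (adj? z b ×-dec (K b ≟B true)))

    Cyc : (V → Col) → Subset n → Set
    Cyc κ k = (∃ λ x → lookup k x ≡ true) × (∀ y → lookup k y ≡ true → κ y ≡ cF) × Leafless (lookup k)

    cyc? : ∀ κ k → Dec (Cyc κ k)
    cyc? κ k = F.any? (λ x → lookup k x ≟B true) ×-dec
      (F.all? (λ y → (lookup k y ≟B true) →-dec (κ y ≟C cF)) ×-dec leafless? (lookup k))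

    Ind : (V → Col) → Set
    Ind κ = ∀ u v → Adj u v → κ u ≡ cI → κ v ≢ cI

    ind? : ∀ κ → Dec (Ind κ)
    ind? κ = F.all? λ u → F.all? λ v → adj? u v →-dec ((κ u ≟C cI) →-dec ¬? (κ v ≟C cI))

    Good : Subset n → Set
    Good t = Ind (colOf t) × ¬ ∃ (Cyc (colOf t))

    good? : ∀ t → Dec (Good t)
    good? t = ind? (colOf t) ×-dec ¬? (anySubset? (cyc? (colOf t)))

    fromGood : ∀ t → Good t → Colourable T
    fromGood t (i , nc) = colOf t , record
      { valid = record { ind = i ; forest = λ K x Kx f lf → nc (tabulate K ,
          (x , trans (lookup∘tabulate K x) Kx) ,
          (λ y Ky → f y (trans (sym (lookup∘tabulate K y)) Ky)) ,
          λ z Kz → go K z (lf z (trans (sym (lookup∘tabulate K z)) Kz))) }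
      ; inside = ins ; outside = out }
      where
      go : ∀ K z → _ → _
      go K z (a , b , ne , (p , q) , (r , s)) = a , b , ne , (p , trans (lookup∘tabulate K a) q) , (r , trans (lookup∘tabulate K b) s)
      ins : ∀ v → T v ≡ true → colOf t v ≢ none
      ins v e rewrite e with lookup t v
      ... | true = λ ()
      ... | false = λ ()
      out : ∀ v → T v ≡ false → colOf t v ≡ none
      out v e rewrite e = refl

    toGood : Colourable T → ∃ Good
    toGood (κ , c) = t , (λ u v a p q → Valid.ind valid u v a (trans (sym (same u)) p) (trans (sym (same v)) q)) ,
      λ { (k , (x , kx) , f , lf) → Valid.forest valid (lookup k) x kx (λ y ky → trans (sym (same y)) (f y ky)) lf }
      where
      open Colours c
      isI : Col → Bool
      isI cI = true
      isI _ = false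
      t = tabulate (isI ∘ κ)
      same : ∀ v → colOf t v ≡ κ v
      same v rewrite lookup∘tabulate (isI ∘ κ) v with T v in e | κ v in e'
      ... | true | none = ⊥-elim (inside v e e')
      ... | true | cI = refl
      ... | true | cF = refl
      ... | false | none = refl
      ... | false | cI with trans (sym e') (outside v e)
      ...   | ()
      same v | false | cF with trans (sym e') (outside v e)
      ...   | ()

    -- Takes the place of excluded middle in the choice of a minimal uncolourable set.
    colourable? : Dec (Colourable T)
    colourable? with anySubset? good?
    ... | yes (t , g) = yes (fromGood t g)
    ... | no ng = no (ng ∘ toGood)

  without : (V → Bool) → V → V → Bool
  without T v x = T x ∧ not ⌊ x ≟F v ⌋

  without-≢ : ∀ T v x → x ≢ v → without T v x ≡ T x
  without-≢ T v x ne with T x | x ≟F v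
  ... | false | _ = refl
  ... | true | no _ = refl
  ... | true | yes e = ⊥-elim (ne e)

  without-≡ : ∀ T v → without T v v ≡ false
  without-≡ T v with T v | v ≟F v
  ... | false | _ = refl
  ... | true | yes _ = refl
  ... | true | no n = ⊥-elim (n refl)

  module Extend (S : V → Bool) where

    Nb : V → (V → Set) → Set
    Nb v P = ∀ u → Adj v u → S u ≡ true → P u

    record Partial (κ : V → Col) : Set where
      constructor mkPartial
      field
        valid : Valid κ
        outside : ∀ v → S v ≡ false → κ v ≡ none

    dom : ∀ {κ} → Partial κ → ∀ {u c} → κ u ≡ c → c ≢ none → S u ≡ true
    dom p {u} e n with S u in s
    ... | true = refl
    ... | false = ⊥-elim (n (trans (sym e) (Partial.outside p u s)))

    part-set : ∀ {κ} v c → S v ≡ true → Partial κ → Valid (κ [ v ≔ c ]) → Partial (κ [ v ≔ c ])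
    part-set {κ} v c Sv p V = mkPartial V λ x Sx → trans (set-≢ κ v c λ e → true≢false (trans (sym Sv) (trans (cong S (sym e)) Sx))) (Partial.outside p x Sx)

    part-none : ∀ {κ} v → Partial κ → Partial (κ [ v ≔ none ])
    part-none {κ} v p = mkPartial (set-none v (Partial.valid p)) out
      where
      out : ∀ x → S x ≡ false → (κ [ v ≔ none ]) x ≡ none
      out x Sx with x ≟F v
      ... | yes _ = refl
      ... | no _ = Partial.outside p x Sx

    put-I : ∀ {κ} v → S v ≡ true → Partial κ → Nb v (λ u → κ u ≢ cI) → Partial (κ [ v ≔ cI ])
    put-I v Sv p h = part-set v cI Sv p (set-I v (Partial.valid p) λ u a e → h u a (dom p e (λ ())) e)

    put-F : ∀ {κ} v a → S v ≡ true → Partial κ → Nb v (λ u → κ u ≡ cF → u ≡ a) → Partial (κ [ v ≔ cF ])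
    put-F v a Sv p h = part-set v cF Sv p (set-F v (Partial.valid p) λ x y vx vy ex ey →
      trans (h x vx (dom p ex (λ ())) ex) (sym (h y vy (dom p ey (λ ())) ey)))

    Nb3 : V → V → V → V → Set
    Nb3 v a b c = Nb v λ u → u ≡ a ⊎ u ≡ b ⊎ u ≡ c

    rot3 : ∀ {v a b c} → Nb3 v a b c → Nb3 v b c a
    rot3 h u p q with h u p q
    ... | inj₁ e = inj₂ (inj₂ e)
    ... | inj₂ (inj₁ e) = inj₁ e
    ... | inj₂ (inj₂ e) = inj₂ (inj₁ e)

    swap3 : ∀ {v a b c} → Nb3 v a b c → Nb3 v b a c
    swap3 h u p q with h u p q
    ... | inj₁ e = inj₂ (inj₁ e)
    ... | inj₂ (inj₁ e) = inj₁ e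
    ... | inj₂ (inj₂ e) = inj₂ (inj₂ e)

    all3 : ∀ {v a b c} {P : V → Set} → Nb3 v a b c → P a → P b → P c → Nb v P
    all3 h pa pb pc u p q with h u p q
    ... | inj₁ refl = pa
    ... | inj₂ (inj₁ refl) = pb
    ... | inj₂ (inj₂ refl) = pc

    I-3 : ∀ {κ v a b c} → S v ≡ true → Partial κ → Nb3 v a b c → κ a ≢ cI → κ b ≢ cI → κ c ≢ cI → Partial (κ [ v ≔ cI ])
    I-3 Sv p nb x y z = put-I _ Sv p (all3 nb x y z)

    F-3 : ∀ {κ v a b c} → S v ≡ true → Partial κ → Nb3 v a b c → κ a ≢ cF → κ b ≢ cF → Partial (κ [ v ≔ cF ])
    F-3 {c = c} Sv p nb x y = put-F _ c Sv p (all3 nb (⊥-elim ∘ x) (⊥-elim ∘ y) (λ _ → refl))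

    -- With one neighbour uncoloured, either both others avoid `cI` and `v` takes `cI`, or one of
    -- them is in `cI` and at most one neighbour is left for `cF`.
    greedy : ∀ {κ v a b c} → S v ≡ true → Partial κ → Nb3 v a b c → κ c ≡ none →
      ∃ λ k → k ≢ none × Partial (κ [ v ≔ k ])
    greedy {κ} {v} {a} {b} {c} Sv p nb e with κ a ≟C cI | κ b ≟C cI
    ... | no x | no y = cI , (λ ()) , I-3 Sv p nb x y λ z → case trans (sym e) z of λ ()
    ... | yes x | _ = cF , (λ ()) , F-3 Sv p (rot3 (swap3 nb)) (λ z → case trans (sym x) z of λ ()) (λ z → case trans (sym e) z of λ ())
    ... | no _ | yes y = cF , (λ ()) , F-3 Sv p (rot3 nb) (λ z → case trans (sym y) z of λ ()) (λ z → case trans (sym e) z of λ ())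

-- Short closed walks and the forbidden cycles

module Walks (G : PlaneGraph) (no4 : ¬ Cycle G 4) (no7 : ¬ Cycle G 7) (no9 : ¬ Cycle G 9)
  (no53 : (C : Cycle G 5) (D : Cycle G 3) → ¬ NormallyAdjacent G C D) where
  open PlaneGraph G
  open Colouring G using (adj-sym; adj-≢)

  Chain : V → List V → V → Set
  Chain a [] z = Adj a z
  Chain a (b ∷ bs) z = Adj a b × Chain b bs z

  Fresh : V → List V → Set
  Fresh x [] = ⊤
  Fresh x (y ∷ ys) = x ≢ y × Fresh x ys

  Distinct : List V → Set
  Distinct [] = ⊤
  Distinct (x ∷ xs) = Fresh x xs × Distinct xs

  chain-next : ∀ a xs z → Chain a xs z → ∀ i j → toℕ j ≡ suc (toℕ i) → Adj (lookupL (a ∷ xs) i) (lookupL (a ∷ xs) j)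
  chain-next a (b ∷ bs) z (e , c) zero (suc zero) refl = e
  chain-next a (b ∷ bs) z (e , c) (suc i) (suc j) q = chain-next b bs z c i j (suc-injective q)

  chain-last : ∀ a xs z → Chain a xs z → ∀ i → suc (toℕ i) ≡ suc (length xs) → Adj (lookupL (a ∷ xs) i) z
  chain-last a [] z c zero q = c
  chain-last a (b ∷ bs) z (e , c) (suc i) q = chain-last b bs z c i (suc-injective q)

  fresh-≢ : ∀ x xs → Fresh x xs → ∀ i → x ≢ lookupL xs i
  fresh-≢ x (y ∷ ys) (n , f) zero = n
  fresh-≢ x (y ∷ ys) (n , f) (suc i) = fresh-≢ x ys f i

  distinct-inj : ∀ xs → Distinct xs → ∀ i j → lookupL xs i ≡ lookupL xs j → i ≡ j
  distinct-inj (x ∷ xs) (f , ds) zero zero e = refl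
  distinct-inj (x ∷ xs) (f , ds) zero (suc j) e = ⊥-elim (fresh-≢ x xs f j e)
  distinct-inj (x ∷ xs) (f , ds) (suc i) zero e = ⊥-elim (fresh-≢ x xs f i (sym e))
  distinct-inj (x ∷ xs) (f , ds) (suc i) (suc j) e = cong suc (distinct-inj xs ds i j e)

  mkCycle : ∀ a xs → Chain a xs a → Distinct (a ∷ xs) → Cycle G (suc (length xs))
  mkCycle a xs c ds = record { vert = lookupL (a ∷ xs) ; inj = distinct-inj (a ∷ xs) ds ; adj = adj }
    where
    adj : ∀ i j → Consec i j → Adj (lookupL (a ∷ xs) i) (lookupL (a ∷ xs) j)
    adj i j (inj₁ e) = chain-next a xs a c i j e
    adj i zero (inj₂ (e , _)) = chain-last a xs a c i e

  noC4 : ∀ {a b c d} → Adj a b → Adj b c → Adj c d → Adj d a → a ≢ c → b ≢ d → ⊥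
  noC4 {a} {b} {c} {d} ab bc cd da ac bd = no4 (mkCycle a (b ∷ c ∷ d ∷ []) (ab , bc , cd , da)
    ((adj-≢ ab , ac , (adj-≢ da ∘ sym) , tt) , (adj-≢ bc , bd , tt) , (adj-≢ cd , tt) , tt , tt))

  -- Two triangles on one edge would contain a 4-cycle.
  apex-unique : ∀ {a b c d} → Adj a b → Adj a c → Adj c b → Adj a d → Adj d b → c ≡ d
  apex-unique {a} {b} {c} {d} ab ac cb ad db with c ≟F d
  ... | yes e = e
  ... | no ne = ⊥-elim (noC4 ac cb (adj-sym db) (adj-sym ad) (adj-≢ ab) ne)

  record Five (a b p q r : V) : Set where
    constructor five
    field
      ab : Adj a b
      bp : Adj b p
      pq : Adj p q
      qr : Adj q r
      ra : Adj r a
      a≢p : a ≢ p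
      b≢q : b ≢ q
      p≢r : p ≢ r
      q≢a : q ≢ a
      r≢b : r ≢ b

  rot5 : ∀ {a b p q r} → Five a b p q r → Five b p q r a
  rot5 (five ab bp pq qr ra ap bq pr qa rb) = five bp pq qr ra ab bq pr qa rb ap

  -- If `c` is one of `p`, `q`, `r`, a chord of the pentagon cuts off a 4-cycle; otherwise the
  -- triangle meets the pentagon in the edge `ab` alone.
  no35 : ∀ {a b p q r} c → Five a b p q r → Adj a c → Adj c b → ⊥
  no35 {a} {b} {p} {q} {r} c (five ab bp pq qr ra ap bq pr qa rb) ac cb with c ≟F p | c ≟F q | c ≟F r
  ... | yes refl | _ | _ = noC4 ac pq qr ra (qa ∘ sym) pr
  ... | no _ | yes refl | _ = noC4 ab bp pq (adj-sym ac) ap bq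
  ... | no _ | no _ | yes refl = noC4 bp pq qr cb bq pr
  ... | no cp | no cq | no cr = no53 C D (a , b , adj-≢ ab , (zero , refl) , (zero , refl) , (suc zero , refl) , (suc zero , refl) ,
          common , (zero , suc zero , inj₁ refl , inj₁ (refl , refl)) , (zero , suc zero , inj₁ refl , inj₁ (refl , refl)))
    where
    C = mkCycle a (b ∷ p ∷ q ∷ r ∷ []) (ab , bp , pq , qr , ra)
      ((adj-≢ ab , ap , (qa ∘ sym) , (adj-≢ ra ∘ sym) , tt) , (adj-≢ bp , bq , (rb ∘ sym) , tt) , (adj-≢ pq , pr , tt) , (adj-≢ qr , tt) , tt , tt)
    D = mkCycle a (b ∷ c ∷ []) (ab , adj-sym cb , adj-sym ac)
      ((adj-≢ ab , adj-≢ ac , tt) , ((adj-≢ cb ∘ sym) , tt) , tt , tt)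
    common : ∀ w → OnC G C w → OnC G D w → w ≡ a ⊎ w ≡ b
    common w _ (zero , e) = inj₁ (sym e)
    common w _ (suc zero , e) = inj₂ (sym e)
    common w (zero , e) _ = inj₁ (sym e)
    common w (suc zero , e) _ = inj₂ (sym e)
    common w (suc (suc zero) , e) (suc (suc zero) , e') = ⊥-elim (cp (trans e' (sym e)))
    common w (suc (suc (suc zero)) , e) (suc (suc zero) , e') = ⊥-elim (cq (trans e' (sym e)))
    common w (suc (suc (suc (suc zero))) , e) (suc (suc zero) , e') = ⊥-elim (cr (trans e' (sym e)))

  -- Equal vertices at distance three would split off a closed walk of length 4, which is a 4-cycle.
  -- Hence only vertices at distance two have to be told apart beforehand.
  N7 : ∀ {a b c d e f g} → Adj a b → Adj b c → Adj c d → Adj d e → Adj e f → Adj f g → Adj g a →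
    a ≢ c → b ≢ d → c ≢ e → d ≢ f → e ≢ g → f ≢ a → g ≢ b → ⊥
  N7 {a} {b} {c} {d} {e} {f} {g} e0 e1 e2 e3 e4 e5 e6 m0 m1 m2 m3 m4 m5 m6 = no7 (mkCycle a (b ∷ c ∷ d ∷ e ∷ f ∷ g ∷ [])
    (e0 , e1 , e2 , e3 , e4 , e5 , e6)
    (((adj-≢ e0) , (m0) , (λ q → noC4 e3 e4 e5 (subst (Adj g) q e6) m3 m4) , (λ q → noC4 e0 e1 e2 (subst (Adj d) (sym q) e3) m0 m1) , (m5 ∘ sym) , (adj-≢ e6 ∘ sym) , tt) ,
     ((adj-≢ e1) , (m1) , (λ q → noC4 e4 e5 e6 (subst (Adj a) q e0) m4 m5) , (λ q → noC4 e1 e2 e3 (subst (Adj e) (sym q) e4) m1 m2) , (m6 ∘ sym) , tt) ,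
     ((adj-≢ e2) , (m2) , (λ q → noC4 e5 e6 e0 (subst (Adj b) q e1) m5 m6) , (λ q → noC4 e2 e3 e4 (subst (Adj f) (sym q) e5) m2 m3) , tt) ,
     ((adj-≢ e3) , (m3) , (λ q → noC4 e6 e0 e1 (subst (Adj c) q e2) m6 m0) , tt) ,
     ((adj-≢ e4) , (m4) , tt) ,
     ((adj-≢ e5) , tt) ,
     (tt) , tt))

  -- Distance four is settled by the absence of 4-cycles as in `N7`. Distance three stays a
  -- hypothesis: equality there splits the walk into lengths 3 and 6, neither of which is forbidden.
  N9 : ∀ {a b c d e f g h i} → Adj a b → Adj b c → Adj c d → Adj d e → Adj e f → Adj f g → Adj g h → Adj h i → Adj i a →
    a ≢ c → b ≢ d → c ≢ e → d ≢ f → e ≢ g → f ≢ h → g ≢ i → h ≢ a → i ≢ b →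
    a ≢ d → b ≢ e → c ≢ f → d ≢ g → e ≢ h → f ≢ i → g ≢ a → h ≢ b → i ≢ c → ⊥
  N9 {a} {b} {c} {d} {e} {f} {g} {h} {i} e0 e1 e2 e3 e4 e5 e6 e7 e8 m0 m1 m2 m3 m4 m5 m6 m7 m8 n0 n1 n2 n3 n4 n5 n6 n7 n8 = no9 (mkCycle a (b ∷ c ∷ d ∷ e ∷ f ∷ g ∷ h ∷ i ∷ [])
    (e0 , e1 , e2 , e3 , e4 , e5 , e6 , e7 , e8)
    (((adj-≢ e0) , (m0) , (n0) , (λ q → noC4 e0 e1 e2 (subst (Adj d) (sym q) e3) m0 m1) , (λ q → noC4 e5 e6 e7 (subst (Adj i) q e8) m5 m6) , (n6 ∘ sym) , (m7 ∘ sym) , (adj-≢ e8 ∘ sym) , tt) ,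
     ((adj-≢ e1) , (m1) , (n1) , (λ q → noC4 e1 e2 e3 (subst (Adj e) (sym q) e4) m1 m2) , (λ q → noC4 e6 e7 e8 (subst (Adj a) q e0) m6 m7) , (n7 ∘ sym) , (m8 ∘ sym) , tt) ,
     ((adj-≢ e2) , (m2) , (n2) , (λ q → noC4 e2 e3 e4 (subst (Adj f) (sym q) e5) m2 m3) , (λ q → noC4 e7 e8 e0 (subst (Adj b) q e1) m7 m8) , (n8 ∘ sym) , tt) ,
     ((adj-≢ e3) , (m3) , (n3) , (λ q → noC4 e3 e4 e5 (subst (Adj g) (sym q) e6) m3 m4) , (λ q → noC4 e8 e0 e1 (subst (Adj c) q e2) m8 m0) , tt) ,
     ((adj-≢ e4) , (m4) , (n4) , (λ q → noC4 e4 e5 e6 (subst (Adj h) (sym q) e7) m4 m5) , tt) ,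
     ((adj-≢ e5) , (m5) , (n5) , tt) ,
     ((adj-≢ e6) , (m6) , tt) ,
     ((adj-≢ e7) , tt) ,
     (tt) , tt))

-- Boolean certificates for the discharging

-- Truth tables: a bound that depends on a few Booleans is proved by evaluating all cases.
every : ∀ n → (Vec Bool n → Bool) → Bool
every zero P = P []
every (suc n) P = every n (λ v → P (true ∷ v)) ∧ every n (λ v → P (false ∷ v))

every-sound : ∀ n P → every n P ≡ true → ∀ v → P v ≡ true
every-sound zero P h [] = h
every-sound (suc n) P h (true ∷ v) = every-sound n _ (proj₁ (∧-true h)) v
every-sound (suc n) P h (false ∷ v) = every-sound n _ (proj₂ (∧-true {every n (λ v → P (true ∷ v))} h)) v

_⇒_ : Bool → Bool → Bool
a ⇒ b = not a ∨ b

mp : ∀ {a b} → (a ⇒ b) ≡ true → a ≡ true → b ≡ true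
mp {true} h refl = h

not-∧ : ∀ {a b} → (a ≡ true → b ≡ true → ⊥) → not (a ∧ b) ≡ true
not-∧ {true} {true} h = ⊥-elim (h refl refl)
not-∧ {true} {false} h = refl
not-∧ {false} h = refl

≤ᵇ-true : ∀ {a b} → (a ≤ᵇ b) ≡ true → a ≤ b
≤ᵇ-true {a} {b} e = ≤ᵇ⇒≤ a b (subst Data.Bool.T (sym e) _)

-- What a vertex of degree ≥ 4 gives to the face of one of its corners: q says that the degree
-- is 4, t₋, t₊, t₂ that the previous, the next and the opposite corner lie on triangles,
-- s₋, s₊, s that the previous, the next and this corner lie on 5- or 8-faces.
give : (q t₋ t₊ t₂ s₋ s₊ s : Bool) → ℕ
give q true true _ _ _ _ = if q then 12 else 18
give q true false _ _ s₊ _ = if q ∧ s₊ then 9 else 12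
give q false true _ s₋ _ _ = if q ∧ s₋ then 9 else 12
give q false false t₂ _ _ s = if q ∧ t₂ then (if s then 6 else 0) else 6

give≤18 : ∀ q t₋ t₊ t₂ s₋ s₊ s → give q t₋ t₊ t₂ s₋ s₊ s ≤ 18
give≤18 q a b c e f g = ≤ᵇ-true (every-sound 7 (λ { (q ∷ a ∷ b ∷ c ∷ e ∷ f ∷ g ∷ []) → give q a b c e f g ≤ᵇ 18 }) refl (q ∷ a ∷ b ∷ c ∷ e ∷ f ∷ g ∷ []))

gives : (q t t₋ t₊ t₂ s₋ s₊ s : Bool) → ℕ
gives q t t₋ t₊ t₂ s₋ s₊ s = if t then 0 else give q t₋ t₊ t₂ s₋ s₊ s

-- The limit is the charge 24 · 4 - 72 of a vertex of degree 4. The hypotheses say that no two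
-- triangles share an edge at it.
give-four : ∀ t₀ t₁ t₂ t₃ s₀ s₁ s₂ s₃ → not (t₀ ∧ t₁) ≡ true → not (t₁ ∧ t₂) ≡ true → not (t₂ ∧ t₃) ≡ true → not (t₃ ∧ t₀) ≡ true →
  gives true t₀ t₃ t₁ t₂ s₃ s₁ s₀ + (gives true t₁ t₀ t₂ t₃ s₀ s₂ s₁ + (gives true t₂ t₁ t₃ t₀ s₁ s₃ s₂ + (gives true t₃ t₂ t₀ t₁ s₂ s₀ s₃ + 0))) ≤ 24
give-four t₀ t₁ t₂ t₃ s₀ s₁ s₂ s₃ h₀ h₁ h₂ h₃ = ≤ᵇ-true (mp (mp (mp (mp
  (every-sound 8 (λ { (t₀ ∷ t₁ ∷ t₂ ∷ t₃ ∷ s₀ ∷ s₁ ∷ s₂ ∷ s₃ ∷ []) → not (t₀ ∧ t₁) ⇒ (not (t₁ ∧ t₂) ⇒ (not (t₂ ∧ t₃) ⇒ (not (t₃ ∧ t₀) ⇒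
    ((gives true t₀ t₃ t₁ t₂ s₃ s₁ s₀ + (gives true t₁ t₀ t₂ t₃ s₀ s₂ s₁ + (gives true t₂ t₁ t₃ t₀ s₁ s₃ s₂ + (gives true t₃ t₂ t₀ t₁ s₂ s₀ s₃ + 0)))) ≤ᵇ 24)))) })
  refl (t₀ ∷ t₁ ∷ t₂ ∷ t₃ ∷ s₀ ∷ s₁ ∷ s₂ ∷ s₃ ∷ [])) h₀) h₁) h₂) h₃)

-- for degree 5 only t₋ and t₊ matter
give′ : (t t₋ t₊ : Bool) → ℕ
give′ t t₋ t₊ = gives false t t₋ t₊ false false false false

gives′ : ∀ t t₋ t₊ t₂ s₋ s₊ s → gives false t t₋ t₊ t₂ s₋ s₊ s ≡ give′ t t₋ t₊
gives′ true _ _ _ _ _ _ = refl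
gives′ false true true _ _ _ _ = refl
gives′ false true false _ _ _ _ = refl
gives′ false false true _ _ _ _ = refl
gives′ false false false _ _ _ _ = refl

-- Here 48 is the charge 24 · 5 - 72.
give-five : ∀ t₀ t₁ t₂ t₃ t₄ → not (t₀ ∧ t₁) ≡ true → not (t₁ ∧ t₂) ≡ true → not (t₂ ∧ t₃) ≡ true → not (t₃ ∧ t₄) ≡ true → not (t₄ ∧ t₀) ≡ true →
  give′ t₀ t₄ t₁ + (give′ t₁ t₀ t₂ + (give′ t₂ t₁ t₃ + (give′ t₃ t₂ t₄ + (give′ t₄ t₃ t₀ + 0)))) ≤ 48
give-five t₀ t₁ t₂ t₃ t₄ h₀ h₁ h₂ h₃ h₄ = ≤ᵇ-true (mp (mp (mp (mp (mp
  (every-sound 5 (λ { (t₀ ∷ t₁ ∷ t₂ ∷ t₃ ∷ t₄ ∷ []) → not (t₀ ∧ t₁) ⇒ (not (t₁ ∧ t₂) ⇒ (not (t₂ ∧ t₃) ⇒ (not (t₃ ∧ t₄) ⇒ (not (t₄ ∧ t₀) ⇒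
    ((give′ t₀ t₄ t₁ + (give′ t₁ t₀ t₂ + (give′ t₂ t₁ t₃ + (give′ t₃ t₂ t₄ + (give′ t₄ t₃ t₀ + 0))))) ≤ᵇ 48))))) })
  refl (t₀ ∷ t₁ ∷ t₂ ∷ t₃ ∷ t₄ ∷ [])) h₀) h₁) h₂) h₃) h₄)

-- Summed around a vertex the triangle terms leave at most 12 per corner, and 12d ≤ 24d - 72 as soon
-- as d ≥ 6.
give-many : ∀ q t t₋ t₊ t₂ s₋ s₊ s → gives q t t₋ t₊ t₂ s₋ s₊ s + 12 * bit t ≤ 12 + 6 * bit t₊
give-many q t a b c e f g = ≤ᵇ-true (every-sound 8 (λ { (q ∷ t ∷ a ∷ b ∷ c ∷ e ∷ f ∷ g ∷ []) → (gives q t a b c e f g + 12 * bit t) ≤ᵇ (12 + 6 * bit b) }) refl (q ∷ t ∷ a ∷ b ∷ c ∷ e ∷ f ∷ g ∷ []))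

-- The type of an edge of a large face, seen from that face: eT borders a triangle, eA, eB and
-- eZ a 5-face receiving 4, 3 or nothing (eZ also an 8-face), eL a poor face, eN anything else.
data Edge : Set where
  eT eA eB eZ eN eL : Edge

-- a corner (true: of degree ≥ 4) with the edge following it
Sym : Set
Sym = Bool × Edge

-- What remains to the face of the 12 units of this edge after its payment across: it pays 12 for
-- `eT`, 4 for `eA`, 3 for `eB` and `eL`.
cost : Edge → ℕ
cost eT = 0
cost eA = 8
cost eB = 9
cost eZ = 12
cost eN = 12
cost eL = 9

isS : Edge → Bool
isS eA = true
isS eB = true
isS eZ = true
isS _ = false

isT : Edge → Bool
isT eT = true
isT _ = false

isAL : Edge → Bool
isAL eA = true
isAL eL = true
isAL _ = false

isL : Edge → Bool
isL eL = true
isL _ = false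

isA : Edge → Bool
isA eA = true
isA _ = false

isB : Edge → Bool
isB eB = true
isB _ = false

-- The least value of `give` over all degrees at least 4, given the types of the two edges at the
-- corner. A 5- or 8-face beside the corner of a degree 4 vertex keeps the opposite corner from
-- being a triangle, whence the 6.
gainLow : Edge → Bool → Edge → ℕ
gainLow e false f = 0
gainLow eT true eT = 12
gainLow eT true f = if isS f then 9 else 12
gainLow e true eT = if isS e then 9 else 12
gainLow e true f = if isS e ∨ isS f then 6 else 0

-- Twice the charge of a corner, each edge counted half at both of its ends; a face of charge
-- at least 72 has weight at least 144.
weight : Sym → Sym → ℕ
weight (_ , e) (y , f) = 2 * gainLow e y f + (cost e + cost f)

-- Edges `eA` and `eL` have both ends of degree 3. At a corner of degree 3 the faces beyond its two
-- edges share the third edge there: beside a triangle the other has length at least 10, and beside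
-- a poor face it is a triangle.
ok₂ : Sym → Sym → Bool
ok₂ (_ , e) (true , f) = not (isAL e ∨ isAL f)
ok₂ (_ , e) (false , f) = not (isT e ∧ (isT f ∨ isS f)) ∧ not (isS e ∧ isT f) ∧ (not (isL e) ∨ isT f) ∧ (not (isL f) ∨ isT e)

-- A triangle bordering a poor face has its vertex off that face of degree at least 4. An `eB` edge
-- with both ends of degree 3 must have a pentagon beyond one of its neighbouring edges.
ok₃ : Sym → Sym → Sym → Bool
ok₃ (_ , e₀) (y₁ , e₁) (y₂ , e₂) =
  not (isL e₀ ∧ isT e₁ ∧ not y₁ ∧ not y₂) ∧ not (isL e₂ ∧ isT e₁ ∧ not y₁ ∧ not y₂) ∧
  not (isB e₁ ∧ not y₁ ∧ not y₂ ∧ not (isS e₀) ∧ not (isS e₂))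

allE : (Edge → Bool) → Bool
allE P = P eT ∧ P eA ∧ P eB ∧ P eZ ∧ P eN ∧ P eL

allE-sound : ∀ P → allE P ≡ true → ∀ e → P e ≡ true
allE-sound P h eT = proj₁ (∧-true h)
allE-sound P h eA = proj₁ (∧-true (proj₂ (∧-true {P eT} h)))
allE-sound P h eB = proj₁ (∧-true (proj₂ (∧-true {P eA} (proj₂ (∧-true {P eT} h)))))
allE-sound P h eZ = proj₁ (∧-true (proj₂ (∧-true {P eB} (proj₂ (∧-true {P eA} (proj₂ (∧-true {P eT} h)))))))
allE-sound P h eN = proj₁ (∧-true (proj₂ (∧-true {P eZ} (proj₂ (∧-true {P eB} (proj₂ (∧-true {P eA} (proj₂ (∧-true {P eT} h)))))))))
allE-sound P h eL = proj₂ (∧-true {P eN} (proj₂ (∧-true {P eZ} (proj₂ (∧-true {P eB} (proj₂ (∧-true {P eA} (proj₂ (∧-true {P eT} h)))))))))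

allSym : (Sym → Bool) → Bool
allSym P = allE (λ e → P (true , e)) ∧ allE (λ e → P (false , e))

allSym-sound : ∀ P → allSym P ≡ true → ∀ s → P s ≡ true
allSym-sound P h (true , e) = allE-sound (λ e → P (true , e)) (proj₁ (∧-true h)) e
allSym-sound P h (false , e) = allE-sound (λ e → P (false , e)) (proj₂ (∧-true {allE (λ e → P (true , e))} h)) e

_≡ᴱ_ : Edge → Edge → Bool
eT ≡ᴱ eT = true
eA ≡ᴱ eA = true
eB ≡ᴱ eB = true
eZ ≡ᴱ eZ = true
eN ≡ᴱ eN = true
eL ≡ᴱ eL = true
_ ≡ᴱ _ = false

≡ᴱ-sound : ∀ e f → e ≡ᴱ f ≡ true → e ≡ f
≡ᴱ-sound eT eT _ = refl
≡ᴱ-sound eA eA _ = refl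
≡ᴱ-sound eB eB _ = refl
≡ᴱ-sound eZ eZ _ = refl
≡ᴱ-sound eN eN _ = refl
≡ᴱ-sound eL eL _ = refl

same-sym : Sym → Sym → Bool
same-sym (x , e) (y , f) = ⌊ x ≟B y ⌋ ∧ (e ≡ᴱ f)

same-sym-sound : ∀ s t → same-sym s t ≡ true → s ≡ t
same-sym-sound (x , e) (y , f) h = cong₂ _,_ (⌊⌋-true {d = x ≟B y} (proj₁ (∧-true h))) (≡ᴱ-sound e f (proj₂ (∧-true {⌊ x ≟B y ⌋} h)))

same-list : List Sym → List Sym → Bool
same-list [] [] = true
same-list (x ∷ xs) (y ∷ ys) = same-sym x y ∧ same-list xs ys
same-list _ _ = false

same-list-sound : ∀ xs ys → same-list xs ys ≡ true → xs ≡ ys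
same-list-sound [] [] _ = refl
same-list-sound (x ∷ xs) (y ∷ ys) h = cong₂ _∷_ (same-sym-sound x y (proj₁ (∧-true h))) (same-list-sound xs ys (proj₂ (∧-true {same-sym x y} h)))

member : List Sym → List (List Sym) → Bool
member x [] = false
member x (y ∷ ys) = same-list x y ∨ member x ys

∨-false : ∀ {a b} → a ∨ b ≡ true → a ≡ false → b ≡ true
∨-false h refl = h

≤ᵇ-false : ∀ {a b} → b < a → (a ≤ᵇ b) ≡ false
≤ᵇ-false {a} {b} lt with a ≤ᵇ b in e
... | false = refl
... | true = ⊥-elim (<⇒≱ lt (≤ᵇ-true e))

sumN-split : ∀ a b (f : ℕ → ℕ) → sumN (a + b) f ≡ sumN a f + sumN b (λ i → f (a + i))
sumN-split zero b f = refl
sumN-split (suc a) b f = trans (cong (f 0 +_) (sumN-split a b (f ∘ suc))) (sym (+-assoc (f 0) _ _))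

revL : (ℕ → Sym) → ℕ → List Sym
revL s zero = []
revL s (suc m) = s m ∷ revL s m

-- Depth-first enumeration of the cyclic sequences of symbols of weight less than the budget;
-- base is a lower bound for the weight of one corner.
module Search (ban : Sym → Bool) (first : Sym → Bool) (base budget : ℕ) (exc : List (List Sym)) where

  okAcc : List Sym → Sym → Bool
  okAcc (b ∷ a ∷ _) t = ok₂ b t ∧ ok₃ a b t
  okAcc _ t = true

  wAcc : List Sym → Sym → ℕ
  wAcc (b ∷ _) t = weight b t
  wAcc [] t = 0

  explore : Sym → Sym → ℕ → List Sym → ℕ → Bool
  -- The word is cyclic, so the windows across its end are tested too.
  explore s₀ s₁ zero acc w = not (okAcc acc s₀ ∧ okAcc (s₀ ∷ acc) s₁) ∨ (budget ≤ᵇ (w + wAcc acc s₀)) ∨ member acc exc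
  -- The `k` symbols after `t` and the closing step contribute at least `base` each.
  explore s₀ s₁ (suc k) acc w = allSym λ t → ban t ∨ not (okAcc acc t) ∨ (budget ≤ᵇ (w + wAcc acc t + base * suc k)) ∨
    explore s₀ s₁ k (t ∷ acc) (w + wAcc acc t)

  start₁ : ℕ → Sym → Sym → Bool
  start₁ n s₀ s₁ = ban s₁ ∨ not (ok₂ s₀ s₁) ∨ explore s₀ s₁ n (s₁ ∷ s₀ ∷ []) (weight s₀ s₁)

  start₀ : ℕ → Sym → Bool
  start₀ n s₀ = not (first s₀) ∨ ban s₀ ∨ allSym (start₁ n s₀)

  run : ℕ → Bool
  run n = allSym (start₀ n)

  module _ (n : ℕ) (s : ℕ → Sym) (e₀ : s (2 + n) ≡ s 0) (e₁ : s (3 + n) ≡ s 1)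
    (o₂ : ∀ i → ok₂ (s i) (s (suc i)) ≡ true) (o₃ : ∀ i → ok₃ (s i) (s (suc i)) (s (2 + i)) ≡ true)
    (nb : ∀ i → ban (s i) ≡ false) (f₀ : first (s 0) ≡ true)
    (low : ∀ i → base ≤ weight (s i) (s (suc i)))
    (cheap : sumN (2 + n) (λ i → weight (s i) (s (suc i))) < budget) where

    private
      wt : ℕ → ℕ
      wt i = weight (s i) (s (suc i))

      partial : ∀ a b → a + b ≡ 2 + n → sumN a wt + base * b < budget
      partial a b q = ≤-<-trans (≤-trans (+-monoʳ-≤ (sumN a wt) (≤-trans (≤-reflexive (trans (*-comm base b) (sym (sumN-const b base)))) (sumN-mono b λ i → low (a + i))))
        (≤-reflexive (trans (sym (sumN-split a b wt)) (cong (λ z → sumN z wt) q)))) cheap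

    sound-explore : ∀ k m → k + (2 + m) ≡ 2 + n → explore (s 0) (s 1) k (revL s (2 + m)) (sumN (suc m) wt) ≡ true → member (revL s (2 + n)) exc ≡ true
    sound-explore zero m refl h = ∨-false (∨-false h cl) (≤ᵇ-false (subst (_< budget) (trans (sumN-snoc (suc m) wt) (cong (λ z → sumN (suc m) wt + weight (s (suc m)) z) e₀)) cheap))
      where
      cl : not (okAcc (revL s (2 + m)) (s 0) ∧ okAcc (s 0 ∷ revL s (2 + m)) (s 1)) ≡ false
      cl rewrite sym e₀ | sym e₁ | o₂ (suc m) | o₃ m | o₂ (2 + m) | o₃ (suc m) = refl
    sound-explore (suc k) m q h = sound-explore k (suc m) (trans (+-suc k (2 + m)) q)
        (subst (λ z → explore (s 0) (s 1) k (revL s (3 + m)) z ≡ true) (sym (sumN-snoc (suc m) wt))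
          (∨-false (∨-false (∨-false (allSym-sound next h (s (2 + m))) (nb (2 + m))) ok) (≤ᵇ-false (subst (_< budget) (cong (_+ base * suc k) (sumN-snoc (suc m) wt)) (partial (2 + m) (suc k) (trans (+-suc (2 + m) k) (trans (cong suc (+-comm (2 + m) k)) q)))))))
      where
      acc : List Sym
      acc = revL s (2 + m)
      next : Sym → Bool
      next t = ban t ∨ not (okAcc acc t) ∨ (budget ≤ᵇ (sumN (suc m) wt + wAcc acc t + base * suc k)) ∨
        explore (s 0) (s 1) k (t ∷ acc) (sumN (suc m) wt + wAcc acc t)
      ok : not (okAcc (revL s (2 + m)) (s (2 + m))) ≡ false
      ok rewrite o₂ (suc m) | o₃ m = refl

    sound : run n ≡ true → member (revL s (2 + n)) exc ≡ true
    sound h = sound-explore n 0 (+-comm n 2)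
      (subst (λ z → explore (s 0) (s 1) n (revL s 2) z ≡ true) (sym (+-identityʳ (wt 0)))
        (∨-false (∨-false (allSym-sound (start₁ n (s 0)) (∨-false (∨-false (allSym-sound (start₀ n) h (s 0)) (cong not f₀)) (nb 0)) (s 1)) (nb 1)) (cong not (o₂ 0))))

3T 3N 3L 3A YT : Sym
3T = false , eT
3N = false , eN
3L = false , eL
3A = false , eA
YT = true , eT

-- The words of too small weight around a 10-face, read backwards as by revL.
wordL wordA wordP wordP' : List Sym
wordL = YT ∷ 3T ∷ 3N ∷ 3T ∷ 3N ∷ 3T ∷ 3N ∷ YT ∷ 3T ∷ 3L ∷ []
wordA = 3N ∷ 3T ∷ 3N ∷ 3T ∷ 3N ∷ 3T ∷ 3N ∷ 3T ∷ 3N ∷ 3A ∷ []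
wordP = 3N ∷ 3T ∷ 3N ∷ 3T ∷ 3N ∷ 3T ∷ 3N ∷ 3T ∷ 3N ∷ 3T ∷ []
wordP' = 3T ∷ 3N ∷ 3T ∷ 3N ∷ 3T ∷ 3N ∷ 3T ∷ 3N ∷ 3T ∷ 3N ∷ []

nothing : Sym → Bool
nothing _ = false

anything : Sym → Bool
anything _ = true

has-L has-A has-AL : Sym → Bool
has-L (_ , e) = isL e
has-A (_ , e) = isA e
has-AL (_ , e) = isAL e

-- A word is rotated to begin with `eL` if it has one, otherwise with `eA` if it has one; the later
-- searches ban what the earlier ones have settled. An `eL` beside an `eT` has weight only 9;
-- without `eL` every corner weighs at least 12.
module L₁₀ = Search nothing has-L 9 144 (wordL ∷ [])
module A₁₀ = Search has-L has-A 12 144 (wordA ∷ [])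
module P₁₀ = Search has-AL anything 12 144 (wordP ∷ wordP' ∷ [])
module L₁₁ = Search nothing has-L 9 144 []
module A₁₁ = Search has-L has-A 12 144 []
module P₁₁ = Search has-AL anything 12 144 []

run-L₁₀ : L₁₀.run 8 ≡ true
run-L₁₀ = refl
run-A₁₀ : A₁₀.run 8 ≡ true
run-A₁₀ = refl
run-P₁₀ : P₁₀.run 8 ≡ true
run-P₁₀ = refl
run-L₁₁ : L₁₁.run 9 ≡ true
run-L₁₁ = refl
run-A₁₁ : A₁₁.run 9 ≡ true
run-A₁₁ = refl
run-P₁₁ : P₁₁.run 9 ≡ true
run-P₁₁ = refl

low-9 : ∀ s t → ok₂ s t ≡ true → 9 ≤ weight s t
low-9 s t o = ≤ᵇ-true (∨-false (allSym-sound (λ t → not (ok₂ s t) ∨ (9 ≤ᵇ weight s t)) (allSym-sound (λ s → allSym λ t → not (ok₂ s t) ∨ (9 ≤ᵇ weight s t)) refl s) t) (cong not o))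

low-12 : ∀ s t → has-L s ≡ false → has-L t ≡ false → ok₂ s t ≡ true → 12 ≤ weight s t
low-12 s t p q o = ≤ᵇ-true (∨-false (∨-false (∨-false (allSym-sound (λ t → P s t) (allSym-sound (λ s → allSym λ t → P s t) refl s) t) p) q) (cong not o))
  where
  P : Sym → Sym → Bool
  P s t = has-L s ∨ has-L t ∨ not (ok₂ s t) ∨ (12 ≤ᵇ weight s t)

-- for long faces, an eL edge is compensated by the corner at the far end of the next edge
low-shift : ∀ r s t → ok₂ r s ≡ true → ok₂ s t ≡ true → ok₃ r s t ≡ true →
  12 + 6 * bit (has-L r) ≤ weight s t + (3 * bit (has-L s) + 3 * bit (has-L t))
low-shift r s t p q o = ≤ᵇ-true (∨-false (∨-false (∨-false (allSym-sound (λ t → P r s t) (allSym-sound (λ s → allSym λ t → P r s t)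
    (allSym-sound (λ r → allSym λ s → allSym λ t → P r s t) refl r) s) t) (cong not p)) (cong not q)) (cong not o))
  where
  P : Sym → Sym → Sym → Bool
  P r s t = not (ok₂ r s) ∨ not (ok₂ s t) ∨ not (ok₃ r s t) ∨ ((12 + 6 * bit (has-L r)) ≤ᵇ (weight s t + (3 * bit (has-L s) + 3 * bit (has-L t))))

-- What a pentagon demands across its first edge: y₀, …, y₄ say which vertices have degree ≥ 4,
-- s₋ and s₊ whether the faces beyond the previous and the next edge are pentagons.
demand : (y₀ y₁ y₂ y₃ y₄ s₋ s₊ : Bool) → ℕ
demand false false false false false _ _ = 4
demand true false false false false _ _ = 3
demand false true false false false _ _ = 3
demand false false false false true s₋ _ = if s₋ then 3 else 0
demand false false true false false _ s₊ = if s₊ then 3 else 0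
demand _ _ _ _ _ _ _ = 0

type₅ : ℕ → Edge
type₅ 4 = eA
type₅ 3 = eB
type₅ _ = eZ

paid : (s y₀ y₁ y₂ y₃ y₄ s₋ s₊ : Bool) → ℕ
paid s y₀ y₁ y₂ y₃ y₄ s₋ s₊ = if s then 0 else 12 ∸ cost (type₅ (demand y₀ y₁ y₂ y₃ y₄ s₋ s₊))

six : Bool → ℕ
six y = if y then 6 else 0

-- A pentagon lacks 72 - 60 = 12. By hypothesis pentagons do not lie beyond two consecutive edges at
-- a vertex of degree 3. So with all degrees 3 at least three edges pay 4; with one larger degree
-- its 6 is completed by two payments of 3; two larger degrees give 12 by themselves.
pentagon-total : ∀ y₀ y₁ y₂ y₃ y₄ s₀ s₁ s₂ s₃ s₄ →
  y₁ ∨ not (s₀ ∧ s₁) ≡ true → y₂ ∨ not (s₁ ∧ s₂) ≡ true → y₃ ∨ not (s₂ ∧ s₃) ≡ true → y₄ ∨ not (s₃ ∧ s₄) ≡ true → y₀ ∨ not (s₄ ∧ s₀) ≡ true →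
  12 ≤ (six y₀ + paid s₀ y₀ y₁ y₂ y₃ y₄ s₄ s₁) + ((six y₁ + paid s₁ y₁ y₂ y₃ y₄ y₀ s₀ s₂) + ((six y₂ + paid s₂ y₂ y₃ y₄ y₀ y₁ s₁ s₃) +
       ((six y₃ + paid s₃ y₃ y₄ y₀ y₁ y₂ s₂ s₄) + ((six y₄ + paid s₄ y₄ y₀ y₁ y₂ y₃ s₃ s₀) + 0))))
pentagon-total y₀ y₁ y₂ y₃ y₄ s₀ s₁ s₂ s₃ s₄ h₁ h₂ h₃ h₄ h₀ = ≤ᵇ-true (mp (mp (mp (mp (mp
  (every-sound 10 (λ { (y₀ ∷ y₁ ∷ y₂ ∷ y₃ ∷ y₄ ∷ s₀ ∷ s₁ ∷ s₂ ∷ s₃ ∷ s₄ ∷ []) →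
    (y₁ ∨ not (s₀ ∧ s₁)) ⇒ ((y₂ ∨ not (s₁ ∧ s₂)) ⇒ ((y₃ ∨ not (s₂ ∧ s₃)) ⇒ ((y₄ ∨ not (s₃ ∧ s₄)) ⇒ ((y₀ ∨ not (s₄ ∧ s₀)) ⇒
    (12 ≤ᵇ ((six y₀ + paid s₀ y₀ y₁ y₂ y₃ y₄ s₄ s₁) + ((six y₁ + paid s₁ y₁ y₂ y₃ y₄ y₀ s₀ s₂) + ((six y₂ + paid s₂ y₂ y₃ y₄ y₀ y₁ s₁ s₃) +
       ((six y₃ + paid s₃ y₃ y₄ y₀ y₁ y₂ s₂ s₄) + ((six y₄ + paid s₄ y₄ y₀ y₁ y₂ y₃ s₃ s₀) + 0)))))))))) })
  refl (y₀ ∷ y₁ ∷ y₂ ∷ y₃ ∷ y₄ ∷ s₀ ∷ s₁ ∷ s₂ ∷ s₃ ∷ s₄ ∷ [])) h₁) h₂) h₃) h₄) h₀)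

demand-4 : ∀ y₀ y₁ y₂ y₃ y₄ s₋ s₊ → type₅ (demand y₀ y₁ y₂ y₃ y₄ s₋ s₊) ≡ eA →
  (y₀ ≡ false × y₁ ≡ false) × (y₂ ≡ false × y₃ ≡ false × y₄ ≡ false)
demand-4 false false false false false _ _ _ = (refl , refl) , (refl , refl , refl)
demand-4 true false false false false _ _ ()
demand-4 false true false false false _ _ ()
demand-4 false false false false true true _ ()
demand-4 false false false false true false _ ()
demand-4 false false true false false _ true ()
demand-4 false false true false false _ false ()
demand-4 false false false true _ _ _ ()
demand-4 false false true false true _ _ ()
demand-4 false false true true _ _ _ ()
demand-4 false true false false true _ _ ()
demand-4 false true false true _ _ _ ()
demand-4 false true true _ _ _ _ ()
demand-4 true false false false true _ _ ()
demand-4 true false false true _ _ _ ()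
demand-4 true false true _ _ _ _ ()
demand-4 true true _ _ _ _ _ ()

demand-3 : ∀ y₂ y₃ y₄ s₋ s₊ → type₅ (demand false false y₂ y₃ y₄ s₋ s₊) ≡ eB → s₋ ≡ true ⊎ s₊ ≡ true
demand-3 false false true true _ _ = inj₁ refl
demand-3 true false false _ true _ = inj₂ refl
demand-3 false false false _ _ ()
demand-3 false false true false _ ()
demand-3 false true _ _ _ ()
demand-3 true false false _ false ()
demand-3 true false true _ _ ()
demand-3 true true _ _ _ ()

type₅-S : ∀ k → isS (type₅ k) ≡ true
type₅-S 0 = refl
type₅-S 1 = refl
type₅-S 2 = refl
type₅-S 3 = refl
type₅-S 4 = refl
type₅-S (suc (suc (suc (suc (suc _))))) = refl

isT-type₅ : ∀ k → isT (type₅ k) ≡ false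
isT-type₅ 0 = refl
isT-type₅ 1 = refl
isT-type₅ 2 = refl
isT-type₅ 3 = refl
isT-type₅ 4 = refl
isT-type₅ (suc (suc (suc (suc (suc _))))) = refl

isL-type₅ : ∀ k → isL (type₅ k) ≡ false
isL-type₅ 0 = refl
isL-type₅ 1 = refl
isL-type₅ 2 = refl
isL-type₅ 3 = refl
isL-type₅ 4 = refl
isL-type₅ (suc (suc (suc (suc (suc _))))) = refl

gainLow-give : ∀ e f q t₂ → not (q ∧ t₂ ∧ (isS e ∨ isS f)) ≡ true →
  gainLow e true f ≤ give q (isT e) (isT f) t₂ (isS e) (isS f) false
gainLow-give e f q t₂ h = ≤ᵇ-true (mp (P-all q t₂) h)
  where
  P : Bool → Bool → Edge → Edge → Bool
  P q t₂ e f = not (q ∧ t₂ ∧ (isS e ∨ isS f)) ⇒ (gainLow e true f ≤ᵇ give q (isT e) (isT f) t₂ (isS e) (isS f) false)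
  P-all : ∀ q t₂ → P q t₂ e f ≡ true
  P-all true true = allE-sound (P true true e) (allE-sound (λ e → allE (P true true e)) refl e) f
  P-all true false = allE-sound (P true false e) (allE-sound (λ e → allE (P true false e)) refl e) f
  P-all false true = allE-sound (P false true e) (allE-sound (λ e → allE (P false true e)) refl e) f
  P-all false false = allE-sound (P false false e) (allE-sound (λ e → allE (P false false e)) refl e) f

cost≥8 : ∀ e → e ≢ eT → 8 ≤ cost e
cost≥8 eT n = ⊥-elim (n refl)
cost≥8 eA _ = ≤-refl
cost≥8 eB _ = m≤m+n 8 1
cost≥8 eZ _ = m≤m+n 8 4
cost≥8 eN _ = m≤m+n 8 4
cost≥8 eL _ = m≤m+n 8 1

cost≥9 : ∀ e → e ≢ eT → e ≢ eA → 9 ≤ cost e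
cost≥9 eT n _ = ⊥-elim (n refl)
cost≥9 eA _ n = ⊥-elim (n refl)
cost≥9 eB _ _ = ≤-refl
cost≥9 eZ _ _ = m≤m+n 9 3
cost≥9 eN _ _ = m≤m+n 9 3
cost≥9 eL _ _ = ≤-refl

not-true : ∀ {b} → (b ≡ true → ⊥) → not b ≡ true
not-true {true} h = ⊥-elim (h refl)
not-true {false} _ = refl

imp : ∀ {a b} → (a ≡ true → b ≡ true) → not a ∨ b ≡ true
imp {true} h = h refl
imp {false} _ = refl

not-false : ∀ {b} → not b ≡ true → b ≡ false
not-false {false} _ = refl

and : ∀ {a b} → a ≡ true → b ≡ true → a ∧ b ≡ true
and refl refl = refl

nth : ℕ → List Sym → Sym
nth _ [] = false , eN
nth zero (x ∷ _) = x
nth (suc i) (_ ∷ xs) = nth i xs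

member-one : ∀ x y → member x (y ∷ []) ≡ true → x ≡ y
member-one x y h with ∨-true {same-list x y} h
... | inj₁ e = same-list-sound x y e

member-two : ∀ x y z → member x (y ∷ z ∷ []) ≡ true → x ≡ y ⊎ x ≡ z
member-two x y z h with ∨-true {same-list x y} h
... | inj₁ e = inj₁ (same-list-sound x y e)
... | inj₂ e = inj₂ (member-one x z e)

-- A minimal uncolourable vertex set

module Critical (G : PlaneGraph) (no4 : ¬ Cycle G 4) (no7 : ¬ Cycle G 7) (no9 : ¬ Cycle G 9)
  (no53 : (C : Cycle G 5) (D : Cycle G 3) → ¬ NormallyAdjacent G C D)
  (S : Fin (PlaneGraph.n G) → Bool)
  (sub : ∀ v → S v ≡ true → Colouring.Colourable G (Colouring.without G S v))
  (bad : ¬ Colouring.Colourable G S) where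
  open PlaneGraph G
  open Colouring G
  open Extend S
  open Walks G no4 no7 no9 no53
  open Rotation G S

  Full : (V → Col) → Set
  Full κ = ∀ v → S v ≡ true → κ v ≢ none

  complete : ∀ {κ} → Partial κ → Full κ → ⊥
  complete p f = bad (_ , record { valid = Partial.valid p ; inside = f ; outside = Partial.outside p })

  record Hole (p : V) (κ : V → Col) : Set where
    constructor mkHole
    field
      part : Partial κ
      hole : κ p ≡ none
      full : ∀ v → S v ≡ true → v ≢ p → κ v ≢ none

  start : ∀ v → S v ≡ true → ∃ (Hole v)
  start v Sv with sub v Sv
  ... | κ , c = κ , mkHole (mkPartial (Colours.valid c) λ x e → Colours.outside c x (off x e))
          (Colours.outside c v (without-≡ S v)) λ x Sx ne → Colours.inside c x (trans (without-≢ S v x ne) Sx)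
    where
    off : ∀ x → S x ≡ false → without S v x ≡ false
    off x e rewrite e = refl

  fill : ∀ {p κ} c → S p ≡ true → Hole p κ → c ≢ none → ¬ Partial (κ [ p ≔ c ])
  fill {p} {κ} c Sp h cn q = complete q λ x Sx → case x ≟F p of λ where
    (yes e) z → cn (trans (sym (set-≡ κ p c e)) z)
    (no ne) z → Hole.full h x Sx ne (trans (sym (set-≢ κ p c ne)) z)

  alive-at : ∀ v → S v ≡ true → ∃ λ h → Alive h × vtx h ≡ v
  alive-at v Sv with F.any? (λ h → (alive h ≟B true) ×-dec (vtx h ≟F v))
  ... | yes r = r
  ... | no nr with start v Sv
  ...   | κ , h = ⊥-elim (fill cI Sv h (λ ()) (put-I v Sv (Hole.part h)
          λ { u (k , refl , refl) Su → ⊥-elim (nr (k , mkAlive k Sv Su , refl)) }))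

  deg≥3 : ∀ h → Alive h → 3 ≤ deg h
  deg≥3 h a with 3 ≤? deg h
  ... | yes q = q
  ... | no nq with start (vtx h) (alive-S a)
  ...   | κ , H with greedy (alive-S a) (Hole.part H) nb (Hole.hole H)
    where
    -- The hole itself fills the place of the uncoloured third neighbour.
    nb : Nb3 (vtx h) (vtx (α h)) (vtx (α (sg h))) (vtx h)
    nb u uv Su with neighbour h u a uv Su
    ... | zero , _ , e = inj₁ (sym e)
    ... | suc zero , _ , e = inj₂ (inj₁ (sym e))
    ... | suc (suc t) , lt , e = ⊥-elim (nq (≤-trans (s≤s (s≤s (s≤s z≤n))) lt))
  ...     | c , cn , q = ⊥-elim (fill c (alive-S a) H cn q)

  record Cubic (v a b c : V) : Set where
    constructor mkCubic
    field
      Sv : S v ≡ true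
      va : Adj v a
      vb : Adj v b
      vc : Adj v c
      Sa : S a ≡ true
      Sb : S b ≡ true
      Sc : S c ≡ true
      nb : Nb3 v a b c
      a≢b : a ≢ b
      b≢c : b ≢ c
      a≢c : a ≢ c

  cubic : ∀ h → Alive h → deg h ≡ 3 → Cubic (vtx h) (vtx (α h)) (vtx (α (sg h))) (vtx (α (sg (sg h))))
  cubic h a d3 = mkCubic (alive-S a) (h , refl , refl) (sg h , vtx-sg h , refl) (sg (sg h) , vtx-itersg 2 h , refl)
      (alive-S (alive-α a)) (alive-S (alive-α (alive-sg a))) (alive-S (alive-α (alive-sg (alive-sg a)))) nb
      (ne 0 1 (s≤s z≤n) (s≤s (s≤s z≤n)) λ ()) (ne 1 2 (s≤s (s≤s z≤n)) ≤-refl λ ()) (ne 0 2 (s≤s z≤n) ≤-refl λ ())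
    where
    ne : ∀ i j → i < 3 → j < 3 → i ≢ j → vtx (α (iter sg i h)) ≢ vtx (α (iter sg j h))
    ne i j p q n e = n (RS.per-distinct h i j (subst (i <_) (sym d3) p) (subst (j <_) (sym d3) q)
      (no-multi _ _ (trans (vtx-itersg i h) (sym (vtx-itersg j h))) e))
    nb : Nb3 (vtx h) (vtx (α h)) (vtx (α (sg h))) (vtx (α (sg (sg h))))
    nb u uv Su with neighbour h u a uv Su
    ... | zero , _ , e = inj₁ (sym e)
    ... | suc zero , _ , e = inj₂ (inj₁ (sym e))
    ... | suc (suc zero) , _ , e = inj₂ (inj₂ (sym e))
    ... | suc (suc (suc t)) , lt , e = ⊥-elim (<⇒≱ lt (≤-trans (≤-reflexive d3) (m≤m+n 3 t)))

  cub-rot : ∀ {v a b c} → Cubic v a b c → Cubic v b c a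
  cub-rot (mkCubic s x y z p q r n ab bc ac) = mkCubic s y z x q r p (rot3 n) bc (ac ∘ sym) (ab ∘ sym)

  data One (κ : V → Col) (a b c : V) : Set where
    one : κ a ≡ cI → κ b ≡ cF → κ c ≡ cF → One κ a b c
    two : κ a ≡ cF → κ b ≡ cI → κ c ≡ cF → One κ a b c
    three : κ a ≡ cF → κ b ≡ cF → κ c ≡ cI → One κ a b c

  I≢F : ∀ {κ : V → Col} {v} → κ v ≡ cI → κ v ≢ cF
  I≢F p q with trans (sym p) q
  ... | ()

  none≢ : ∀ {κ : V → Col} {v} c → c ≢ none → κ v ≡ none → κ v ≢ c
  none≢ c cn p q = cn (trans (sym q) p)

  coloured : ∀ {κ : V → Col} {v} → κ v ≢ none → κ v ≡ cI ⊎ κ v ≡ cF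
  coloured {κ} {v} n with κ v
  ... | none = ⊥-elim (n refl)
  ... | cI = inj₁ refl
  ... | cF = inj₂ refl

  -- otherwise v itself could be coloured
  see : ∀ {κ v a b c} → Hole v κ → Cubic v a b c → One κ a b c
  see {κ} {v} {a} {b} {c} H C = go (col a Sa va) (col b Sb vb) (col c Sc vc)
    where
    open Cubic C
    col : ∀ u → S u ≡ true → Adj v u → κ u ≡ cI ⊎ κ u ≡ cF
    col u Su vu = coloured {κ} {u} (Hole.full H u Su (λ e → adj-≢ vu (sym e)))
    F! : ∀ {x y z} → Nb3 v x y z → κ x ≢ cF → κ y ≢ cF → ⊥
    F! n p q = fill cF Sv H (λ ()) (F-3 Sv (Hole.part H) n p q)
    go : κ a ≡ cI ⊎ κ a ≡ cF → κ b ≡ cI ⊎ κ b ≡ cF → κ c ≡ cI ⊎ κ c ≡ cF → One κ a b c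
    go (inj₁ p) (inj₂ q) (inj₂ r) = one p q r
    go (inj₂ p) (inj₁ q) (inj₂ r) = two p q r
    go (inj₂ p) (inj₂ q) (inj₁ r) = three p q r
    go (inj₂ p) (inj₂ q) (inj₂ r) = ⊥-elim (fill cI Sv H (λ ()) (I-3 Sv (Hole.part H) nb
      (λ z → I≢F {κ} z p) (λ z → I≢F {κ} z q) (λ z → I≢F {κ} z r)))
    go (inj₁ p) (inj₁ q) _ = ⊥-elim (F! nb (I≢F {κ} p) (I≢F {κ} q))
    go (inj₁ p) (inj₂ _) (inj₁ r) = ⊥-elim (F! (rot3 (rot3 nb)) (I≢F {κ} r) (I≢F {κ} p))
    go (inj₂ _) (inj₁ q) (inj₁ r) = ⊥-elim (F! (rot3 nb) (I≢F {κ} q) (I≢F {κ} r))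

  shift : (V → Col) → V → V → V → Col
  shift κ v a = (κ [ a ≔ none ]) [ v ≔ κ a ]

  shift-v : ∀ κ v a → shift κ v a v ≡ κ a
  shift-v κ v a = set-≡ (κ [ a ≔ none ]) v (κ a) refl

  shift-a : ∀ κ v a → a ≢ v → shift κ v a a ≡ none
  shift-a κ v a n = trans (set-≢ (κ [ a ≔ none ]) v (κ a) n) (set-≡ κ a none refl)

  shift-other : ∀ κ v a x → x ≢ v → x ≢ a → shift κ v a x ≡ κ x
  shift-other κ v a x p q = trans (set-≢ (κ [ a ≔ none ]) v (κ a) p) (set-≢ κ a none q)

  -- By `see` exactly one neighbour is in `cI`. If it is `a`, no `cI` remains around `v`; otherwise
  -- `a` is in `cF` and just one neighbour in `cF` remains. Either way `v` can take over the colour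
  -- of `a`.
  move : ∀ {κ v a b c} → Hole v κ → Cubic v a b c → Hole a (shift κ v a)
  move {κ} {v} {a} {b} {c} H C = mkHole (go (see H C)) (shift-a κ v a (adj-≢ va ∘ sym)) full
    where
    open Cubic C
    κ' = κ [ a ≔ none ]
    P' : Partial κ'
    P' = part-none a (Hole.part H)
    κa : κ' a ≡ none
    κa = set-≡ κ a none refl
    keep : ∀ u k → k ≢ none → κ u ≢ k → κ' u ≢ k
    keep u k kn ne z with u ≟F a
    ... | yes _ = kn (sym z)
    ... | no _ = ne z
    go : One κ a b c → Partial (shift κ v a)
    go (one p q r) = subst (λ k → Partial (κ' [ v ≔ k ])) (sym p) (I-3 Sv P' nb (none≢ {κ'} cI (λ ()) κa)
      (keep b cI (λ ()) (λ z → I≢F {κ} z q)) (keep c cI (λ ()) λ z → I≢F {κ} z r))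
    go (two p q r) = subst (λ k → Partial (κ' [ v ≔ k ])) (sym p) (F-3 Sv P' nb (none≢ {κ'} cF (λ ()) κa) (keep b cF (λ ()) (I≢F {κ} q)))
    go (three p q r) = subst (λ k → Partial (κ' [ v ≔ k ])) (sym p) (F-3 Sv P' (rot3 (rot3 nb)) (keep c cF (λ ()) (I≢F {κ} r)) (none≢ {κ'} cF (λ ()) κa))
    full : ∀ u → S u ≡ true → u ≢ a → shift κ v a u ≢ none
    full u Su ua z with u ≟F v
    ... | yes _ = Hole.full H a Sa (adj-≢ va ∘ sym) z
    ... | no uv with u ≟F a
    ...   | yes e = ua e
    ...   | no _ = Hole.full H u Su uv z

  -- A cycle of vertices of degree 3 with third neighbours `o i`, indexed periodically by all of ℕ
  -- so that rotations need no modular indices.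
  record Ring (k : ℕ) : Set where
    field
      p o : ℕ → V
      p-per : ∀ i → p (i + k) ≡ p i
      o-per : ∀ i → o (i + k) ≡ o i
      cub : ∀ i → Cubic (p (suc i)) (p i) (p (2 + i)) (o (suc i))
      apart : ∀ i t → suc t < k → p i ≢ p (suc t + i)

    Off : V → Set
    Off x = ∀ i → x ≢ p i

    record Rim (κ : V → Col) : Set where
      constructor mkRim
      field
        part : Partial κ
        unc : ∀ i → κ (p i) ≡ none
        full : ∀ v → S v ≡ true → Off v → κ v ≢ none

    apart' : ∀ i j → i < j → j < k → p i ≢ p j
    apart' i j lt jk q = apart i (j ∸ suc i) (subst (_< k) (sym e) (≤-<-trans (m∸n≤m j i) jk)) (trans q (cong p (sym (trans (cong (_+ i) e) (m∸n+n≡m (<⇒≤ lt))))) )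
      where
      e : suc (j ∸ suc i) ≡ j ∸ i
      e = sym (+-∸-assoc 1 lt)

  rotate : ∀ {k} → ℕ → Ring k → Ring k
  rotate {k} s R = record
    { p = λ i → p (i + s) ; o = λ i → o (i + s)
    ; p-per = λ i → trans (cong p (sw i)) (p-per (i + s)) ; o-per = λ i → trans (cong o (sw i)) (o-per (i + s))
    ; cub = λ i → cub (i + s)
    ; apart = λ i t lt q → apart (i + s) t lt (trans q (cong (λ z → p (suc z)) (+-assoc t i s))) }
    where
    open Ring R
    sw : ∀ i → i + k + s ≡ i + s + k
    sw i = trans (+-assoc i k s) (trans (cong (i +_) (+-comm k s)) (sym (+-assoc i s k)))

  module _ {m : ℕ} (R : Ring (suc (suc m))) where
    open Ring R
    private
      k : ℕ
      k = suc (suc m)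

    cub₀ : Cubic (p 0) (p (suc m)) (p 1) (o 0)
    cub₀ = subst₂ (λ x y → Cubic x (p (suc m)) y (o 0)) (p-per 0) (p-per 1) (subst (Cubic (p k) (p (suc m)) (p (suc k))) (o-per 0) (cub (suc m)))

    record Arc (κ₀ : V → Col) (j : ℕ) (κ : V → Col) : Set where
      field
        part : Partial κ
        first : κ (p 0) ≡ cI
        done : ∀ i → i ≤ j → κ (p i) ≢ none
        todo : ∀ i → j < i → i < k → κ (p i) ≡ none
        off : ∀ x → Off x → κ x ≡ κ₀ x

    arc-set : ∀ {κ₀ j κ} c → suc j < k → c ≢ none → Arc κ₀ j κ → Partial (κ [ p (suc j) ≔ c ]) → Arc κ₀ (suc j) (κ [ p (suc j) ≔ c ])
    arc-set {κ₀} {j} {κ} c lt cn A q = record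
      { part = q
      ; first = trans (set-≢ κ (p (suc j)) c (apart' 0 (suc j) (s≤s z≤n) lt)) (Arc.first A)
      ; done = dn
      ; todo = λ i ji ik → trans (set-≢ κ (p (suc j)) c (λ e → apart' (suc j) i ji ik (sym e))) (Arc.todo A i (<-trans (n<1+n j) ji) ik)
      ; off = λ x ox → trans (set-≢ κ (p (suc j)) c (ox (suc j))) (Arc.off A x ox) }
      where
      dn : ∀ i → i ≤ suc j → (κ [ p (suc j) ≔ c ]) (p i) ≢ none
      dn i le z with p i ≟F p (suc j)
      ... | yes _ = cn z
      ... | no ne with m≤n⇒m<n∨m≡n le
      ...   | inj₁ (s≤s le') = Arc.done A i le' z
      ...   | inj₂ e = ne (cong p e)

    arc-first : ∀ {κ} → Rim κ → κ (o 0) ≢ cI → Arc κ 0 (κ [ p 0 ≔ cI ])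
    arc-first {κ} r ne = record
      { part = I-3 (Cubic.Sv cub₀) part (Cubic.nb cub₀) (none≢ {κ} cI (λ ()) (unc (suc m))) (none≢ {κ} cI (λ ()) (unc 1)) ne
      ; first = set-≡ κ (p 0) cI refl
      ; done = λ { .0 z≤n z → case trans (sym (set-≡ κ (p 0) cI refl)) z of λ () }
      ; todo = λ i 0<i ik → trans (set-≢ κ (p 0) cI (λ e → apart' 0 i 0<i ik (sym e))) (unc i)
      ; off = λ x ox → set-≢ κ (p 0) cI (ox 0) }
      where open Rim r

    arc-step : ∀ {κ₀ j κ} → suc (suc j) < k → Arc κ₀ j κ → ∃ (Arc κ₀ (suc j))
    arc-step {κ₀} {j} {κ} lt A with greedy (Cubic.Sv (cub j)) (Arc.part A) (rot3 (rot3 (Cubic.nb (cub j)))) (Arc.todo A (2 + j) (s≤s (n≤1+n j)) lt)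
    ... | c , cn , q = κ [ p (suc j) ≔ c ] , arc-set c (<-trans (n<1+n _) lt) cn A q

    arc-run : ∀ {κ} → Rim κ → κ (o 0) ≢ cI → ∀ j → suc j < k → ∃ (Arc κ j)
    arc-run r ne zero lt = _ , arc-first r ne
    arc-run r ne (suc j) lt = arc-step lt (proj₂ (arc-run r ne j (<-trans (n<1+n _) lt)))

    finish : ∀ {κ₀ κ} → Rim κ₀ → Arc κ₀ (suc m) κ → ⊥
    finish {κ₀} {κ} r A = complete (Arc.part A) f
      where
      onRing : ∀ v → Dec (∃ λ (i : Fin k) → v ≡ p (toℕ i))
      onRing v = F.any? λ i → v ≟F p (toℕ i)
      f : Full κ
      f v Sv with onRing v
      ... | yes (i , e) = λ z → Arc.done A (toℕ i) (≤-pred (F.toℕ<n i)) (trans (cong κ (sym e)) z)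
      ... | no nr = λ z → Rim.full r v Sv ov (trans (sym (Arc.off A v ov)) z)
        where
        ov : Off v
        ov i e = nr (fromℕ< ik , trans e (trans (cong p (m≡m%n+[m/n]*n i k)) (trans (periodic p p-per (i % k) (i / k)) (cong p (sym (F.toℕ-fromℕ< ik))))))
          where
          ik : i % k < k
          ik = m%n<n i k

    -- The last vertex already has `p 0` in `cI`; one more neighbour outside `cF` lets it take `cF`.
    arc-last : ∀ {κ₀ κ} → Rim κ₀ → Arc κ₀ m κ → (κ (p m) ≢ cF ⊎ κ (o (suc m)) ≢ cF) → ⊥
    arc-last {κ₀} {κ} r A h = finish r (arc-set cF ≤-refl (λ ()) A (go h))
      where
      C = cub m
      pk : κ (p k) ≢ cF
      pk z = I≢F {κ} (trans (cong κ (p-per 0)) (Arc.first A)) z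
      go : κ (p m) ≢ cF ⊎ κ (o (suc m)) ≢ cF → Partial (κ [ p (suc m) ≔ cF ])
      go (inj₁ x) = F-3 (Cubic.Sv C) (Arc.part A) (Cubic.nb C) x pk
      go (inj₂ x) = F-3 (Cubic.Sv C) (Arc.part A) (rot3 (Cubic.nb C)) pk x

  -- p 0 has its outer neighbour in F and its predecessor in I: start with p 0 in I, go
  -- round greedily, and the last vertex sees two vertices of I.
  ring-mixed₀ : ∀ {m κ} (R : Ring (suc (suc m))) → Ring.Rim R κ → (∀ i → Ring.Off R (Ring.o R i)) →
    κ (Ring.o R 0) ≡ cF → κ (Ring.o R (suc m)) ≡ cI → ⊥
  ring-mixed₀ {m} {κ} R r off e0 e1 with arc-run R r (λ z → I≢F {κ} z e0) m ≤-refl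
  ... | κ' , A = arc-last R r A (inj₂ λ z → I≢F {κ} e1 (trans (sym (Arc.off A _ (off (suc m)))) z))

  off-rotate : ∀ {k} s (R : Ring (suc k)) v → Ring.Off (rotate s R) v → Ring.Off R v
  off-rotate {k} s R v ov i e = ov (i + s * suc k ∸ s) (trans e (trans (sym (periodic p p-per i s))
      (cong p (sym (m∸n+n≡m {i + s * suc k} {s} (≤-trans (m≤m*n s (suc k)) (m≤n+m (s * suc k) i)))))))
    where open Ring R

  rim-rotate : ∀ {k κ} s (R : Ring (suc k)) → Ring.Rim R κ → Ring.Rim (rotate s R) κ
  rim-rotate s R r = record
    { part = Ring.Rim.part r ; unc = λ i → Ring.Rim.unc r (i + s)
    ; full = λ v Sv ov → Ring.Rim.full r v Sv (off-rotate s R v ov) }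

  -- If both colours occur outside, then somewhere going round an outer `cI` is directly followed by
  -- an outer `cF`; `ring-mixed₀` applies to the ring rotated to that place.
  ring-mixed : ∀ {m κ} (R : Ring (suc (suc m))) → Ring.Rim R κ → (∀ i → Ring.Off R (Ring.o R i)) →
    (∀ i → κ (Ring.o R i) ≡ cI ⊎ κ (Ring.o R i) ≡ cF) →
    ∀ i j → κ (Ring.o R i) ≡ cI → κ (Ring.o R j) ≡ cF → ⊥
  ring-mixed {m} {κ} R r off col i j eI eF = go (least (λ t → κ (o (t + i)) ≟C cF) t₀ far)
    where
    open Ring R
    k : ℕ
    k = suc (suc m)
    -- A shift that leads from `i` to an index congruent to `j` modulo `k`.
    t₀ = j + i * k ∸ i
    far : κ (o (t₀ + i)) ≡ cF
    far = trans (cong (κ ∘ o) (m∸n+n≡m {j + i * k} {i} (≤-trans (m≤m*n i k) (m≤n+m (i * k) j)))) (trans (cong κ (periodic o o-per j i)) eF)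
    go : Least (λ t → κ (o (t + i)) ≡ cF) → ⊥
    go (mkLeast zero h _) = I≢F {κ} eI h
    go (mkLeast (suc t) h b) with col (t + i)
    ... | inj₂ x = b t ≤-refl x
    ... | inj₁ x = ring-mixed₀ (rotate (suc (t + i)) R) (rim-rotate (suc (t + i)) R r)
          (λ l v e → off (l + suc (t + i)) (v + suc (t + i)) e) h
          (trans (cong (κ ∘ o) (trans (+-suc (suc m) (t + i)) (trans (cong suc (+-comm (suc m) (t + i))) (sym (+-suc (t + i) (suc m)))))) (trans (cong κ (o-per (t + i))) x))

  -- An even ring with all outer neighbours in F is coloured alternately.
  ring-even : ∀ {m κ} (R : Ring (suc (suc (m + m)))) → Ring.Rim R κ → (∀ i → Ring.Off R (Ring.o R i)) →
    (∀ i → κ (Ring.o R i) ≡ cF) → ⊥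
  ring-even {m} {κ} R r off allF with run m ≤-refl
    where
    open Ring R
    k : ℕ
    k = suc (suc (m + m))
    run : ∀ j → j ≤ m → ∃ λ κ' → Arc R κ (j + j) κ' × κ' (p (j + j)) ≡ cI
    run zero _ = _ , arc-first R r (λ z → I≢F {κ} z (allF 0)) , set-≡ κ (p 0) cI refl
    run (suc j) lt with run j (≤-trans (n≤1+n j) lt)
    ... | κ' , A , eI rewrite +-suc j j = κ₂ , A₂ , set-≡ κ₁ (p (2 + (j + j))) cI refl
      where
      lt₁ : suc (suc (j + j)) < k
      lt₁ = s≤s (s≤s (≤-trans (≤-reflexive (sym (+-suc j j))) (+-mono-≤ (≤-trans (n≤1+n j) lt) lt)))
      C₁ = cub (j + j)
      κ₁ = κ' [ p (suc (j + j)) ≔ cF ]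
      A₁ : Arc R κ (suc (j + j)) κ₁
      A₁ = arc-set R cF (<-trans (n<1+n _) lt₁) (λ ()) A (F-3 (Cubic.Sv C₁) (Arc.part A) (Cubic.nb C₁)
        (I≢F {κ'} eI) (none≢ {κ'} cF (λ ()) (Arc.todo A _ (s≤s (n≤1+n _)) lt₁)))
      C₂ = cub (suc (j + j))
      κ₂ = κ₁ [ p (2 + (j + j)) ≔ cI ]
      lt₂ : suc (suc (suc (j + j))) < k
      lt₂ = s≤s (s≤s (≤-trans (≤-reflexive (cong suc (sym (+-suc j j)))) (+-mono-≤ lt lt)))
      A₂ : Arc R κ (2 + (j + j)) κ₂
      A₂ = arc-set R cI lt₁ (λ ()) A₁ (I-3 (Cubic.Sv C₂) (Arc.part A₁) (Cubic.nb C₂)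
        (λ z → case trans (sym (set-≡ κ' (p (suc (j + j))) cF refl)) z of λ ())
        (none≢ {κ₁} cI (λ ()) (Arc.todo A₁ _ (s≤s (n≤1+n _)) lt₂))
        λ z → I≢F {κ₁} z (trans (Arc.off A₁ _ (off _)) (allF _)))
  ... | κ' , A , eI = arc-last R r A (inj₁ (I≢F {κ'} eI))

  -- Boundary walks of faces and their possible lengths

  at : ℕ → Fin d → V
  at i h = vtx (iter ψ i h)

  Len : ℕ → Fin d → Set
  Len k h = len h ≡ k

  wrapD : ∀ {h k} → Len k h → ∀ i → iter ψ (i + k) h ≡ iter ψ i h
  wrapD {h} refl i = RF.iter-per h i

  wrap : ∀ {h k} → Len k h → ∀ i → at (i + k) h ≡ at i h
  wrap l i = cong vtx (wrapD l i)

  len-iter : ∀ t h → len (iter ψ t h) ≡ len h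
  len-iter = RF.per-iter

  edge : ∀ h → Adj (vtx h) (vtx (α h))
  edge h = h , refl , refl

  adj : ∀ {h} → Alive h → ∀ i → Adj (at i h) (at (suc i) h)
  adj a i = _ , refl , sym (vtx-ψ (alive-iterψ i a))

  same : ∀ g k → vtx g ≡ vtx k → vtx (α g) ≡ vtx (α k) → g ≡ k
  same = no-multi

  sg≢ : ∀ {h} → Alive h → sg h ≢ h
  sg≢ {h} a e = <⇒≱ (deg≥3 h a) (≤-trans (RS.per-least h 1 (s≤s z≤n) e) (s≤s z≤n))

  sgsg≢ : ∀ {h} → Alive h → sg (sg h) ≢ h
  sgsg≢ {h} a e = <⇒≱ (deg≥3 h a) (RS.per-least h 2 (s≤s z≤n) e)

  -- A boundary walk turns straight back only at a vertex of degree 1.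
  nb2₀ : ∀ {h} → Alive h → at 0 h ≢ at 2 h
  nb2₀ {h} a e = sg≢ (alive-α a) (trans (sym (ψ-alive a)) (same (ψ h) (α h) (vtx-ψ a)
    (trans (sym (vtx-ψ (alive-ψ a))) (trans (sym e) (cong vtx (sym (α-inv h)))))))

  nb2 : ∀ {h} → Alive h → ∀ i → at i h ≢ at (2 + i) h
  nb2 a i = nb2₀ (alive-iterψ i a)

  -- consecutive corners at the head of p: the face of ψ p and the face of α (ψ p)
  corner : ∀ {p} → Alive p → vtx p ≢ vtx (α (sg (ψ p)))
  corner {p} a e = sgsg≢ (alive-α a) (trans (cong sg (sym (ψ-alive a))) (same (sg (ψ p)) (α p)
    (trans (vtx-sg (ψ p)) (vtx-ψ a)) (trans (sym e) (cong vtx (sym (α-inv p))))))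

  at-α0 : ∀ {h} → Alive h → at 0 (α h) ≡ at 1 h
  at-α0 a = sym (vtx-ψ a)

  at-α1 : ∀ {h} → Alive h → at 1 (α h) ≡ at 0 h
  at-α1 {h} a = trans (vtx-ψ (alive-α a)) (cong vtx (α-inv h))

  -- Meant for the case that the face across `h` is a triangle: its vertex off `h`.
  tip : Fin d → V
  tip h = at 2 (α h)

  tip-adj₀ : ∀ {h} → Alive h → Adj (at 0 h) (tip h)
  tip-adj₀ {h} a = subst (λ z → Adj z (tip h)) (at-α1 a) (adj (alive-α a) 1)

  tip-adj₁ : ∀ {h} → Alive h → Len 3 (α h) → Adj (tip h) (at 1 h)
  tip-adj₁ {h} a l = subst (Adj (tip h)) (trans (wrap l 0) (at-α0 a)) (adj (alive-α a) 2)

  -- Otherwise the triangle continues along the edge after `h`, and the head of `h` has degree at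
  -- most 2.
  tip-next : ∀ {h} → Alive h → Len 3 (α h) → tip h ≢ at 2 h
  tip-next {h} a l e = sgsg≢ (alive-α a) (trans (cong sg (trans (sym (ψ-alive a)) (same (ψ h) (α g) v₁ v₂)))
      (trans (sym (ψ-alive ag)) (wrapD l 0)))
    where
    g = iter ψ 2 (α h)
    ag : Alive g
    ag = alive-iterψ 2 (alive-α a)
    v₁ : vtx (ψ h) ≡ vtx (α g)
    v₁ = trans (vtx-ψ a) (trans (sym (wrap l 0)) (vtx-ψ ag))
    v₂ : vtx (α (ψ h)) ≡ vtx (α (α g))
    v₂ = trans (sym (vtx-ψ (alive-ψ a))) (trans (sym e) (cong vtx (sym (α-inv g))))

  tip-prev : ∀ {p} → Alive p → Len 3 (α (ψ p)) → tip (ψ p) ≢ vtx p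
  tip-prev {p} a l e = sgsg≢ (alive-α a) (trans (cong sg (sym (ψ-alive a))) (trans (cong sg (sym (α-inv (ψ p)))) (trans (sym (ψ-alive (alive-α (alive-ψ a))))
      (same (ψ k) (α p) v₁ v₂))))
    where
    k = α (ψ p)
    v₁ : vtx (ψ k) ≡ vtx (α p)
    v₁ = trans (at-α1 (alive-ψ a)) (vtx-ψ a)
    v₂ : vtx (α (ψ k)) ≡ vtx (α (α p))
    v₂ = trans (sym (vtx-ψ (alive-ψ (alive-α (alive-ψ a))))) (trans e (cong vtx (sym (α-inv p))))

  tip-prev' : ∀ {h m} → Alive h → len h ≡ suc m → Len 3 (α h) → tip h ≢ at m h
  tip-prev' {h} {m} a lh l e = tip-prev {iter ψ m h} (alive-iterψ m a) (subst (λ z → Len 3 (α z)) q l) (trans (cong tip (sym q)) e)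
    where
    q : h ≡ ψ (iter ψ m h)
    q = sym (wrapD lh 0)

  -- In a simple graph a boundary that traverses `h` backwards contains the dart `α h`, so both
  -- sides of the edge lie on one face.
  rev-dart : ∀ {h} → Alive h → ∀ i → at i h ≡ at 1 h → at (suc i) h ≡ at 0 h → len (α h) ≡ len h
  rev-dart {h} a i e e' = trans (cong len (same (α h) (iter ψ i h) (trans (at-α0 a) (sym e))
    (trans (cong vtx (α-inv h)) (trans (sym e') (vtx-ψ (alive-iterψ i a)))))) (len-iter i h)

  face-five : ∀ {h} → Alive h → Len 5 h → Five (at 0 h) (at 1 h) (at 2 h) (at 3 h) (at 4 h)
  face-five {h} a l = five (adj a 0) (adj a 1) (adj a 2) (adj a 3) (subst (Adj (at 4 h)) (wrap l 0) (adj a 4))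
    (nb2 a 0) (nb2 a 1) (nb2 a 2) (λ e → nb2 a 3 (trans e (sym (wrap l 0)))) (λ e → nb2 a 4 (trans e (sym (wrap l 1))))

  len≢1 : ∀ {h} → Alive h → ¬ Len 1 h
  len≢1 {h} a l = adj-≢ (adj a 0) (sym (wrap l 0))

  len≢2 : ∀ {h} → Alive h → ¬ Len 2 h
  len≢2 {h} a l = nb2 a 0 (sym (wrap l 0))

  len≢4 : ∀ {h} → Alive h → ¬ Len 4 h
  len≢4 {h} a l = noC4 (adj a 0) (adj a 1) (adj a 2) (subst (Adj (at 3 h)) (wrap l 0) (adj a 3)) (nb2 a 0) (nb2 a 1)

  len≢7 : ∀ {h} → Alive h → ¬ Len 7 h
  len≢7 {h} a l = N7 (adj a 0) (adj a 1) (adj a 2) (adj a 3) (adj a 4) (adj a 5) (subst (Adj (at 6 h)) (wrap l 0) (adj a 6))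
    (nb2 a 0) (nb2 a 1) (nb2 a 2) (nb2 a 3) (nb2 a 4) (λ e → nb2 a 5 (trans e (sym (wrap l 0)))) (λ e → nb2 a 6 (trans e (sym (wrap l 1))))

  module Tri {h : Fin d} (a : Alive h) (t : Len 3 (α h)) where
    x : ℕ → V
    x i = at i h
    c : V
    c = tip h
    e : ∀ i → Adj (x i) (x (suc i))
    e = adj a
    n2 : ∀ i → x i ≢ x (2 + i)
    n2 = nb2 a
    ac : Adj (x 0) c
    ac = tip-adj₀ a
    cb : Adj c (x 1)
    cb = tip-adj₁ a t
    c≢x2 : c ≢ x 2
    c≢x2 = tip-next a t

    apex : ∀ {y} → Adj (x 0) y → Adj y (x 1) → c ≡ y
    apex = apex-unique (e 0) ac cb

    no-rev : ∀ {k} → Len k h → k ≢ 3 → ∀ i → x i ≡ x 1 → x (suc i) ≡ x 0 → ⊥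
    no-rev l k3 i p q = k3 (trans (sym l) (trans (sym (rev-dart a i p q)) t))

    len≢3 : ¬ Len 3 h
    len≢3 l = c≢x2 (apex (adj-sym (subst (Adj (x 2)) (wrap l 0) (e 2))) (adj-sym (e 1)))

    len≢5 : ¬ Len 5 h
    len≢5 l = no35 c (face-five a l) ac cb

    -- Replacing the edge `h` by the detour over `c` gives a closed walk of length 7.
    len≢6 : ¬ Len 6 h
    len≢6 l = N7 cb (e 1) (e 2) (e 3) (e 4) (subst (Adj (x 5)) (wrap l 0) (e 5)) ac
      c≢x2 (n2 1) (n2 2) (n2 3) (λ q → n2 4 (trans q (sym (wrap l 0)))) (tip-prev' a l t ∘ sym) (adj-≢ (e 0))

    -- The detour over `c` gives length 9. Most coincidences at distance three close a pentagon
    -- through the edge `h`, on which `c` forms a triangle.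
    len≢8 : ¬ Len 8 h
    len≢8 l = N9 cb (e 1) (e 2) (e 3) (e 4) (e 5) (e 6) e7 ac
        c≢x2 (n2 1) (n2 2) (n2 3) (n2 4) (n2 5) x6≢x0 c≢x7' (adj-≢ (e 0))
        k₁ k₂ k₃ k₄ k₅ k₆ k₇ x7≢x1 (n2 0)
      where
      w0 = wrap l 0
      e7 : Adj (x 7) (x 0)
      e7 = subst (Adj (x 7)) w0 (e 7)
      x6≢x0 : x 6 ≢ x 0
      x6≢x0 q = n2 6 (trans q (sym w0))
      x7≢x1 : x 7 ≢ x 1
      x7≢x1 q = n2 7 (trans q (sym (wrap l 1)))
      c≢x7' : x 7 ≢ c
      c≢x7' q = tip-prev' a l t (sym q)
      k₁ : c ≢ x 3
      k₁ q = noC4 (e 0) (e 1) (subst (Adj (x 2)) (sym q) (e 2)) (adj-sym ac) (n2 0) (adj-≢ cb ∘ sym)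
      k₂ : x 1 ≢ x 4
      k₂ q = no35 c (five (e 0) (subst (λ z → Adj z (x 5)) (sym q) (e 4)) (e 5) (e 6) e7
        (λ r → no-rev l (λ ()) 4 (sym q) (sym r)) (λ r → n2 4 (trans (sym q) r)) (n2 5) x6≢x0 x7≢x1) ac cb
      k₃ : x 2 ≢ x 5
      k₃ q = no35 c (five (e 0) (e 1) (subst (λ z → Adj z (x 6)) (sym q) (e 5)) (e 6) e7
        (n2 0) (λ r → tip-prev' a l t (apex (adj-sym e7) (adj-sym (subst (λ z → Adj z (x 7)) (sym r) (e 6)))))
        (λ r → n2 5 (trans (sym q) r)) x6≢x0 x7≢x1) ac cb
      k₄ : x 3 ≢ x 6
      k₄ q = no35 c (five (e 0) (e 1) (e 2) (subst (λ z → Adj z (x 7)) (sym q) (e 6)) e7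
        (n2 0) (n2 1) (λ r → c≢x2 (apex (adj-sym (subst (λ z → Adj z (x 0)) (sym r) e7)) (adj-sym (e 1))))
        (λ r → x6≢x0 (trans (sym q) r)) x7≢x1) ac cb
      k₅ : x 4 ≢ x 7
      k₅ q = no35 c (five (e 0) (e 1) (e 2) (e 3) (subst (λ z → Adj z (x 0)) (sym q) e7)
        (n2 0) (n2 1) (n2 2) (λ r → c≢x2 (apex (adj-sym (subst (Adj (x 2)) r (e 2))) (adj-sym (e 1))))
        (λ r → x7≢x1 (trans (sym q) r))) ac cb
      k₆ : x 5 ≢ x 0
      k₆ q = no35 c (five (e 0) (e 1) (e 2) (e 3) (subst (Adj (x 4)) q (e 4))
        (n2 0) (n2 1) (n2 2) (λ r → n2 3 (trans r (sym q)))
        (λ r → no-rev l (λ ()) 4 r q)) ac cb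
      k₇ : x 6 ≢ c
      k₇ q = noC4 (adj-sym (e 0)) (adj-sym e7) (adj-sym (e 6)) (subst (λ z → Adj z (x 1)) (sym q) cb) (x7≢x1 ∘ sym) (λ r → adj-≢ ac (trans r q))

    -- a 9-face has two vertices at distance 3, so it splits into a triangle and a closed 6-walk
    len≢9 : ¬ Len 9 h
    len≢9 l = N9 (e 0) (e 1) (e 2) (e 3) (e 4) (e 5) (e 6) (e 7) e8
        (n2 0) (n2 1) (n2 2) (n2 3) (n2 4) (n2 5) (n2 6) x7≢x0 x8≢x1
        k₀ k₁ k₂ k₃ k₄ k₅ k₆ k₇ k₈
      where
      w0 = wrap l 0
      w1 = wrap l 1
      e8 : Adj (x 8) (x 0)
      e8 = subst (Adj (x 8)) w0 (e 8)
      x7≢x0 : x 7 ≢ x 0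
      x7≢x0 q = n2 7 (trans q (sym w0))
      x8≢x1 : x 8 ≢ x 1
      x8≢x1 q = n2 8 (trans q (sym w1))
      c≢x8 : c ≢ x 8
      c≢x8 = tip-prev' a l t
      adj-subst : ∀ {u v w} → u ≡ v → Adj v w → Adj u w
      adj-subst refl z = z
      k₀ : x 0 ≢ x 3
      k₀ q = c≢x2 (apex (adj-sym (subst (Adj (x 2)) (sym q) (e 2))) (adj-sym (e 1)))
      k₇ : x 7 ≢ x 1
      k₇ q = c≢x8 (apex (adj-sym e8) (adj-sym (adj-subst (sym q) (e 7))))
      k₈ : x 8 ≢ x 2
      k₈ q = c≢x2 (apex (adj-sym (adj-subst (sym q) e8)) (adj-sym (e 1)))
      k₁ : x 1 ≢ x 4
      -- Cutting off the triangle on `x 1`, `x 2`, `x 3` leaves a closed 6-walk through the edge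
      -- `h`. The detour over `c` makes it a 7-walk, which degenerates only for `c = x 5`; then a
      -- pentagon borders a triangle.
      k₁ q with c ≟F x 5
      ... | no n = N7 (subst (Adj c) q cb) (e 4) (e 5) (e 6) (e 7) e8 ac n (n2 4) (n2 5) (n2 6) x7≢x0 (c≢x8 ∘ sym)
              (λ r → adj-≢ (e 0) (trans r (sym q)))
      ... | yes r = no35 (x 1) (five ac (adj-subst r (e 5)) (e 6) (e 7) e8
              (λ z → tip-next (alive-iterψ 4 a) t4 (trans (sym tip4) z))
              (λ z → n2 5 (trans (sym r) z)) (n2 6) x7≢x0 (c≢x8 ∘ sym)) (e 0) (adj-sym cb)
        where
        -- the edge from x 4 = x 1 to x 5 = c is again an edge of the triangle
        g = iter ψ 2 (α h)
        ag : Alive g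
        ag = alive-iterψ 2 (alive-α a)
        α4 : α (iter ψ 4 h) ≡ g
        α4 = same _ _ (trans (sym (vtx-ψ (alive-iterψ 4 a))) (sym r))
               (trans (cong vtx (α-inv _)) (trans (sym q) (trans (sym (at-α0 a)) (trans (sym (wrap t 0)) (vtx-ψ ag)))))
        t4 : Len 3 (α (iter ψ 4 h))
        t4 = trans (cong len α4) (trans (len-iter 2 (α h)) t)
        tip4 : x 0 ≡ tip (iter ψ 4 h)
        tip4 = sym (trans (cong (at 2) α4) (trans (wrap t 1) (at-α1 a)))
      k₆ : x 6 ≢ x 0
      k₆ q with x 5 ≟F c
      ... | no n = N7 cb (e 1) (e 2) (e 3) (e 4) (subst (Adj (x 5)) q (e 5)) ac c≢x2 (n2 1) (n2 2) (n2 3)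
              (λ r → n2 4 (trans r (sym q))) n (adj-≢ (e 0))
      ... | yes r = no35 (x 0) (five cb (e 1) (e 2) (e 3) (subst (Adj (x 4)) r (e 4))
              c≢x2 (n2 1) (n2 2) (λ z → n2 3 (trans z (sym r)))
              (λ z → tip-prev {iter ψ 4 h} (alive-iterψ 4 a) t5 (trans tip5 (sym z)))) (adj-sym ac) (e 0)
        where
        g = ψ (α h)
        α5 : α (iter ψ 5 h) ≡ g
        α5 = same _ _ (trans (sym (vtx-ψ (alive-iterψ 5 a))) (trans q (sym (at-α1 a))))
               (trans (cong vtx (α-inv _)) (trans r (vtx-ψ (alive-ψ (alive-α a)))))
        t5 : Len 3 (α (ψ (iter ψ 4 h)))
        t5 = trans (cong len α5) (trans (len-iter 1 (α h)) t)
        tip5 : tip (ψ (iter ψ 4 h)) ≡ x 1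
        tip5 = trans (cong (at 2) α5) (trans (wrap t 0) (at-α0 a))
      k₂ : x 2 ≢ x 5
      k₂ q = N7 cb (e 1) (adj-subst q (e 5)) (e 6) (e 7) e8 ac
        c≢x2 (λ r → noC4 (adj-subst r (e 6)) (e 7) e8 (e 0) (n2 6 ∘ trans (sym r)) x7≢x0) (λ r → n2 5 (trans (sym q) r)) (n2 6) x7≢x0 (c≢x8 ∘ sym) (adj-≢ (e 0))
      k₃ : x 3 ≢ x 6
      k₃ q = N7 cb (e 1) (e 2) (adj-subst q (e 6)) (e 7) e8 ac
        c≢x2 (n2 1) (λ r → noC4 (adj-subst r (e 7)) e8 (e 0) (e 1) (x7≢x0 ∘ trans (sym r)) x8≢x1) (λ r → n2 6 (trans (sym q) r)) x7≢x0 (c≢x8 ∘ sym) (adj-≢ (e 0))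
      k₄ : x 4 ≢ x 7
      k₄ q = N7 cb (e 1) (e 2) (e 3) (adj-subst q (e 7)) e8 ac
        c≢x2 (n2 1) (n2 2) (λ r → noC4 (adj-subst r e8) (e 0) (e 1) (e 2) (x8≢x1 ∘ trans (sym r)) (n2 0)) (λ r → x7≢x0 (trans (sym q) r)) (c≢x8 ∘ sym) (adj-≢ (e 0))
      k₅ : x 5 ≢ x 8
      k₅ q = N7 cb (e 1) (e 2) (e 3) (e 4) (adj-subst q e8) ac
        c≢x2 (n2 1) (n2 2) (n2 3) (λ r → noC4 (e 0) (e 1) (e 2) (subst (Adj (x 3)) r (e 3)) (n2 0) (n2 1)) (λ r → c≢x8 (trans (sym r) q)) (adj-≢ (e 0))

    len≥10 : 10 ≤ len h
    len≥10 with len h in l | RF.per>0 h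
    ... | 1 | _ = ⊥-elim (len≢1 a l)
    ... | 2 | _ = ⊥-elim (len≢2 a l)
    ... | 3 | _ = ⊥-elim (len≢3 l)
    ... | 4 | _ = ⊥-elim (len≢4 a l)
    ... | 5 | _ = ⊥-elim (len≢5 l)
    ... | 6 | _ = ⊥-elim (len≢6 l)
    ... | 7 | _ = ⊥-elim (len≢7 a l)
    ... | 8 | _ = ⊥-elim (len≢8 l)
    ... | 9 | _ = ⊥-elim (len≢9 l)
    ... | suc (suc (suc (suc (suc (suc (suc (suc (suc (suc k))))))))) | _ = m≤m+n 10 k

  -- Without the common edge the two boundaries form a closed walk of length 5 + 6 - 2 = 9. A
  -- coincidence on it would mean a boundary turning back, a vertex of degree 2, or a triangle on an
  -- edge of the pentagon.
  five-six : ∀ {f} → Alive f → Len 5 f → ¬ Len 6 (α f)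
  five-six {f} a l l' = N9 ax2 (e 2) (e 3) (e 4) e5 bp pq qr ra
      (λ q → n2 1 (trans x1 q)) (n2 2) (n2 3) (λ q → n2 4 (trans q (trans x0 (sym (wrap l' 0)))))
      x5≢p b≢q p≢r q≢a r≢x2
      k₀ k₁ k₂ k₃ k₄ (r≢b ∘ sym) (a≢p ∘ sym) k₇ k₈
    where
    open Five (face-five a l)
    F5 = face-five a l
    x : ℕ → V
    x i = at i (α f)
    aα = alive-α a
    e : ∀ i → Adj (x i) (x (suc i))
    e = adj aα
    n2 : ∀ i → x i ≢ x (2 + i)
    n2 = nb2 aα
    x0 : at 1 f ≡ x 0
    x0 = sym (at-α0 a)
    x1 : x 1 ≡ at 0 f
    x1 = at-α1 a
    ax2 : Adj (at 0 f) (x 2)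
    ax2 = subst (λ z → Adj z (x 2)) x1 (e 1)
    e5 : Adj (x 5) (at 1 f)
    e5 = subst (Adj (x 5)) (trans (wrap l' 0) (sym x0)) (e 5)
    x5≢p : x 5 ≢ at 2 f
    x5≢p q = corner {iter ψ 5 (α f)} (alive-iterψ 5 aα) (trans q (trans (vtx-ψ (alive-ψ a))
      (cong (vtx ∘ α) (trans (ψ-alive a) (cong sg (sym (wrapD l' 0)))))))
    r≢x2 : at 4 f ≢ x 2
    r≢x2 q = corner {iter ψ 4 f} (alive-iterψ 4 a) (trans q (trans (vtx-ψ (alive-ψ aα))
      (cong (vtx ∘ α) (trans (ψ-alive aα) (cong sg (trans (α-inv f) (sym (wrapD l 0))))))))
    k₀ : at 0 f ≢ x 4
    k₀ q = no35 (x 5) F5 (subst (λ z → Adj z (x 5)) (sym q) (e 4)) e5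
    k₁ : x 2 ≢ x 5
    k₁ q = no35 (x 2) F5 ax2 (subst (λ z → Adj z (at 1 f)) (sym q) e5)
    k₂ : x 3 ≢ at 1 f
    k₂ q = no35 (x 2) F5 ax2 (subst (Adj (x 2)) q (e 2))
    k₃ : x 4 ≢ at 2 f
    k₃ q = no35 (x 5) (rot5 F5) (adj-sym e5) (adj-sym (subst (λ z → Adj z (x 5)) q (e 4)))
    k₄ : x 5 ≢ at 3 f
    k₄ q = no35 (at 3 f) (rot5 F5) (adj-sym (subst (λ z → Adj z (at 1 f)) q e5)) (adj-sym pq)
    k₇ : at 3 f ≢ x 2
    k₇ q = no35 (at 3 f) (rot5 (rot5 (rot5 (rot5 F5)))) (adj-sym qr) (adj-sym (subst (Adj (at 0 f)) (sym q) ax2))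
    k₈ : at 4 f ≢ x 3
    k₈ q = no35 (x 2) (rot5 (rot5 (rot5 (rot5 F5)))) (adj-sym (subst (Adj (x 2)) (sym q) (e 2))) (adj-sym ax2)

  -- Without the three edges at the common vertex the boundaries form a closed walk of length 15 - 6
  -- = 9.
  three-fives : ∀ {g} → Alive g → deg g ≡ 3 → Len 5 g → Len 5 (sg g) → Len 5 (sg (sg g)) → ⊥
  three-fives {g} a d3 l₁ l₂ l₃ = N9 (F₁.bp) (F₁.pq) (subst (Adj (at 3 g)) C₁ F₁.qr)
      (subst (λ z → Adj z (at 2 g₃)) C₃ F₃.bp) F₃.pq (subst (Adj (at 3 g₃)) B₃ F₃.qr)
      (subst (λ z → Adj z (at 2 g₂)) B₂ F₂.bp) F₂.pq (subst (Adj (at 3 g₂)) A₂ F₂.qr)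
      F₁.b≢q (λ z → F₁.p≢r (trans z (sym C₁))) q≢t (λ z → F₃.b≢q (trans C₃ z)) (λ z → F₃.p≢r (trans z (sym B₃))) u≢r
      (λ z → F₂.b≢q (trans B₂ z)) (λ z → F₂.p≢r (trans z (sym A₂))) s≢p
      (λ z → F₁.r≢b (trans C₁ (sym z)))
      (λ z → noC4 F₁.ab F₁.bp (adj-sym (subst₂ Adj C₃ (sym z) F₃.bp)) (adj-sym vC) (F₁.a≢p) (λ y → F₁.r≢b (trans C₁ (sym y))))
      (λ z → noC4 vC (adj-sym (subst (Adj (at 3 g)) C₁ F₁.qr)) (subst₂ Adj (sym z) B₃ F₃.qr) (adj-sym vB) (F₁.q≢a ∘ sym) C≢B)
      C≢B
      (λ z → noC4 vC (subst (λ y → Adj y (at 2 g₃)) C₃ F₃.bp) (adj-sym (subst₂ Adj B₂ (sym z) F₂.bp)) (adj-sym vB) (λ y → F₃.a≢p (trans v₃ y)) C≢B)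
      (λ z → noC4 vB (adj-sym (subst (Adj (at 3 g₃)) B₃ F₃.qr)) (subst₂ Adj (sym z) A₂ F₂.qr) (adj-sym F₁.ab) (λ y → F₃.q≢a (trans (sym y) (sym v₃))) B≢A)
      B≢A
      (λ z → noC4 vB (subst (λ y → Adj y (at 2 g₂)) B₂ F₂.bp) (subst (λ y → Adj y (at 1 g)) (sym z) (adj-sym F₁.bp)) (adj-sym F₁.ab) (λ y → F₂.a≢p (trans v₂ y)) B≢A)
      (λ z → noC4 F₁.ab (adj-sym (subst (Adj (at 3 g₂)) A₂ F₂.qr)) (subst₂ Adj (sym z) C₁ F₁.qr) (adj-sym vC) (λ y → F₂.q≢a (trans (sym y) (sym v₂))) (λ y → F₁.r≢b (trans C₁ (sym y))))
    where
    g₂ = sg g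
    g₃ = sg (sg g)
    a₂ = alive-sg a
    a₃ = alive-sg a₂
    module F₁ = Five (face-five a l₁)
    module F₂ = Five (face-five a₂ l₂)
    module F₃ = Five (face-five a₃ l₃)
    s3 : sg g₃ ≡ g
    s3 = trans (cong (λ t → iter sg t g) (sym d3)) (RS.per-return g)
    v₂ : vtx g₂ ≡ vtx g
    v₂ = vtx-sg g
    v₃ : vtx g₃ ≡ vtx g
    v₃ = trans (vtx-sg g₂) v₂
    last : ∀ {k m} → Alive k → Alive m → Len 5 k → sg m ≡ k → iter ψ 4 k ≡ α m
    last {k} {m} ak am lk q = ψ-inj _ _ (trans (wrapD lk 0) (trans (sym q) (trans (cong sg (sym (α-inv m))) (sym (ψ-alive (alive-α am))))))
    C B : V
    C = vtx (α g₃)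
    B = vtx (α g₂)
    C₁ : at 4 g ≡ C
    C₁ = cong vtx (last a a₃ l₁ s3)
    A₂ : at 4 g₂ ≡ at 1 g
    A₂ = trans (cong vtx (last a₂ a l₂ refl)) (sym (vtx-ψ a))
    B₃ : at 4 g₃ ≡ B
    B₃ = cong vtx (last a₃ a₂ l₃ refl)
    C₃ : at 1 g₃ ≡ C
    C₃ = vtx-ψ a₃
    B₂ : at 1 g₂ ≡ B
    B₂ = vtx-ψ a₂
    vC : Adj (vtx g) C
    vC = subst (λ z → Adj z C) v₃ (edge g₃)
    vB : Adj (vtx g) B
    vB = subst (λ z → Adj z B) v₂ (edge g₂)
    C≢B : C ≢ B
    C≢B z = sg≢ a₂ (same _ _ (trans v₃ (sym v₂)) z)
    B≢A : B ≢ at 1 g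
    B≢A z = F₂.r≢b (trans A₂ (trans (sym z) (sym B₂)))
    -- at the outer end of the edge of m, the faces of k = sg m and of m are consecutive
    turn : ∀ {k m} → Alive k → Alive m → Len 5 k → sg m ≡ k → at 3 k ≢ at 2 m
    turn {k} {m} ak am lk q z = corner {iter ψ 3 k} (alive-iterψ 3 ak) (trans z (trans (vtx-ψ (alive-ψ am))
      (cong (vtx ∘ α) (trans (ψ-alive am) (cong sg (sym (last ak am lk q)))))))
    q≢t : at 3 g ≢ at 2 g₃
    q≢t = turn a a₃ l₁ s3
    u≢r : at 3 g₃ ≢ at 2 g₂
    u≢r = turn a₃ a₂ l₃ refl
    s≢p : at 3 g₂ ≢ at 2 g
    s≢p = turn a₂ a l₂ refl

  -- Recolouring a ring and moving the uncoloured vertex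

  module OnRing {m : ℕ} (R : Ring (suc (suc m))) (off : ∀ i → Ring.Off R (Ring.o R i)) where
    open Ring R
    k : ℕ
    k = suc (suc m)

    mod : ∀ i → p i ≡ p (i % k)
    mod i = trans (cong p (m≡m%n+[m/n]*n i k)) (periodic p p-per (i % k) (i / k))

    onRing : ∀ v → (∃ λ i → i < k × v ≡ p i) ⊎ Off v
    onRing v with F.any? {k} (λ i → v ≟F p (toℕ i))
    ... | yes (i , e) = inj₁ (toℕ i , F.toℕ<n i , e)
    ... | no nr = inj₂ λ i e → nr (fromℕ< (m%n<n i k) , trans e (trans (mod i) (cong p (sym (F.toℕ-fromℕ< (m%n<n i k))))))

    So : ∀ i → S (o i) ≡ true
    So i = subst (λ z → S z ≡ true) (o-per i) (subst (λ z → S (o z) ≡ true) (sym (+-suc i (suc m))) (Cubic.Sc (cub (i + suc m))))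

    coloured-o : ∀ {κ} → Rim κ → ∀ i → κ (o i) ≡ cI ⊎ κ (o i) ≡ cF
    coloured-o {κ} r i = coloured {κ} {o i} (Rim.full r (o i) (So i) (off i))

    clear : (V → Col) → V → Col
    clear κ v with onRing v
    ... | inj₁ _ = none
    ... | inj₂ _ = κ v

    clear-on : ∀ κ i → clear κ (p i) ≡ none
    clear-on κ i with onRing (p i)
    ... | inj₁ _ = refl
    ... | inj₂ ov = ⊥-elim (ov i refl)

    clear-off : ∀ κ v → Off v → clear κ v ≡ κ v
    clear-off κ v ov with onRing v
    ... | inj₁ (i , _ , e) = ⊥-elim (ov i e)
    ... | inj₂ _ = refl

    clear-part : ∀ {κ} → Partial κ → Partial (clear κ)
    clear-part {κ} q = mkPartial (restrict-valid (Partial.valid q) lower) out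
      where
      lower : ∀ x → clear κ x ≡ none ⊎ clear κ x ≡ κ x
      lower x with onRing x
      ... | inj₁ _ = inj₁ refl
      ... | inj₂ _ = inj₂ refl
      out : ∀ x → S x ≡ false → clear κ x ≡ none
      out x e with onRing x
      ... | inj₁ _ = refl
      ... | inj₂ _ = Partial.outside q x e

    hole-rim : ∀ {κ} j → Hole (p j) κ → Rim (clear κ)
    hole-rim {κ} j H = mkRim (clear-part (Hole.part H)) (clear-on κ)
      λ v Sv ov z → Hole.full H v Sv (ov j) (trans (sym (clear-off κ v ov)) z)

    Sp : ∀ i → S (p i) ≡ true
    Sp i = Cubic.Sa (cub i)

    rim : ∃ Rim
    rim with start (p 0) (Sp 0)
    ... | κ , H = clear κ , hole-rim 0 H

    -- colours p 1, …, p (k − 1) as prescribed by cs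
    module Paint (cs : ℕ → Col) (cs0 : cs 0 ≡ none) (csn : ∀ i → cs (suc i) ≢ none) {κ : V → Col} (r : Rim κ)
      (ok : ∀ j κ' → Partial κ' → κ' (p j) ≡ cs j → κ' (p (2 + j)) ≡ none → κ' (o (suc j)) ≡ κ (o (suc j)) → Partial (κ' [ p (suc j) ≔ cs (suc j) ])) where

      record State (j : ℕ) (κ' : V → Col) : Set where
        field
          part : Partial κ'
          done : ∀ i → i ≤ j → κ' (p i) ≡ cs i
          todo : ∀ i → j < i → i < k → κ' (p i) ≡ none
          out : ∀ x → Off x → κ' x ≡ κ x

      run : ∀ j → j < k → ∃ (State j)
      run zero _ = κ , record { part = Rim.part r ; done = λ { .0 z≤n → trans (Rim.unc r 0) (sym cs0) } ; todo = λ i _ _ → Rim.unc r i ; out = λ _ _ → refl }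
      run (suc j) lt with run j (<-trans (n<1+n j) lt)
      ... | κ' , s = κ' [ p (suc j) ≔ cs (suc j) ] , record
            { part = ok j κ' (State.part s) (State.done s j ≤-refl) next (State.out s _ (off (suc j)))
            ; done = dn
            ; todo = λ i ji ik → trans (set-≢ κ' (p (suc j)) _ (λ e → apart' (suc j) i ji ik (sym e))) (State.todo s i (<-trans (n<1+n j) ji) ik)
            ; out = λ x ox → trans (set-≢ κ' (p (suc j)) _ (ox (suc j))) (State.out s x ox) }
        where
        next : κ' (p (2 + j)) ≡ none
        next with suc (suc j) <? k
        ... | yes q = State.todo s (2 + j) (s≤s (n≤1+n j)) q
        ... | no q = trans (cong κ' (trans (cong p (≤-antisym lt (≮⇒≥ q))) (p-per 0))) (trans (State.done s 0 z≤n) cs0)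
        dn : ∀ i → i ≤ suc j → (κ' [ p (suc j) ≔ cs (suc j) ]) (p i) ≡ cs i
        dn i le with m≤n⇒m<n∨m≡n le
        ... | inj₂ refl = set-≡ κ' (p (suc j)) _ refl
        ... | inj₁ lt' = trans (set-≢ κ' (p (suc j)) _ (apart' i (suc j) lt' lt)) (State.done s i (≤-pred lt'))

      painted : ∃ λ κ' → Hole (p 0) κ' × (∀ i → i < k → κ' (p i) ≡ cs i) × (∀ x → Off x → κ' x ≡ κ x)
      painted with run (suc m) ≤-refl
      ... | κ' , s = κ' , mkHole (State.part s) (trans (State.done s 0 z≤n) cs0) f , (λ i lt → State.done s i (≤-pred lt)) , State.out s
        where
        f : ∀ v → S v ≡ true → v ≢ p 0 → κ' v ≢ none
        f v Sv ne z with onRing v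
        ... | inj₂ ov = Rim.full r v Sv ov (trans (sym (State.out s v ov)) z)
        ... | inj₁ (zero , _ , e) = ne e
        ... | inj₁ (suc i , lt , e) = csn i (trans (sym (State.done s (suc i) (≤-pred lt))) (trans (cong κ' (sym e)) z))

    flip : Col → Col
    flip cI = cF
    flip cF = cI
    flip none = none

    -- The alternation starts at `p 1` and leaves `p 0` as the hole, so it never has to close up and
    -- works for odd rings too.
    alt : Col → ℕ → Col
    alt c zero = none
    alt c (suc zero) = c
    alt c (suc (suc i)) = flip (alt c (suc i))

    alt-cases : ∀ c → c ≢ none → ∀ i → alt c (suc i) ≡ cI ⊎ alt c (suc i) ≡ cF
    alt-cases none n zero = ⊥-elim (n refl)
    alt-cases cI n zero = inj₁ refl
    alt-cases cF n zero = inj₂ refl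
    alt-cases c n (suc i) with alt-cases c n i
    ... | inj₁ e = inj₂ (cong flip e)
    ... | inj₂ e = inj₁ (cong flip e)

    alt-none : ∀ c → c ≢ none → ∀ i → alt c (suc i) ≢ none
    alt-none c n i z with alt-cases c n i
    ... | inj₁ e = case trans (sym e) z of λ ()
    ... | inj₂ e = case trans (sym e) z of λ ()

    alt-differ : ∀ i → alt cI (suc i) ≢ alt cF (suc i)
    alt-differ zero ()
    alt-differ (suc i) q = alt-differ i (unflip _ _ q)
      where
      unflip : ∀ a b → flip a ≡ flip b → a ≡ b
      unflip none none _ = refl
      unflip cI cI _ = refl
      unflip cF cF _ = refl

    alt-prev : ∀ c → c ≢ none → ∀ j {x} → x ≡ alt c j → x ≢ alt c (suc j)
    alt-prev c n zero refl z = n (sym z)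
    alt-prev c n (suc j) refl z with alt-cases c n j
    ... | inj₁ e = case trans (sym e) (trans z (cong flip e)) of λ ()
    ... | inj₂ e = case trans (sym e) (trans z (cong flip e)) of λ ()

    alternate : ∀ {κ} (r : Rim κ) → (∀ i → κ (o i) ≡ cF) → ∀ c → c ≢ none →
      ∃ λ κ' → Hole (p 0) κ' × (∀ i → i < k → κ' (p i) ≡ alt c i) × (∀ x → Off x → κ' x ≡ κ x)
    alternate {κ} r allF c n = Paint.painted (alt c) refl (alt-none c n) r ok
      where
      ok : ∀ j κ' → Partial κ' → κ' (p j) ≡ alt c j → κ' (p (2 + j)) ≡ none → κ' (o (suc j)) ≡ κ (o (suc j)) → Partial (κ' [ p (suc j) ≔ alt c (suc j) ])
      ok j κ' P e e₂ eo with alt-cases c n j | alt-prev c n j e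
      ... | inj₁ q | ne rewrite q = I-3 (Cubic.Sv (cub j)) P (Cubic.nb (cub j)) ne (none≢ {κ'} cI (λ ()) e₂) (λ z → I≢F {κ'} z (trans eo (allF _)))
      ... | inj₂ q | ne rewrite q = F-3 (Cubic.Sv (cub j)) P (Cubic.nb (cub j)) ne (none≢ {κ'} cF (λ ()) e₂)

    allF' : ∀ {κ} (r : Rim κ) → (∀ i → κ (o i) ≡ cI) →
      ∃ λ κ' → Hole (p 0) κ' × (∀ i → suc i < k → κ' (p (suc i)) ≡ cF)
    allF' {κ} r allI with Paint.painted cs refl (λ _ ()) r ok
      where
      cs : ℕ → Col
      cs zero = none
      cs (suc i) = cF
      ok : ∀ j κ' → Partial κ' → κ' (p j) ≡ cs j → κ' (p (2 + j)) ≡ none → κ' (o (suc j)) ≡ κ (o (suc j)) → Partial (κ' [ p (suc j) ≔ cF ])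
      ok j κ' P e e₂ eo = F-3 (Cubic.Sv (cub j)) P (rot3 (Cubic.nb (cub j))) (none≢ {κ'} cF (λ ()) e₂) (I≢F {κ'} (trans eo (allI _)))
    ... | κ' , H , d , _ = κ' , H , λ i lt → d (suc i) lt

    -- The path `w` leaves the ring at `p 0` and first returns at another ring vertex `p (suc j)`;
    -- the hole is sent along it. By `atMost1` the last vertex before the return has no further
    -- neighbour on the ring.
    module Walk
      (atMost1 : ∀ x → Off x → ∀ i j → Adj x (p i) → Adj x (p j) → p i ≡ p j)
      (w : ℕ → V) (l : ℕ) (w0 : w 0 ≡ p 0) (inner : ∀ i → i < l → Off (w (suc i)))
      (cw : ∀ i → i ≤ l → ∃₂ λ b c → Cubic (w i) (w (suc i)) b c)
      (l>0 : 0 < l) (j : ℕ) (j<k : suc j < k) (wl : w (suc l) ≡ p (suc j)) where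

      w-off : ∀ i → i ≤ l → ∀ t → suc t < k → p (suc t) ≢ w i
      w-off zero _ t lt e = apart' 0 (suc t) (s≤s z≤n) lt (sym (trans e w0))
      w-off (suc i) le t lt e = inner i le (suc t) (sym e)

      walk : ∀ {κ} → Hole (p 0) κ → ∀ i → i ≤ l → ∃ λ κ' → Hole (w i) κ' × (∀ t → suc t < k → κ' (p (suc t)) ≡ κ (p (suc t)))
      walk H zero _ = _ , subst (λ z → Hole z _) (sym w0) H , λ _ _ → refl
      walk {κ} H (suc i) le with walk H i (≤-trans (n≤1+n i) le)
      ... | κ' , H' , f = shift κ' (w i) (w (suc i)) , move H' (proj₂ (proj₂ (cw i (≤-trans (n≤1+n i) le)))) ,
            λ t lt → trans (shift-other κ' _ _ (p (suc t)) (w-off i (≤-trans (n≤1+n i) le) t lt) (w-off (suc i) le t lt)) (f t lt)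

      record Pair (v : V) (κ κ' : V → Col) : Set where
        field
          left : Hole v κ
          right : Hole v κ'
          agree : ∀ x → Off x → κ x ≡ κ' x
          differ : ∀ t → suc t < k → κ (p (suc t)) ≢ κ' (p (suc t))

      walk₂ : ∀ {κ κ'} → Pair (p 0) κ κ' → ∀ i → i ≤ l → ∃₂ (Pair (w i))
      walk₂ P zero _ = _ , _ , subst (λ z → Pair z _ _) (sym w0) P
      walk₂ P (suc i) le with walk₂ P i (≤-trans (n≤1+n i) le)
      ... | κ , κ' , Q = shift κ (w i) (w (suc i)) , shift κ' (w i) (w (suc i)) , record
            { left = move (Pair.left Q) c ; right = move (Pair.right Q) c
            ; agree = ag
            ; differ = λ t lt z → Pair.differ Q t lt (trans (sym (so κ t lt)) (trans z (so κ' t lt))) }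
        where
        c = proj₂ (proj₂ (cw i (≤-trans (n≤1+n i) le)))
        so : ∀ κ t → suc t < k → shift κ (w i) (w (suc i)) (p (suc t)) ≡ κ (p (suc t))
        so κ t lt = shift-other κ _ _ _ (w-off i (≤-trans (n≤1+n i) le) t lt) (w-off (suc i) le t lt)
        ag : ∀ x → Off x → shift κ (w i) (w (suc i)) x ≡ shift κ' (w i) (w (suc i)) x
        ag x ox with x ≟F w i
        ... | yes _ = Pair.agree Q _ (inner i le)
        ... | no _ with x ≟F w (suc i)
        ...   | yes _ = refl
        ...   | no _ = Pair.agree Q x ox

      open Cubic

      -- the two states see the same colours except at the end vertex p (suc j)
      clash : ∀ {κ κ' v b c} → Off v → Pair v κ κ' → Cubic v (p (suc j)) b c → ⊥
      clash {κ} {κ'} {v} {b} {c} ov P C = go (see (Pair.left P) C) (see (Pair.right P) C)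
        where
        off' : ∀ u → Adj v u → p (suc j) ≢ u → Off u
        off' u vu ne i e = ne (trans (atMost1 v ov (suc j) i (va C) (subst (Adj v) e vu)) (sym e))
        eb = Pair.agree P b (off' b (vb C) (a≢b C))
        ec = Pair.agree P c (off' c (vc C) (a≢c C))
        ne = Pair.differ P j j<k
        go : One κ (p (suc j)) b c → One κ' (p (suc j)) b c → ⊥
        go (one x _ _) (one y _ _) = ne (trans x (sym y))
        go (two x _ _) (two y _ _) = ne (trans x (sym y))
        go (two x _ _) (three y _ _) = ne (trans x (sym y))
        go (three x _ _) (two y _ _) = ne (trans x (sym y))
        go (three x _ _) (three y _ _) = ne (trans x (sym y))
        go (one _ x _) (two _ y _) = I≢F {κ'} y (trans (sym eb) x)
        go (one _ _ x) (three _ _ y) = I≢F {κ'} y (trans (sym ec) x)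
        go (two _ x _) (one _ y _) = I≢F {κ} x (trans eb y)
        go (three _ _ x) (one _ _ y) = I≢F {κ} x (trans ec y)

      last-off : Off (w l)
      last-off = subst (Off ∘ w) l≡ (inner (pred l) (≤-reflexive l≡))
        where
        l≡ : suc (pred l) ≡ l
        l≡ = suc-pred l {{>-nonZero l>0}}

      last-cub : ∃₂ λ b c → Cubic (w l) (p (suc j)) b c
      last-cub with cw l ≤-refl
      ... | b , c , C = b , c , subst (λ z → Cubic (w l) z b c) wl C

      -- With all outer neighbours in `cF` the ring has two opposite alternating colourings. Moving
      -- the hole to `w l` changes both alike off the ring, so there they differ at exactly one
      -- neighbour of the hole, against `see`.
      case-F : ∀ {κ} → Rim κ → (∀ i → κ (o i) ≡ cF) → ⊥
      case-F r allF with alternate r allF cI (λ ()) | alternate r allF cF (λ ())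
      ... | κ₁ , H₁ , d₁ , f₁ | κ₂ , H₂ , d₂ , f₂ with walk₂ (record { left = H₁ ; right = H₂
              ; agree = λ x ox → trans (f₁ x ox) (sym (f₂ x ox))
              ; differ = λ t lt z → alt-differ t (trans (sym (d₁ (suc t) lt)) (trans z (d₂ (suc t) lt))) }) l ≤-refl
      ...   | _ , _ , P = clash last-off P (proj₂ (proj₂ last-cub))

      anyI : ∀ {κ} → Rim κ → (∃ λ i → κ (o i) ≡ cI) ⊎ (∀ i → κ (o i) ≡ cF)
      anyI {κ} r with F.any? {k} (λ i → κ (o (toℕ i)) ≟C cI)
      ... | yes (i , e) = inj₁ (toℕ i , e)
      ... | no nI = inj₂ λ i → case coloured-o r i of λ where
              (inj₂ e) → e
              (inj₁ e) → ⊥-elim (nI (fromℕ< (m%n<n i k) , trans (cong (κ ∘ o) (F.toℕ-fromℕ< (m%n<n i k))) (trans (cong κ (sym (o-mod i))) e)))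
        where
        o-mod : ∀ i → o i ≡ o (i % k)
        o-mod i = trans (cong o (m≡m%n+[m/n]*n i k)) (periodic o o-per (i % k) (i / k))

      some-F : ∀ {κ} → Rim κ → ∀ i → κ (o i) ≡ cF → ⊥
      some-F r i e with anyI r
      ... | inj₂ allF = case-F r allF
      ... | inj₁ (i' , e') = ring-mixed R r off (coloured-o r) i' i e' e

      -- With all outer neighbours in `cI` the ring is put into `cF` except for the hole. When the
      -- hole returns at `p (suc j)`, its outer neighbour `w l` has inherited `cF`; after clearing
      -- the ring some outer neighbour is in `cF`, a case already refuted.
      case-I : ∀ {κ} → Rim κ → (∀ i → κ (o i) ≡ cI) → ⊥
      case-I r allI with allF' r allI
      ... | κ₁ , H₁ , d₁ with walk H₁ l ≤-refl
      ...   | κ₂ , H₂ , d₂ = some-F (hole-rim (suc j) H₃) (suc j)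
              (trans (clear-off κ₃ _ (off (suc j))) (trans (cong κ₃ o≡) (trans (shift-v κ₂ (w l) (p (suc j))) (trans (d₂ j j<k) (d₁ j j<k)))))
        where
        C = proj₂ (proj₂ last-cub)
        κ₃ = shift κ₂ (w l) (p (suc j))
        H₃ : Hole (p (suc j)) κ₃
        H₃ = move H₂ C
        o≡ : o (suc j) ≡ w l
        o≡ with nb (cub j) (w l) (adj-sym (va C)) (Sv C)
        ... | inj₁ e = ⊥-elim (last-off j e)
        ... | inj₂ (inj₁ e) = ⊥-elim (last-off (2 + j) e)
        ... | inj₂ (inj₂ e) = sym e

      contradiction : ⊥
      contradiction with rim
      ... | κ , r with anyI r
      ...   | inj₂ allF = case-F r allF
      ...   | inj₁ _ = case-I r λ t → case coloured-o r t of λ where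
                (inj₁ q) → q
                (inj₂ q) → ⊥-elim (some-F r t q)

  -- Faces with all degrees 3 beside triangles and pentagons

  CubicFace : Fin d → Set
  CubicFace f = ∀ i → deg (iter ψ i f) ≡ 3

  at-+ : ∀ i j f → at (i + j) f ≡ at i (iter ψ j f)
  at-+ i j f = cong vtx (iter-+ ψ i j f)

  outer : Fin d → V
  outer g = vtx (α (sg g))

  sgsg-back : ∀ {p} → Alive p → deg (ψ p) ≡ 3 → sg (sg (ψ p)) ≡ α p
  sgsg-back {p} a e = sg-inj _ _ (trans (trans (cong (λ t → iter sg t (ψ p)) (sym e)) (RS.per-return (ψ p))) (ψ-alive a))

  cubic-ψ : ∀ {e} → Alive e → deg (ψ e) ≡ 3 → Cubic (at 1 e) (at 0 e) (at 2 e) (outer (ψ e))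
  cubic-ψ {e} a d3 = subst₂ (λ x y → Cubic (at 1 e) x y (outer (ψ e))) prev (sym (vtx-ψ (alive-ψ a))) (cub-rot (cub-rot (cubic (ψ e) (alive-ψ a) d3)))
    where
    prev : vtx (α (sg (sg (ψ e)))) ≡ vtx e
    prev = trans (cong (vtx ∘ α) (sgsg-back a d3)) (cong vtx (α-inv e))

  cub-at : ∀ {f} → Alive f → CubicFace f → ∀ i → Cubic (at (suc i) f) (at i f) (at (2 + i) f) (outer (iter ψ (suc i) f))
  cub-at a c3 i = cubic-ψ (alive-iterψ i a) (c3 (suc i))

  toRing : ∀ {f k} → Alive f → CubicFace f → Len k f → (∀ i t → suc t < k → at i f ≢ at (suc t + i) f) → Ring k
  toRing {f} a c3 l ap = record
    { p = λ i → at i f ; o = λ i → outer (iter ψ i f)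
    ; p-per = wrap l ; o-per = λ i → cong outer (wrapD l i)
    ; cub = cub-at a c3 ; apart = ap }

  relative : ∀ {f k} → Len (suc k) f → ∀ i j → ∃ λ t → t < suc k × at j f ≡ at (t + i) f
  relative {f} {k} l i j with RF.iter-below (iter ψ i f) (j + i * suc k ∸ i)
  ... | t , lt , e = t , subst (t <_) (trans (len-iter i f) l) lt , sym (trans (at-+ t i f) (trans (cong vtx e)
      (trans (sym (at-+ (j + i * suc k ∸ i) i f)) (trans (cong (λ s → at s f) (m∸n+n≡m {j + i * suc k} {i} (≤-trans (m≤m*n i (suc k)) (m≤n+m _ j)))) (periodic (λ s → at s f) (wrap l) j i)))))

  -- What `OnRing` and `Walk` require of the short face. For a triangle or pentagon it follows from
  -- the degrees and from the absence of 4-cycles and of triangles on pentagons.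
  record SmallRing (f : Fin d) : Set where
    field
      m : ℕ
      l : Len (suc (suc m)) f
      ap : ∀ i t → suc t < suc (suc m) → at i f ≢ at (suc t + i) f
      alv : Alive f
      c3 : CubicFace f
    R : Ring (suc (suc m))
    R = toRing alv c3 l ap
    field
      off : ∀ i → Ring.Off R (Ring.o R i)
      atMost1 : ∀ x → Ring.Off R x → ∀ i j → Adj x (Ring.p R i) → Adj x (Ring.p R j) → Ring.p R i ≡ Ring.p R j

  outer-prev : ∀ {f} → Alive f → CubicFace f → ∀ i → outer (iter ψ (suc i) f) ≢ at i f
  outer-prev a c3 i = Cubic.a≢c (cub-at a c3 i) ∘ sym

  outer-next : ∀ {f} → Alive f → CubicFace f → ∀ i → outer (iter ψ (suc i) f) ≢ at (2 + i) f
  outer-next a c3 i = Cubic.b≢c (cub-at a c3 i) ∘ sym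

  outer-self : ∀ {f} → Alive f → CubicFace f → ∀ i → outer (iter ψ (suc i) f) ≢ at (suc i) f
  outer-self a c3 i = adj-≢ (Cubic.vc (cub-at a c3 i)) ∘ sym

  triangle-ring : ∀ {f} → Alive f → CubicFace f → Len 3 f → SmallRing f
  triangle-ring {f} a c3 l = record
    { m = 1 ; l = l ; ap = ap ; alv = a ; c3 = c3  ; off = off ; atMost1 = am }
    where
    ap : ∀ i t → suc t < 3 → at i f ≢ at (suc t + i) f
    ap i zero _ = adj-≢ (adj a i)
    ap i (suc zero) _ = nb2 a i
    ap i (suc (suc t)) (s≤s (s≤s (s≤s ())))
    off' : ∀ i j → outer (iter ψ (suc i) f) ≢ at j f
    off' i j e with relative l i j
    ... | zero , _ , q = outer-prev a c3 i (trans e q)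
    ... | suc zero , _ , q = outer-self a c3 i (trans e q)
    ... | suc (suc zero) , _ , q = outer-next a c3 i (trans e q)
    ... | suc (suc (suc t)) , s≤s (s≤s (s≤s ())) , _
    off : ∀ i j → outer (iter ψ i f) ≢ at j f
    off i j e = off' (i + 2) j (trans (cong outer (trans (cong (λ s → iter ψ s f) (sym (+-suc i 2))) (wrapD l i))) e)
    am : ∀ x → (∀ i → x ≢ at i f) → ∀ i j → Adj x (at i f) → Adj x (at j f) → at i f ≡ at j f
    am x ox i j xi xj with relative l i j
    ... | zero , _ , q = sym q
    ... | suc zero , _ , q = ⊥-elim (ox (2 + i) (sym (apex-unique (adj a i) (subst (λ z → Adj z (at (2 + i) f)) w (adj-sym (adj a (2 + i)))) (adj-sym (adj a (suc i))) (adj-sym xi) (subst (Adj x) q xj))))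
      where
      w : at (3 + i) f ≡ at i f
      w = trans (cong (λ s → at s f) (+-comm 3 i)) (wrap l i)
    ... | suc (suc zero) , _ , q = ⊥-elim (ox (1 + i) (sym (apex-unique (subst (Adj (at (2 + i) f)) w (adj a (2 + i))) (adj-sym (adj a (suc i))) (adj-sym (adj a i)) (adj-sym (subst (Adj x) q xj)) xi)))
      where
      w : at (3 + i) f ≡ at i f
      w = trans (cong (λ s → at s f) (+-comm 3 i)) (wrap l i)
    ... | suc (suc (suc t)) , s≤s (s≤s (s≤s ())) , _

  five-at : ∀ {f} → Alive f → Len 5 f → ∀ i → Five (at i f) (at (1 + i) f) (at (2 + i) f) (at (3 + i) f) (at (4 + i) f)
  five-at {f} a l i = face-five (alive-iterψ i a) (trans (len-iter i f) l)

  pentagon-ring : ∀ {f} → Alive f → CubicFace f → Len 5 f → SmallRing f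
  pentagon-ring {f} a c3 l = record
    { m = 3 ; l = l ; ap = ap ; alv = a ; c3 = c3  ; off = off ; atMost1 = am }
    where
    F : ∀ i → Five (at i f) (at (1 + i) f) (at (2 + i) f) (at (3 + i) f) (at (4 + i) f)
    F = five-at a l
    ap : ∀ i t → suc t < 5 → at i f ≢ at (suc t + i) f
    ap i zero _ = adj-≢ (Five.ab (F i))
    ap i (suc zero) _ = Five.a≢p (F i)
    ap i (suc (suc zero)) _ = Five.q≢a (F i) ∘ sym
    ap i (suc (suc (suc zero))) _ = adj-≢ (Five.ra (F i)) ∘ sym
    ap i (suc (suc (suc (suc t)))) (s≤s (s≤s (s≤s (s≤s (s≤s ())))))
    off' : ∀ i j → outer (iter ψ (suc i) f) ≢ at j f
    off' i j e with relative l i j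
    ... | zero , _ , q = outer-prev a c3 i (trans e q)
    ... | suc zero , _ , q = outer-self a c3 i (trans e q)
    ... | suc (suc zero) , _ , q = outer-next a c3 i (trans e q)
    ... | suc (suc (suc zero)) , _ , q = no35 (at (3 + i) f) (rot5 (F i)) (subst (Adj (at (1 + i) f)) (trans e q) (Cubic.vc (cub-at a c3 i))) (adj-sym (Five.pq (F i)))
    ... | suc (suc (suc (suc zero))) , _ , q = no35 (at (4 + i) f) (F i) (adj-sym (Five.ra (F i))) (adj-sym (subst (Adj (at (1 + i) f)) (trans e q) (Cubic.vc (cub-at a c3 i))))
    ... | suc (suc (suc (suc (suc t)))) , s≤s (s≤s (s≤s (s≤s (s≤s ())))) , _
    off : ∀ i j → outer (iter ψ i f) ≢ at j f
    off i j e = off' (i + 4) j (trans (cong outer (trans (cong (λ s → iter ψ s f) (sym (+-suc i 4))) (wrapD l i))) e)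
    am : ∀ x → (∀ i → x ≢ at i f) → ∀ i j → Adj x (at i f) → Adj x (at j f) → at i f ≡ at j f
    am x ox i j xi xj with relative l i j
    ... | zero , _ , q = sym q
    ... | suc zero , _ , q = ⊥-elim (no35 x (F i) (adj-sym xi) (subst (Adj x) q xj))
    ... | suc (suc zero) , _ , q = ⊥-elim (noC4 xi (Five.ab (F i)) (Five.bp (F i)) (adj-sym (subst (Adj x) q xj)) (ox (1 + i)) (Five.a≢p (F i)))
    ... | suc (suc (suc zero)) , _ , q = ⊥-elim (noC4 (subst (Adj x) q xj) (Five.qr (F i)) (Five.ra (F i)) (adj-sym xi) (ox (4 + i)) (Five.q≢a (F i)))
    ... | suc (suc (suc (suc zero))) , _ , q = ⊥-elim (no35 x (rot5 (rot5 (rot5 (rot5 (F i))))) (adj-sym (subst (Adj x) q xj)) xi)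
    ... | suc (suc (suc (suc (suc t)))) , s≤s (s≤s (s≤s (s≤s (s≤s ())))) , _

  -- The boundary of a cubic face next to a small cubic face leads back to the small face.
  no-small-ring : ∀ {h} → Alive h → CubicFace h → SmallRing (α h) →
    ∀ {k} → Len (3 + k) h → (∀ i → suc i < 2 + k → at (2 + i) h ≢ at 1 h) → ⊥
  no-small-ring {h} a c3 sr {k} l fresh = go (Least.holds L)
    where
    module Q = SmallRing sr
    open Ring Q.R using (p; o; Off)
    module O = OnRing Q.R Q.off
    open O using (onRing)
    On : V → Set
    On v = ∃ λ i → i < suc (suc Q.m) × v ≡ p i
    on? : ∀ v → Dec (On v)
    on? v with onRing v
    ... | inj₁ x = yes x
    ... | inj₂ ov = no λ { (i , _ , e) → ov i e }
    p0 : p 0 ≡ at 1 h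
    p0 = at-α0 a
    p1 : p 1 ≡ at 0 h
    p1 = at-α1 a
    L : Least (λ t → On (at (2 + t) h))
    -- At `suc k` the boundary is back at the tail of `h`, which is `p 1`, so a return to the ring
    -- exists.
    L = least (λ t → on? (at (2 + t) h)) (suc k) (1 , s≤s (s≤s z≤n) , trans (wrap l 0) (sym p1))
    o0 : o 0 ≡ at 2 h
    o0 = trans (cong (vtx ∘ α) (sym (ψ-alive a))) (sym (vtx-ψ (alive-ψ a)))
    L≤ : Least.at L ≤ suc k
    L≤ = least-≤ L (suc k) (1 , s≤s (s≤s z≤n) , trans (wrap l 0) (sym p1))
    pos : 0 < Least.at L
    pos with Least.at L | Least.holds L
    ... | zero | (i , _ , e) = ⊥-elim (Q.off 0 i (trans o0 e))
    ... | suc _ | _ = s≤s z≤n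
    go : On (at (2 + Least.at L) h) → ⊥
    -- A return at `p 0` would visit the head of `h` a second time.
    go (zero , _ , e) with m≤n⇒m<n∨m≡n L≤
    ... | inj₁ lt = fresh (Least.at L) (s≤s lt) (trans e p0)
    ... | inj₂ q = adj-≢ (adj a 0) (trans (sym (wrap l 0)) (trans (cong (λ t → at (2 + t) h) (sym q)) (trans e p0)))
    go (suc j , lt , e) = O.Walk.contradiction Q.atMost1 (λ i → at (suc i) h) (Least.at L) (sym p0)
      (λ i i<l → off i i<l)
      (λ i _ → outer (iter ψ (suc i) h) , at i h , cub-rot (cub-at a c3 i))
      pos j lt e
      where
      off : ∀ i → i < Least.at L → Off (at (2 + i) h)
      off i i<l with onRing (at (2 + i) h)
      ... | inj₁ x = ⊥-elim (Least.below L i i<l x)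
      ... | inj₂ ov = ov

  T : Fin d → Set
  T g = len (α g) ≡ 3

  everywhere : ∀ {f k} (P : Fin d → Set) → Len k f → (∀ i → i < k → P (iter ψ i f)) → ∀ i → P (iter ψ i f)
  everywhere {f} P refl h i with RF.iter-below f i
  ... | t , lt , e = subst P e (h t lt)

  deg-vtx : ∀ {g k} → Alive g → Alive k → vtx g ≡ vtx k → deg g ≡ deg k
  deg-vtx {g} {k} ag ak e with sg-transitive g k ag ak e
  ... | t , q = trans (sym (RS.per-iter t g)) (cong deg q)

  module Near {h : Fin d} (a : Alive h) where

    x : ℕ → V
    x i = at i h

    W3 : ℕ → Set
    W3 i = T (iter ψ i h) ⊎ T (iter ψ (1 + i) h) ⊎ T (iter ψ (2 + i) h)

    -- Equality closes a triangle on an edge that already borders one; by `apex-unique` the two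
    -- agree, and then a vertex has degree 2.
    dist3 : ∀ i → W3 i → x i ≢ x (3 + i)
    dist3 i w e with w
    ... | inj₁ t = tip-next (alive-iterψ i a) t (apex-unique (adj a i) (tip-adj₀ (alive-iterψ i a)) (tip-adj₁ (alive-iterψ i a) t)
          (adj-sym (subst (Adj (x (2 + i))) (sym e) (adj a (2 + i)))) (adj-sym (adj a (1 + i))))
    ... | inj₂ (inj₁ t) = tip-next (alive-iterψ (1 + i) a) t (apex-unique (adj a (1 + i)) (tip-adj₀ (alive-iterψ (1 + i) a)) (tip-adj₁ (alive-iterψ (1 + i) a) t)
          (subst (Adj (x (1 + i))) e (adj-sym (adj a i))) (adj-sym (adj a (2 + i))))
    ... | inj₂ (inj₂ t) = tip-prev (alive-iterψ (1 + i) a) t (apex-unique (adj a (2 + i)) (tip-adj₀ (alive-iterψ (2 + i) a)) (tip-adj₁ (alive-iterψ (2 + i) a) t)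
          (adj-sym (adj a (1 + i))) (adj-sym (subst (λ z → Adj z (x (1 + i))) e (adj a i))))

    dist4 : ∀ i → x i ≢ x (4 + i)
    dist4 i e = noC4 (adj a i) (adj a (1 + i)) (adj a (2 + i)) (subst (Adj (x (3 + i))) (sym e) (adj a (3 + i))) (nb2 a i) (nb2 a (1 + i))

    -- Equality closes a pentagon with an edge that borders a triangle.
    dist5 : ∀ i → W3 i → W3 (1 + i) → x i ≢ x (5 + i)
    dist5 i w w' e with x (1 + i) ≟F x (4 + i)
    ... | yes q = dist3 (1 + i) w' q
    ... | no n = go w
      where
      F : Five (x i) (x (1 + i)) (x (2 + i)) (x (3 + i)) (x (4 + i))
      F = five (adj a i) (adj a (1 + i)) (adj a (2 + i)) (adj a (3 + i)) (subst (Adj (x (4 + i))) (sym e) (adj a (4 + i)))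
            (nb2 a i) (nb2 a (1 + i)) (nb2 a (2 + i)) (λ q → nb2 a (3 + i) (trans q e)) (n ∘ sym)
      go : W3 i → ⊥
      go (inj₁ t) = no35 (tip (iter ψ i h)) F (tip-adj₀ (alive-iterψ i a)) (tip-adj₁ (alive-iterψ i a) t)
      go (inj₂ (inj₁ t)) = no35 (tip (iter ψ (1 + i) h)) (rot5 F) (tip-adj₀ (alive-iterψ (1 + i) a)) (tip-adj₁ (alive-iterψ (1 + i) a) t)
      go (inj₂ (inj₂ t)) = no35 (tip (iter ψ (2 + i) h)) (rot5 (rot5 F)) (tip-adj₀ (alive-iterψ (2 + i) a)) (tip-adj₁ (alive-iterψ (2 + i) a) t)

  module Spread {h : Fin d} (a : Alive h) (l : Len 10 h) (w3 : ∀ i → Near.W3 a i) where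
    open Near a

    shift10 : ∀ i j → x i ≡ x (j + i) → x (j + i) ≡ x (10 + i)
    shift10 i j e = trans (sym e) (trans (sym (wrap l i)) (cong x (+-comm i 10)))

    -- The boundary of the 10-face is a cycle: distances above five are measured the other way
    -- round.
    spread : ∀ i t → suc t < 10 → x i ≢ x (suc t + i)
    spread i 0 _ = adj-≢ (adj a i)
    spread i 1 _ = nb2 a i
    spread i 2 _ = dist3 i (w3 i)
    spread i 3 _ = dist4 i
    spread i 4 _ = dist5 i (w3 i) (w3 (1 + i))
    spread i 5 _ e = dist4 (6 + i) (shift10 i 6 e)
    spread i 6 _ e = dist3 (7 + i) (w3 (7 + i)) (shift10 i 7 e)
    spread i 7 _ e = nb2 a (8 + i) (shift10 i 8 e)
    spread i 8 _ e = adj-≢ (adj a (9 + i)) (shift10 i 9 e)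
    spread i (suc (suc (suc (suc (suc (suc (suc (suc (suc t))))))))) (s≤s (s≤s (s≤s (s≤s (s≤s (s≤s (s≤s (s≤s (s≤s (s≤s ()))))))))))

    apart-at : ∀ i j → i < j → j < 10 → x i ≢ x j
    apart-at i j lt jk q = spread i (j ∸ suc i) (subst (_< 10) (sym e) (≤-<-trans (m∸n≤m j i) jk)) (trans q (cong x (sym (trans (cong (_+ i) e) (m∸n+n≡m (<⇒≤ lt))))))
      where
      e : suc (j ∸ suc i) ≡ j ∸ i
      e = sym (+-∸-assoc 1 lt)

  cubic-out : ∀ {g} → Alive g → deg (ψ g) ≡ 3 → T g → Cubic (at 1 g) (at 0 g) (at 2 g) (tip g)
  cubic-out {g} a d3 t = subst (Cubic (at 1 g) (at 0 g) (at 2 g)) (sym e) C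
    where
    C : Cubic (at 1 g) (at 0 g) (at 2 g) (outer (ψ g))
    C = cubic-ψ a d3
    e : tip g ≡ outer (ψ g)
    e with Cubic.nb C (tip g) (adj-sym (tip-adj₁ a t)) (alive-S (alive-iterψ 2 (alive-α a)))
    ... | inj₁ q = ⊥-elim (adj-≢ (tip-adj₀ a) (sym q))
    ... | inj₂ (inj₁ q) = ⊥-elim (tip-next a t q)
    ... | inj₂ (inj₂ q) = q

  cubic-in : ∀ {p} → Alive p → deg (ψ p) ≡ 3 → T (ψ p) → Cubic (at 1 p) (at 0 p) (at 2 p) (tip (ψ p))
  cubic-in {p} a d3 t = subst (Cubic (at 1 p) (at 0 p) (at 2 p)) (sym e) C
    where
    C : Cubic (at 1 p) (at 0 p) (at 2 p) (outer (ψ p))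
    C = cubic-ψ a d3
    e : tip (ψ p) ≡ outer (ψ p)
    e with Cubic.nb C (tip (ψ p)) (tip-adj₀ (alive-ψ a)) (alive-S (alive-iterψ 2 (alive-α (alive-ψ a))))
    ... | inj₁ q = ⊥-elim (tip-prev a t q)
    ... | inj₂ (inj₁ q) = ⊥-elim (adj-≢ (tip-adj₁ (alive-ψ a) t) q)
    ... | inj₂ (inj₂ q) = q

  quartic : ∀ {e} → Alive e → deg (ψ e) ≡ 4 → T e → Nb (at 1 e) λ u → u ≡ at 0 e ⊎ u ≡ at 2 e ⊎ u ≡ tip (ψ e) ⊎ u ≡ tip e
  quartic {e} a d4 t u uv Su with neighbour (ψ e) u (alive-ψ a) uv Su
  ... | 0 , _ , q = inj₂ (inj₁ (trans (sym q) (sym (vtx-ψ (alive-ψ a)))))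
  ... | 1 , _ , q = inj₂ (inj₂ (inj₁ (trans (sym q) (sym (trans (vtx-ψ (alive-ψ (alive-α (alive-ψ a))))
        (cong (vtx ∘ α) (trans (ψ-alive (alive-α (alive-ψ a))) (cong sg (α-inv _)))))))))
  ... | 2 , _ , q = inj₂ (inj₂ (inj₂ (trans (sym q) (trans (cong (vtx ∘ α) s2) (cong vtx (α-inv _))))))
    where
    g = ψ e
    k = iter ψ 2 (α e)
    ak = alive-iterψ 2 (alive-α a)
    s4 : iter sg 4 g ≡ g
    s4 = trans (cong (λ t → iter sg t g) (sym d4)) (RS.per-return g)
    s2 : iter sg 2 g ≡ α k
    s2 = sg-inj _ _ (trans (sg-inj _ _ (trans s4 (ψ-alive a))) (trans (sym (wrapD t 0)) (ψ-alive ak)))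
  ... | 3 , _ , q = inj₁ (trans (sym q) (trans (cong (vtx ∘ α) s3) (cong vtx (α-inv e))))
    where
    g = ψ e
    s3 : iter sg 3 g ≡ α e
    s3 = sg-inj _ _ (trans (trans (cong (λ t → iter sg t g) (sym d4)) (RS.per-return g)) (ψ-alive a))
  ... | suc (suc (suc (suc t'))) , lt , _ = ⊥-elim (<⇒≱ lt (≤-trans (≤-reflexive d4) (m≤m+n 4 t')))

  -- Poor faces and the reducible face beside one

  record Poor (f : Fin d) : Set where
    constructor mkPoor
    field
      l : Len 10 f
      cub : CubicFace f
      alternate : ∀ i → T (iter ψ i f) ⊎ T (iter ψ (1 + i) f)

  module PoorFace {f : Fin d} (a : Alive f) (P : Poor f) where
    open Poor P

    triangle-near : ∀ i → Near.W3 a i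
    triangle-near i with alternate i
    ... | inj₁ t = inj₁ t
    ... | inj₂ t = inj₂ (inj₁ t)

    open Spread a l triangle-near using (spread)

    -- A tip of degree 3 would make all degrees of the triangle 3, which `no-small-ring` forbids
    -- beside a poor face.
    tip-big : ∀ i → T (iter ψ i f) → deg (iter ψ 2 (α (iter ψ i f))) ≢ 3
    tip-big i t d3 = no-small-ring {iter ψ i f} ai (λ j → trans (cong deg (sym (iter-+ ψ j i f))) (cub (j + i))) (triangle-ring (alive-α ai) c3 t) {7} (trans (len-iter i f) l)
        (λ j lt e → spread (suc i) j (≤-trans lt (n≤1+n 9)) (sym (trans (trans (cong (λ s → at s f) (+-suc (suc j) i)) (at-+ (2 + j) i f)) e)))
      where
      ai = alive-iterψ i a
      g = iter ψ i f
      c3 : CubicFace (α g)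
      c3 = everywhere (λ k → deg k ≡ 3) t λ
        { 0 _ → trans (deg-vtx (alive-α ai) (alive-ψ ai) (at-α0 ai)) (cub (suc i))
        ; 1 _ → trans (deg-vtx (alive-ψ (alive-α ai)) ai (at-α1 ai)) (cub i)
        ; 2 _ → d3
        ; (suc (suc (suc _))) (s≤s (s≤s (s≤s ()))) }

    R : Ring 10
    R = toRing a cub l spread

    off-big : ∀ {g} → Alive g → deg g ≢ 3 → ∀ j → vtx g ≢ at j f
    off-big ag n j e = n (trans (deg-vtx ag (alive-iterψ j a) e) (cub j))

    -- Every vertex of a poor face lies on one of its triangles, so the outer neighbours are tips.
    -- Having degree other than 3, they cannot lie on the ring.
    outer-tip : ∀ i → ∃ λ g → Alive g × deg g ≢ 3 × vtx g ≡ outer (iter ψ (suc i) f)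
    outer-tip i with alternate i
    ... | inj₁ t = iter ψ 2 (α (iter ψ i f)) , alive-iterψ 2 (alive-α ai) , tip-big i t , third (cubic-out ai (cub (suc i)) t)
      where
      ai = alive-iterψ i a
      third : Cubic (at (1 + i) f) (at i f) (at (2 + i) f) (tip (iter ψ i f)) → tip (iter ψ i f) ≡ outer (iter ψ (suc i) f)
      third C with Cubic.nb (cub-at a cub i) (tip (iter ψ i f)) (Cubic.vc C) (Cubic.Sc C)
      ... | inj₁ q = ⊥-elim (Cubic.a≢c C (sym q))
      ... | inj₂ (inj₁ q) = ⊥-elim (Cubic.b≢c C (sym q))
      ... | inj₂ (inj₂ q) = q
    ... | inj₂ t = iter ψ 2 (α (iter ψ (suc i) f)) , alive-iterψ 2 (alive-α (alive-ψ ai)) , tip-big (suc i) t , third (cubic-in ai (cub (suc i)) t)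
      where
      ai = alive-iterψ i a
      third : Cubic (at (1 + i) f) (at i f) (at (2 + i) f) (tip (iter ψ (suc i) f)) → tip (iter ψ (suc i) f) ≡ outer (iter ψ (suc i) f)
      third C with Cubic.nb (cub-at a cub i) (tip (iter ψ (suc i) f)) (Cubic.vc C) (Cubic.Sc C)
      ... | inj₁ q = ⊥-elim (Cubic.a≢c C (sym q))
      ... | inj₂ (inj₁ q) = ⊥-elim (Cubic.b≢c C (sym q))
      ... | inj₂ (inj₂ q) = q

    outer-big : ∀ i → ∃ λ g → Alive g × deg g ≢ 3 × vtx g ≡ outer (iter ψ i f)
    outer-big i with outer-tip (i + 9)
    ... | g , ag , n , e = g , ag , n , trans e (cong outer (trans (cong (λ s → iter ψ s f) (sym (+-suc i 9))) (wrapD l i)))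

    off : ∀ i → Ring.Off R (Ring.o R i)
    off i j e with outer-big i
    ... | g , ag , n , q = off-big ag n j (trans q e)

    open OnRing {8} R off

    -- the ring has even length, so if it cannot be coloured then all tips are in I
    all-I : ∀ {κ} → Ring.Rim R κ → ∀ i → κ (Ring.o R i) ≡ cI
    all-I {κ} r i with coloured-o r i
    ... | inj₁ e = e
    ... | inj₂ e with F.any? {10} (λ t → κ (Ring.o R (toℕ t)) ≟C cI)
    ...   | yes (t , e') = ⊥-elim (ring-mixed {8} R r off (coloured-o r) (toℕ t) i e' e)
    ...   | no nI = ⊥-elim (ring-even {4} R r off (everywhere (λ g → κ (outer g) ≡ cF) l λ t lt → case coloured-o r t of λ where
              (inj₂ q) → q
              (inj₁ q) → ⊥-elim (nI (fromℕ< lt , trans (cong (κ ∘ Ring.o R) (F.toℕ-fromℕ< lt)) q))))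

  -- The face Q of h lies beside the poor face of α h: its vertices are v 0, …, v 9, of which
  -- v 2 and v 9 have degree 4.
  module Reduce {h : Fin d} (a : Alive h) (l : Len 10 h) (P : Poor (α h))
    (d0 : deg h ≡ 3) (d1 : deg (iter ψ 1 h) ≡ 3) (d2 : deg (iter ψ 2 h) ≡ 4) (d3 : deg (iter ψ 3 h) ≡ 3)
    (d4 : deg (iter ψ 4 h) ≡ 3) (d5 : deg (iter ψ 5 h) ≡ 3) (d8 : deg (iter ψ 8 h) ≡ 3) (d9 : deg (iter ψ 9 h) ≡ 4)
    (t1 : T (iter ψ 1 h)) (t2 : T (iter ψ 2 h)) (t4 : T (iter ψ 4 h)) (t6 : T (iter ψ 6 h))
    (t8 : T (iter ψ 8 h)) (t9 : T (iter ψ 9 h)) where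

    f : Fin d
    f = α h
    af : Alive f
    af = alive-α a
    open PoorFace af P using (R; off; all-I)
    open Ring R using (p; o; Off; Rim; mkRim)
    open OnRing {8} R off using (onRing; rim; coloured-o)

    v : ℕ → V
    v i = at i h
    q Y q₁ : V
    q = tip (iter ψ 2 h)
    Y = tip (iter ψ 4 h)
    q₁ = tip (iter ψ 8 h)

    w3 : ∀ i → i < 10 → T (iter ψ i h) ⊎ T (iter ψ (1 + i) h) ⊎ T (iter ψ (2 + i) h)
    w3 0 _ = inj₂ (inj₁ t1)
    w3 1 _ = inj₁ t1
    w3 2 _ = inj₁ t2
    w3 3 _ = inj₂ (inj₁ t4)
    w3 4 _ = inj₁ t4
    w3 5 _ = inj₂ (inj₁ t6)
    w3 6 _ = inj₁ t6
    w3 7 _ = inj₂ (inj₁ t8)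
    w3 8 _ = inj₁ t8
    w3 9 _ = inj₁ t9
    w3 (suc (suc (suc (suc (suc (suc (suc (suc (suc (suc i)))))))))) lt = ⊥-elim (<⇒≱ lt (m≤m+n 10 i))

    open Spread a l (everywhere (λ g → T g ⊎ T (ψ g) ⊎ T (ψ (ψ g))) l w3) using (apart-at)

    ne : ∀ i j {i<j : True (i <? j)} {j<10 : True (j <? 10)} → v i ≢ v j
    ne i j {x} {y} = apart-at i j (toWitness x) (toWitness y)

    al : ∀ i → Alive (iter ψ i h)
    al i = alive-iterψ i a

    p0 : p 0 ≡ v 1
    p0 = at-α0 a

    p1 : p 1 ≡ v 0
    p1 = at-α1 a

    o0 : o 0 ≡ v 2
    o0 = trans (cong (vtx ∘ α) (sym (ψ-alive a))) (sym (vtx-ψ (alive-ψ a)))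

    o1 : o 1 ≡ v 9
    o1 = trans (cong (vtx ∘ α) (trans (cong sg (trans (ψ-alive af) (cong sg (α-inv h)))) s2)) (cong vtx (α-inv _))
      where
      s2 : sg (sg h) ≡ α (iter ψ 9 h)
      s2 = sg-inj _ _ (trans (trans (cong (λ t → iter sg t h) (sym d0)) (RS.per-return h)) (trans (sym (wrapD l 0)) (ψ-alive (al 9))))

    c1 : Cubic (v 1) (v 0) (v 2) (tip (ψ h))
    c1 = cubic-in a d1 t1
    c0 : Cubic (v 10) (v 9) (v 11) (tip (iter ψ 9 h))
    c0 = cubic-out (al 9) (trans (cong deg (wrapD l 0)) d0) t9
    c3 : Cubic (v 3) (v 2) (v 4) q
    c3 = cubic-out (al 2) d3 t2
    c4 : Cubic (v 4) (v 3) (v 5) Y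
    c4 = cubic-in (al 3) d4 t4
    c5 : Cubic (v 5) (v 4) (v 6) Y
    c5 = cubic-out (al 4) d5 t4
    c8 : Cubic (v 8) (v 7) (v 9) q₁
    c8 = cubic-in (al 7) d8 t8

    tip1 : tip (ψ h) ≡ at 9 f
    tip1 = go (Cubic.nb c1 (at 9 f) (subst (λ z → Adj z (at 9 f)) (trans (wrap (Poor.l P) 0) p0) (adj-sym (adj af 9))) (alive-S (alive-iterψ 9 af)))
      where
      go : at 9 f ≡ v 0 ⊎ at 9 f ≡ v 2 ⊎ at 9 f ≡ tip (ψ h) → tip (ψ h) ≡ at 9 f
      go (inj₁ e) = ⊥-elim (nb2 af 9 (trans e (trans (sym p1) (sym (wrap (Poor.l P) 1)))))
      go (inj₂ (inj₁ e)) = ⊥-elim (off 0 9 (trans o0 (sym e)))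
      go (inj₂ (inj₂ e)) = sym e

    tip9 : tip (iter ψ 9 h) ≡ at 2 f
    tip9 = go (Cubic.nb c0 (at 2 f) (subst (λ z → Adj z (at 2 f)) (trans p1 (sym (wrap l 0))) (adj af 1)) (alive-S (alive-iterψ 2 af)))
      where
      go : at 2 f ≡ v 9 ⊎ at 2 f ≡ v 11 ⊎ at 2 f ≡ tip (iter ψ 9 h) → tip (iter ψ 9 h) ≡ at 2 f
      go (inj₁ e) = ⊥-elim (off 1 2 (trans o1 (sym e)))
      go (inj₂ (inj₁ e)) = ⊥-elim (nb2 af 0 (trans p0 (trans (sym (wrap l 1)) (sym e))))
      go (inj₂ (inj₂ e)) = sym e

    nb-2 : Nb (v 2) λ u → u ≡ v 1 ⊎ u ≡ v 3 ⊎ u ≡ q ⊎ u ≡ tip (ψ h)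
    nb-2 = quartic (al 1) d2 t1

    nb-9 : Nb (v 9) λ u → u ≡ v 8 ⊎ u ≡ v 10 ⊎ u ≡ tip (iter ψ 9 h) ⊎ u ≡ q₁
    nb-9 = quartic (al 8) d9 t8

    S-v : ∀ i → S (v i) ≡ true
    S-v i = alive-S (al i)

    -- A `Rim` in progress: the vertices satisfying `ex` are excused from being coloured.
    record Work (ex : V → Set) (κ : V → Col) : Set where
      constructor mkWork
      field
        part : Partial κ
        unc : ∀ i → κ (p i) ≡ none
        full : ∀ x → S x ≡ true → Off x → ¬ ex x → κ x ≢ none

    clearW : ∀ {ex κ} x → Work ex κ → Work (λ u → ex u ⊎ u ≡ x) (κ [ x ≔ none ])
    clearW {ex} {κ} x (mkWork P u f) = mkWork (part-none x P) unc' λ y Sy oy ny z → f y Sy oy (ny ∘ inj₁) (trans (sym (set-≢ κ x none (ny ∘ inj₂))) z)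
      where
      unc' : ∀ i → (κ [ x ≔ none ]) (p i) ≡ none
      unc' i with p i ≟F x
      ... | yes _ = refl
      ... | no _ = u i

    setW : ∀ {ex κ} x c → c ≢ none → Off x → Partial (κ [ x ≔ c ]) → Work ex κ → Work (λ u → ex u × u ≢ x) (κ [ x ≔ c ])
    setW {ex} {κ} x c cn ox Q (mkWork P u f) = mkWork Q (λ i → trans (set-≢ κ x c (λ e → ox i (sym e))) (u i)) full'
      where
      full' : ∀ y → S y ≡ true → Off y → ¬ (ex y × y ≢ x) → (κ [ x ≔ c ]) y ≢ none
      full' y Sy oy ny z with y ≟F x
      ... | yes _ = cn z
      ... | no n = f y Sy oy (λ e → ny (e , n)) z

    -- gives x the colour I unless x lies on the ring
    force-I : ∀ {ex κ} x {b c e} → Cubic x b c e → κ b ≢ cI → κ c ≢ cI → κ e ≢ cI → Work ex κ →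
      ∃ λ κ' → Work ex κ' × κ' x ≢ cF × (∀ u → u ≢ x → κ' u ≡ κ u)
    force-I {ex} {κ} x C nb' nc ne' w with onRing x
    ... | inj₁ (i , _ , e) = κ , w , (λ z → case trans (sym z) (trans (cong κ e) (Work.unc w i)) of λ ()) , λ _ _ → refl
    ... | inj₂ ox = κ [ x ≔ cI ] , weaken (setW x cI (λ ()) ox (I-3 (Cubic.Sv C) (Work.part w) (Cubic.nb C) nb' nc ne') w) ,
            (λ z → case trans (sym (set-≡ κ x cI refl)) z of λ ()) , λ u n → set-≢ κ x cI n
      where
      weaken : Work (λ u → ex u × u ≢ x) (κ [ x ≔ cI ]) → Work ex (κ [ x ≔ cI ])
      weaken (mkWork P u f) = mkWork P u λ y Sy oy ny → f y Sy oy (ny ∘ proj₁)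

    to-rim : ∀ {ex κ} → (∀ x → ¬ ex x) → Work ex κ → Rim κ
    to-rim n (mkWork P u f) = mkRim P u λ x Sx ox → f x Sx ox (n x)

    not-I : ∀ {κ u w} → Partial κ → Adj u w → κ u ≡ cI → κ w ≢ cI
    not-I P uw e z = Valid.ind (Partial.valid P) _ _ uw e z

    off-2 : Off (v 2)
    off-2 i e = off 0 i (trans o0 e)

    off-9 : Off (v 9)
    off-9 i e = off 1 i (trans o1 e)

    module Go {κ : V → Col} (r : Rim κ) where
      open Ring.Rim r using (part; unc; full)

      y2 : κ (v 2) ≡ cI
      y2 = trans (cong κ (sym o0)) (all-I r 0)

      y9 : κ (v 9) ≡ cI
      y9 = trans (cong κ (sym o1)) (all-I r 1)

      w₀ : Work (λ _ → ⊥) κ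
      w₀ = mkWork part unc λ x Sx ox _ → full x Sx ox

      mixed : ∀ {κ'} → Rim κ' → (κ' (v 2) ≡ cF ⊎ κ' (v 9) ≡ cF) → ⊥
      mixed {κ'} r' (inj₁ e) = I≢F {κ'} (trans (cong κ' (sym o0)) (all-I r' 0)) e
      mixed {κ'} r' (inj₂ e) = I≢F {κ'} (trans (cong κ' (sym o1)) (all-I r' 1)) e

      at-ring : ∀ {ex κ'} → Work ex κ' → ∀ {u i} → u ≡ p i → κ' u ≢ cF
      at-ring w {i = i} e z = case trans (sym z) (trans (cong _ e) (Work.unc w i)) of λ ()

      Forced : (V → Set) → (V → Col) → V → Set
      Forced ex κ' x = ∃ λ κ'' → Work ex κ'' × κ'' x ≢ cF × (∀ u → u ≢ x → κ'' u ≡ κ' u)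

      -- Besides `v 8` and `q₁` the neighbours of `v 9` lie on the uncoloured ring, so `v 9` can
      -- take `cF`. It is an outer neighbour of the poor ring, which contradicts `all-I`.
      v9-F : ∀ {κ'} → Work (λ u → ⊥ ⊎ u ≡ v 9) κ' → κ' (v 8) ≢ cF → ⊥
      v9-F {κ'} w n8 = mixed (to-rim (λ { x (inj₂ e , n') → n' e }) (setW (v 9) cF (λ ()) off-9 P₂ w)) (inj₂ (set-≡ κ' (v 9) cF refl))
        where
        only : ∀ u → u ≡ v 8 ⊎ u ≡ v 10 ⊎ u ≡ tip (iter ψ 9 h) ⊎ u ≡ q₁ → κ' u ≡ cF → u ≡ q₁
        only u (inj₁ e) z = ⊥-elim (n8 (trans (cong κ' (sym e)) z))
        only u (inj₂ (inj₁ e)) z = ⊥-elim (at-ring w {i = 1} (trans e (trans (wrap l 0) (sym p1))) z)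
        only u (inj₂ (inj₂ (inj₁ e))) z = ⊥-elim (at-ring w {i = 2} (trans e tip9) z)
        only u (inj₂ (inj₂ (inj₂ e))) _ = e
        P₂ : Partial (κ' [ v 9 ≔ cF ])
        P₂ = put-F (v 9) q₁ (S-v 9) (Work.part w) λ u uv Su → only u (nb-9 u uv Su)

      -- Otherwise, with `v 9` uncoloured, `v 8` could take `cI` and then `v 9` could take `cF`.
      v7-I : κ (v 7) ≡ cI
      v7-I = decide (κ (v 7) ≟C cI)
        where
        q₁-I : κ q₁ ≢ cI
        q₁-I = not-I part (adj-sym (tip-adj₁ (al 8) t8)) y9
        κ' = κ [ v 9 ≔ none ]
        lift : ∀ {u} → κ u ≢ cI → κ' u ≢ cI
        lift {u} n z with u ≟F v 9
        ... | no _ = n z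
        decide : Dec (κ (v 7) ≡ cI) → κ (v 7) ≡ cI
        decide (yes e) = e
        decide (no n) = ⊥-elim (fin (force-I (v 8) c8 (lift n) (none≢ {κ'} cI (λ ()) (set-≡ κ (v 9) none refl)) (lift q₁-I) (clearW (v 9) w₀)))
          where
          fin : Forced (λ u → ⊥ ⊎ u ≡ v 9) κ' (v 8) → ⊥
          fin (_ , w₁ , n8 , _) = v9-F w₁ n8

      v6-I : κ (v 6) ≢ cI
      v6-I = not-I part (adj-sym (adj a 6)) v7-I

      q-I : κ q ≢ cI
      q-I = not-I part (tip-adj₀ (al 2)) y2

      v2-F : ∀ {κ'} → Work (λ u → u ≡ v 2) κ' → κ' (v 3) ≢ cF → ⊥
      v2-F {κ'} w n3 = mixed (to-rim (λ { x (e , n) → n e }) (setW (v 2) cF (λ ()) off-2 P₂ w)) (inj₁ (set-≡ κ' (v 2) cF refl))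
        where
        only : ∀ u → u ≡ v 1 ⊎ u ≡ v 3 ⊎ u ≡ q ⊎ u ≡ tip (ψ h) → κ' u ≡ cF → u ≡ q
        only u (inj₁ e) z = ⊥-elim (at-ring w {i = 0} (trans e (sym p0)) z)
        only u (inj₂ (inj₁ e)) z = ⊥-elim (n3 (trans (cong κ' (sym e)) z))
        only u (inj₂ (inj₂ (inj₁ e))) _ = e
        only u (inj₂ (inj₂ (inj₂ e))) z = ⊥-elim (at-ring w {i = 9} (trans e tip1) z)
        P₂ : Partial (κ' [ v 2 ≔ cF ])
        P₂ = put-F (v 2) q (S-v 2) (Work.part w) λ u uv Su → only u (nb-2 u uv Su)

      -- Otherwise, with `v 2` uncoloured, `v 3` could take `cI` and then `v 2` could take `cF`.
      v4-I : κ (v 4) ≡ cI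
      v4-I = decide (κ (v 4) ≟C cI)
        where
        κ' = κ [ v 2 ≔ none ]
        lift : ∀ {u} → κ u ≢ cI → κ' u ≢ cI
        lift {u} n z with u ≟F v 2
        ... | no _ = n z
        decide : Dec (κ (v 4) ≡ cI) → κ (v 4) ≡ cI
        decide (yes e) = e
        decide (no n) = ⊥-elim (fin (force-I (v 3) c3 (none≢ {κ'} cI (λ ()) (set-≡ κ (v 2) none refl)) (lift n) (lift q-I) (clearW (v 2) w₀)))
          where
          fin : Forced (λ u → ⊥ ⊎ u ≡ v 2) κ' (v 3) → ⊥
          fin (_ , w₁ , n3 , _) = v2-F (mkWork (Work.part w₁) (Work.unc w₁) λ x Sx ox n' → Work.full w₁ x Sx ox λ { (inj₂ e) → n' e }) n3

      Y-I : κ Y ≢ cI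
      Y-I = not-I part (tip-adj₀ (al 4)) v4-I

      -- Needed so that recolouring `v 5` does not change what `v 3` sees at `q`. Equality would put
      -- a second triangle on the edge from `v 4` to `v 5`.
      q≢v5 : q ≢ v 5
      q≢v5 e = tip-prev (al 3) t4 (apex-unique (adj a 4) (tip-adj₀ (al 4)) (tip-adj₁ (al 4) t4)
        (adj-sym (adj a 3)) (adj-sym (subst (λ z → Adj z (v 3)) e (tip-adj₁ (al 2) t2))))

      κ₁ : V → Col
      κ₁ = (κ [ v 2 ≔ none ]) [ v 4 ≔ none ]

      below : ∀ {u} → κ u ≢ cI → κ₁ u ≢ cI
      below {u} n z with u ≟F v 4
      ... | yes _ = case z of λ ()
      ... | no _ with u ≟F v 2
      ...   | yes _ = case z of λ ()
      ...   | no _ = n z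

      off-4 : Off (v 4)
      off-4 i e = case trans (sym v4-I) (trans (cong κ e) (unc i)) of λ ()

      -- v 3 and v 5 go to I, then v 4 and v 2 to F
      absurd : ⊥
      absurd = fin (force-I (v 5) c5 (none≢ {κ₁} {v 4} cI (λ ()) v4-none) (below v6-I) (below Y-I) (clearW (v 4) (clearW (v 2) w₀)))
        where
        v4-none : κ₁ (v 4) ≡ none
        v4-none = set-≡ (κ [ v 2 ≔ none ]) (v 4) none refl
        v2-none : κ₁ (v 2) ≡ none
        v2-none = trans (set-≢ (κ [ v 2 ≔ none ]) (v 4) none (ne 2 4)) (set-≡ κ (v 2) none refl)
        Ex : V → Set
        Ex u = (⊥ ⊎ u ≡ v 2) ⊎ u ≡ v 4
        fin₂ : ∀ {κ₂} → κ₂ (v 5) ≢ cF → Forced Ex κ₂ (v 3) → ⊥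
        fin₂ {κ₂} n5 (κ₃ , w₃ , n3 , s₃) = v2-F (mkWork (Work.part w₄) (Work.unc w₄) λ x Sx ox n' → Work.full w₄ x Sx ox λ { (inj₁ (inj₂ e) , _) → n' e ; (inj₂ e , n) → n e })
            (λ z → n3 (trans (sym (set-≢ κ₃ (v 4) cF (ne 3 4))) z))
          where
          w₄ : Work (λ u → Ex u × u ≢ v 4) (κ₃ [ v 4 ≔ cF ])
          w₄ = setW (v 4) cF (λ ()) off-4 (F-3 (S-v 4) (Work.part w₃) (Cubic.nb c4) n3 (λ z → n5 (trans (sym (s₃ (v 5) (ne 3 5 ∘ sym))) z))) w₃
        fin : Forced Ex κ₁ (v 5) → ⊥
        fin (κ₂ , w₂ , n5 , s₂) = fin₂ n5 (force-I (v 3) c3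
              (none≢ {κ₂} {v 2} cI (λ ()) (trans (s₂ (v 2) (ne 2 5)) v2-none))
              (none≢ {κ₂} {v 4} cI (λ ()) (trans (s₂ (v 4) (ne 4 5)) v4-none))
              (λ z → below q-I (trans (sym (s₂ q q≢v5)) z)) w₂)

    contradiction : ⊥
    contradiction = Go.absurd (proj₂ rim)

  -- Discharging

  isLen : ℕ → Fin d → Bool
  isLen k h = ⌊ len h ≟ k ⌋

  small : Fin d → Bool
  small h = isLen 5 h ∨ isLen 8 h

  big : Fin d → Bool
  big h = not ⌊ deg h ≟ 3 ⌋

  -- The dart `h` stands for the corner at its tail in the face of `h`; `RS.inv h` and `sg h` stand
  -- for the previous and next corner at the same vertex.
  gain : Fin d → ℕ
  gain h = if big h
    then gives ⌊ deg h ≟ 4 ⌋ (isLen 3 h) (isLen 3 (RS.inv h)) (isLen 3 (sg h)) (isLen 3 (sg (sg h))) (small (RS.inv h)) (small (sg h)) (small h)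
    else 0

  gain≤18 : ∀ h → gain h ≤ 18
  gain≤18 h with big h | isLen 3 h
  ... | false | _ = z≤n
  ... | true | true = z≤n
  ... | true | false = give≤18 ⌊ deg h ≟ 4 ⌋ (isLen 3 (RS.inv h)) (isLen 3 (sg h)) (isLen 3 (sg (sg h))) (small (RS.inv h)) (small (sg h)) (small h)

  len-α : ∀ {h} → Alive h → len (α h) ≡ len (sg h)
  len-α {h} a = trans (sym (RF.per-shift (α h))) (cong len (trans (ψ-alive (alive-α a)) (cong sg (α-inv h))))

  no-tri-tri : ∀ {h} → Alive h → not (isLen 3 h ∧ isLen 3 (sg h)) ≡ true
  no-tri-tri {h} a = not-∧ λ p q → Tri.len≢3 a (trans (len-α a) (⌊⌋-true {d = len (sg h) ≟ 3} q)) (⌊⌋-true {d = len h ≟ 3} p)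

  gain-at : ∀ {k} p n₁ n₂ q → deg k ≢ 3 → ⌊ deg k ≟ 4 ⌋ ≡ q → RS.inv k ≡ p → sg k ≡ n₁ → sg n₁ ≡ n₂ →
    gain k ≡ gives q (isLen 3 k) (isLen 3 p) (isLen 3 n₁) (isLen 3 n₂) (small p) (small n₁) (small k)
  gain-at {k} _ _ _ _ n refl refl refl refl with deg k ≟ 3
  ... | yes e = ⊥-elim (n e)
  ... | no _ = refl

  ⌊⌋-no : ∀ {A : Set} {D : Dec A} → ¬ A → ⌊ D ⌋ ≡ false
  ⌊⌋-no {D = yes a} n = ⊥-elim (n a)
  ⌊⌋-no {D = no _} n = refl

  big-false : ∀ {h} → deg h ≡ 3 → big h ≡ false
  big-false {h} e = cong not (true-⌊⌋ {d = deg h ≟ 3} e)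

  gain-3 : ∀ {h} → deg h ≡ 3 → gain h ≡ 0
  gain-3 {h} e rewrite big-false {h} e = refl

  module AtVertex {h : Fin d} (a : Alive h) where
    x : ℕ → Fin d
    x i = iter sg i h
    t : ℕ → Bool
    t i = isLen 3 (x i)
    s : ℕ → Bool
    s i = small (x i)
    deg-x : ∀ i → deg (x i) ≡ deg h
    deg-x i = RS.per-iter i h
    apart : ∀ i → not (t i ∧ t (suc i)) ≡ true
    apart i = no-tri-tri (alive-itersg i a)
    back : ∀ {k} → deg h ≡ k → x k ≡ h
    back refl = RS.per-return h

    deg-3 : deg h ≡ 3 → 72 + RS.orbitSum gain h ≤ 24 * 3
    deg-3 e = ≤-reflexive (cong (72 +_) (trans (sumN-cong (deg h) {g = λ _ → 0} λ i → gain-3 (trans (deg-x i) e)) (trans (sumN-const (deg h) 0) (*-zeroʳ (deg h)))))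

    deg-4 : deg h ≡ 4 → 72 + RS.orbitSum gain h ≤ 24 * 4
    deg-4 e = +-monoʳ-≤ 72 (≤-trans (≤-reflexive (trans (cong (λ k → sumN k (λ i → gain (x i))) e) eq))
        (give-four (t 0) (t 1) (t 2) (t 3) (s 0) (s 1) (s 2) (s 3) (apart 0) (apart 1) (apart 2)
          (subst (λ k → not (t 3 ∧ isLen 3 k) ≡ true) (back e) (apart 3))))
      where
      g : ∀ i p n₂ → RS.inv (x i) ≡ p → sg (x (suc i)) ≡ n₂ →
        gain (x i) ≡ gives true (t i) (isLen 3 p) (t (suc i)) (isLen 3 n₂) (small p) (s (suc i)) (s i)
      g i p n₂ ip q = gain-at p (x (suc i)) n₂ true (λ z → case trans (sym z) (trans (deg-x i) e) of λ ()) (true-⌊⌋ {d = deg (x i) ≟ 4} (trans (deg-x i) e)) ip refl q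
      inv0 : RS.inv h ≡ x 3
      inv0 = trans (cong RS.inv (sym (back e))) (RS.inv-π (x 3))
      eq : gain (x 0) + (gain (x 1) + (gain (x 2) + (gain (x 3) + 0))) ≡ _
      eq = cong₂ _+_ (g 0 (x 3) (x 2) inv0 refl) (cong₂ _+_ (g 1 (x 0) (x 3) (RS.inv-π (x 0)) refl)
        (cong₂ _+_ (g 2 (x 1) (x 0) (RS.inv-π (x 1)) (back e)) (cong₂ _+_ g3 refl)))
        where
        g3 : gain (x 3) ≡ gives true (t 3) (t 2) (t 0) (t 1) (s 2) (s 0) (s 3)
        g3 = gain-at (x 2) (x 0) (x 1) true (λ z → case trans (sym z) (trans (deg-x 3) e) of λ ()) (true-⌊⌋ {d = deg (x 3) ≟ 4} (trans (deg-x 3) e)) (RS.inv-π (x 2)) (back e) refl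

    deg-5 : deg h ≡ 5 → 72 + RS.orbitSum gain h ≤ 24 * 5
    deg-5 e = +-monoʳ-≤ 72 (≤-trans (≤-reflexive (trans (cong (λ k → sumN k (λ i → gain (x i))) e) eq))
        (give-five (t 0) (t 1) (t 2) (t 3) (t 4) (apart 0) (apart 1) (apart 2) (apart 3)
          (subst (λ k → not (t 4 ∧ isLen 3 k) ≡ true) (back e) (apart 4))))
      where
      g : ∀ i p n₁ → RS.inv (x i) ≡ p → sg (x i) ≡ n₁ → gain (x i) ≡ give′ (t i) (isLen 3 p) (isLen 3 n₁)
      g i p n₁ ip in' = trans (gain-at p n₁ (sg n₁) false (λ z → case trans (sym z) (trans (deg-x i) e) of λ ())
          (⌊⌋-no {D = deg (x i) ≟ 4} (λ z → case trans (sym z) (trans (deg-x i) e) of λ ())) ip in' refl)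
        (gives′ (t i) (isLen 3 p) (isLen 3 n₁) _ _ _ _)
      inv0 : RS.inv h ≡ x 4
      inv0 = trans (cong RS.inv (sym (back e))) (RS.inv-π (x 4))
      eq : gain (x 0) + (gain (x 1) + (gain (x 2) + (gain (x 3) + (gain (x 4) + 0)))) ≡ _
      eq = cong₂ _+_ (g 0 (x 4) (x 1) inv0 refl) (cong₂ _+_ (g 1 (x 0) (x 2) (RS.inv-π (x 0)) refl)
        (cong₂ _+_ (g 2 (x 1) (x 3) (RS.inv-π (x 1)) refl) (cong₂ _+_ (g 3 (x 2) (x 4) (RS.inv-π (x 2)) refl)
          (cong₂ _+_ (g 4 (x 3) (x 0) (RS.inv-π (x 3)) (back e)) refl))))

    deg-6+ : 6 ≤ deg h → 72 + RS.orbitSum gain h ≤ 24 * deg h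
    deg-6+ le = begin
      72 + RS.orbitSum gain h ≤⟨ +-mono-≤ (*-monoʳ-≤ 12 le) (+-cancelʳ-≤ (12 * τ) _ _ main) ⟩
      12 * deg h + 12 * deg h ≡⟨ dbl (deg h) ⟩
      24 * deg h ∎
      where
      open ≤-Reasoning
      b : Fin d → ℕ
      b k = bit (isLen 3 k)
      τ : ℕ
      τ = RS.orbitSum b h
      dbl : ∀ m → 12 * m + 12 * m ≡ 24 * m
      dbl = solve-∀
      pt : ∀ k → gain k + 12 * b k ≤ 12 + 6 * b (sg k)
      pt k with big k
      ... | true = give-many ⌊ deg k ≟ 4 ⌋ (isLen 3 k) (isLen 3 (RS.inv k)) (isLen 3 (sg k)) (isLen 3 (sg (sg k))) (small (RS.inv k)) (small (sg k)) (small k)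
      ... | false with isLen 3 k
      ...   | true = m≤m+n 12 _
      ...   | false = z≤n
      main : RS.orbitSum gain h + 12 * τ ≤ 12 * deg h + 12 * τ
      main = begin
        RS.orbitSum gain h + 12 * τ ≡⟨ cong (RS.orbitSum gain h +_) (sumN-*ˡ (deg h) 12 (λ i → b (x i))) ⟨
        RS.orbitSum gain h + RS.orbitSum (λ k → 12 * b k) h ≡⟨ sumN-+ (deg h) (λ i → gain (x i)) (λ i → 12 * b (x i)) ⟨
        RS.orbitSum (λ k → gain k + 12 * b k) h ≤⟨ sumN-mono (deg h) (λ i → pt (x i)) ⟩
        RS.orbitSum (λ k → 12 + 6 * b (sg k)) h ≡⟨ sumN-+ (deg h) (λ _ → 12) (λ i → 6 * b (sg (x i))) ⟩
        sumN (deg h) (λ _ → 12) + RS.orbitSum (λ k → 6 * b (sg k)) h ≡⟨ cong₂ _+_ (trans (sumN-const (deg h) 12) (*-comm (deg h) 12)) (trans (sumN-*ˡ (deg h) 6 (λ i → b (sg (x i)))) (cong (6 *_) (RS.orbitSum-π b h))) ⟩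
        12 * deg h + 6 * τ ≤⟨ +-monoʳ-≤ (12 * deg h) (*-monoˡ-≤ τ {6} {12} (m≤m+n 6 6)) ⟩
        12 * deg h + 12 * τ ∎

    bound : ∀ k → deg h ≡ k → 3 ≤ k → 72 + RS.orbitSum gain h ≤ 24 * k
    bound 3 e _ = deg-3 e
    bound 4 e _ = deg-4 e
    bound 5 e _ = deg-5 e
    bound (suc (suc (suc (suc (suc (suc k)))))) e _ = subst (λ z → 72 + RS.orbitSum gain h ≤ 24 * z) e (deg-6+ (≤-trans (m≤m+n 6 k) (≤-reflexive (sym e))))
    bound 1 _ (s≤s ())
    bound 2 _ (s≤s (s≤s ()))

  vertex-bound : ∀ {h} → Alive h → 72 ≤ RS.orbitSum (λ k → 24 ∸ gain k) h
  vertex-bound {h} a = +-cancelʳ-≤ (RS.orbitSum gain h) _ _ (≤-trans (AtVertex.bound a (deg h) refl (deg≥3 h a)) (≤-reflexive (sym (trans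
      (sym (sumN-+ (deg h) (λ i → 24 ∸ gain (iter sg i h)) (λ i → gain (iter sg i h))))
      (trans (sumN-cong (deg h) (λ i → m∸n+n≡m (≤-trans (gain≤18 (iter sg i h)) (m≤m+n 18 6)))) (trans (sumN-const (deg h) 24) (*-comm (deg h) 24)))))))

  -- Summing all charges against Euler's inequality

  module Count (nonempty : ∃ λ v → S v ≡ true) where
    open RawMap vtx α σ using (isolated)

    module _ (c : Fin d → ℕ) (c≤12 : ∀ h → c h ≤ 12)
      (face-bound : ∀ {h} → Alive h → 72 ≤ RF.orbitSum (λ x → gain x + (c x + (12 ∸ c (α x)))) h) where

      private
        on : (Fin d → ℕ) → Fin d → ℕ
        on w x = if alive x then w x else 0

        on-alive : ∀ w {x} → Alive x → on w x ≡ w x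
        on-alive w a rewrite a = refl

        face : Fin d → ℕ
        face x = gain x + (c x + (12 ∸ c (α x)))

        vert : Fin d → ℕ
        vert x = 24 ∸ gain x

        -- a marked dart for each non-isolated vertex outside S
        mark : Fin d → Bool
        mark x = firstB _≟F_ vtx x ∧ not (S (vtx x))

        -- The stubs around a vertex outside `S` form a face of their own in `lam`; the marked dart
        -- supplies its 72 units.
        face⁺ : Fin d → ℕ
        face⁺ x = if alive x then face x else 72 * bit (mark x)

        euler-S = Euler.euler-subset G alive alive-closed S (λ h a → alive-S a) nonempty
        lam = proj₁ euler-S
        lam-φ = proj₁ (proj₂ euler-S)

        A N M Fc s : ℕ
        A = countB alive
        N = countB mark
        M = countB (not ∘ S)
        Fc = classes _≟_ lam
        s = countB S

        weigh : ∀ {h} (w : Fin d → ℕ) (W : Fin d → ℕ) → (∀ x → Alive x → w x ≡ W x) → Alive h → ∀ {B : Set} (_≟'_ : (x y : B) → Dec (x ≡ y)) (l : Fin d → B) →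
          (∀ x → l (ψ x) ≡ l x) → RF.orbitSum w h ≤ sum (λ x → if ⌊ l x ≟' l h ⌋ then W x else 0)
        weigh {h} w W e a _≟'_ l inv = ≤-trans (≤-reflexive (sumN-cong (len h) (λ i → e _ (alive-iterψ i a)))) (RF.orbitSum-class _≟'_ l inv W h)

        first-of : ∀ r → ∃ λ k → vtx k ≡ vtx r × firstB _≟F_ vtx k ≡ true
        first-of r = k , proj₂ (proj₂ (Least.holds L)) , first-complete _≟F_ vtx k λ u u<k e →
            Least.below L (toℕ u) (subst (toℕ u <_) (proj₁ (proj₂ (Least.holds L))) u<k) (u , refl , trans e (proj₂ (proj₂ (Least.holds L))))
          where
          P : ℕ → Set
          P m = ∃ λ k → toℕ k ≡ m × vtx k ≡ vtx r
          L : Least P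
          L = least (λ m → F.any? λ k → (toℕ k ≟ m) ×-dec (vtx k ≟F vtx r)) (toℕ r) (r , refl , refl)
          k : Fin d
          k = proj₁ (Least.holds L)

        indicator : ∀ {B : Set} (_≟'_ : (x y : B) → Dec (x ≡ y)) (l : Fin d → B) {r k} (W : Fin d → ℕ) → l k ≡ l r →
          W k ≤ sum (λ x → if ⌊ l x ≟' l r ⌋ then W x else 0)
        indicator _≟'_ l {r} {k} W e = ≤-trans (≤-reflexive (sym same')) (sum-≥ (λ x → if ⌊ l x ≟' l r ⌋ then W x else 0) k)
          where
          same' : (if ⌊ l k ≟' l r ⌋ then W k else 0) ≡ W k
          same' with l k ≟' l r
          ... | yes _ = refl
          ... | no n = ⊥-elim (n e)

        face-alive : ∀ {r h} → Alive h → lam h ≡ lam r → 72 ≤ sum (λ x → if ⌊ lam x ≟ lam r ⌋ then face⁺ x else 0)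
        face-alive {r} {h} a e = subst (λ z → 72 ≤ sum (λ x → if ⌊ lam x ≟ z ⌋ then face⁺ x else 0)) e
          (≤-trans (face-bound a) (weigh face face⁺ (λ x ax → sym (cong (λ b → if b then face x else 72 * bit (mark x)) ax)) a _≟_ lam (ψ-inv lam lam-φ)))

        -- the stubs after r, up to the first alive dart, belong to the face of r
        stubs : ∀ r t → (∀ i → i < t → alive (iter σ i r) ≡ false) → lam (iter σ t r) ≡ lam r
        stubs r zero _ = refl
        stubs r (suc t) dead = trans (trans (cong (λ b → lam (σ (if b then α y else y))) (sym (dead t ≤-refl))) (lam-φ y)) (stubs r t λ i lt → dead i (<-trans lt (n<1+n t)))
          where
          y : Fin d
          y = iter σ t r

        -- Turning around the vertex of `r` stays in its class. If an alive dart is met, its face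
        -- has weight 72; if not, the vertex lies outside `S` and its marked dart is in the class.
        per-face : ∀ r → 72 ≤ sum (λ x → if ⌊ lam x ≟ lam r ⌋ then face⁺ x else 0)
        per-face r = go (F.any? {suc d} λ t → alive (iter σ (toℕ t) r) ≟B true)
          where
          go : Dec (∃ λ (t : Fin (suc d)) → alive (iter σ (toℕ t) r) ≡ true) → 72 ≤ sum (λ x → if ⌊ lam x ≟ lam r ⌋ then face⁺ x else 0)
          go (yes (t , e)) = face-alive (Least.holds L) (stubs r (Least.at L) λ i lt → ¬true (Least.below L i lt))
            where
            L : Least (λ t → alive (iter σ t r) ≡ true)
            L = least (λ t → alive (iter σ t r) ≟B true) (toℕ t) e
          go (no none') = ≤-trans (≤-reflexive (sym seventy-two)) (indicator _≟_ lam face⁺ lamk)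
            where
            k : Fin d
            k = proj₁ (first-of r)
            k-vtx : vtx k ≡ vtx r
            k-vtx = proj₁ (proj₂ (first-of r))
            module Pσ = Perm σ σ-inj
            below : ∀ x → vtx x ≡ vtx r → ∃ λ t → t < suc d × iter σ t r ≡ x
            below x e = let t , q = reachP-sound σ r x (σ-trans r x (sym e)) ; t' , lt , q' = Pσ.iter-below r t in
              t' , ≤-trans lt (≤-trans (Pσ.per≤d r) (n≤1+n d)) , trans q' q
            dead : ∀ x → vtx x ≡ vtx r → alive x ≢ true
            dead x e ax = let t , lt , q = below x e in none' (fromℕ< lt , trans (cong (λ i → alive (iter σ i r)) (F.toℕ-fromℕ< lt)) (trans (cong alive q) ax))
            lamk : lam k ≡ lam r
            lamk = let t , lt , q = below k k-vtx in
              trans (cong lam (sym q)) (stubs r t λ i i<t → ¬true (dead (iter σ i r) (iter-inv σ vtx σ-vtx i r)))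
            outside : S (vtx r) ≡ false
            outside = ¬true λ Sr → let h , ah , e = alive-at (vtx r) Sr in dead h e ah
            seventy-two : face⁺ k ≡ 72
            seventy-two rewrite ¬true (dead k k-vtx) | proj₂ (proj₂ (first-of r)) | k-vtx | outside = refl

        faces≤ : 72 * Fc ≤ sum face⁺
        faces≤ = classes-sum _≟_ lam 72 face⁺ per-face

        per-vertex : ∀ v → 72 * bit (S v) ≤ sum (λ x → if ⌊ vtx x ≟F v ⌋ then on vert x else 0)
        per-vertex v with S v in e
        ... | false = z≤n
        ... | true with alive-at v e
        ...   | h , a , refl = ≤-trans (vertex-bound a) (≤-trans (≤-reflexive (sumN-cong (deg h) (λ i → sym (on-alive vert (alive-itersg i a)))))
                (RS.orbitSum-class _≟F_ vtx vtx-sg (on vert) h))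

        only-one : ∀ (W : Fin d → ℕ) x → sum (λ v → if ⌊ vtx x ≟F v ⌋ then W x else 0) ≤ W x
        only-one W x = sum-single _ (W x) le λ i j p q → trans (sym (get i p)) (get j q)
          where
          le : ∀ v → (if ⌊ vtx x ≟F v ⌋ then W x else 0) ≤ W x
          le v with vtx x ≟F v
          ... | yes _ = ≤-refl
          ... | no _ = z≤n
          get : ∀ v → (if ⌊ vtx x ≟F v ⌋ then W x else 0) ≢ 0 → vtx x ≡ v
          get v n with vtx x ≟F v
          ... | yes e = e
          ... | no _ = ⊥-elim (n refl)

        verts≤ : 72 * s ≤ sum (on vert)
        verts≤ = begin
          72 * s ≡⟨ cong (72 *_) (countB-sum S) ⟩
          72 * sum (bit ∘ S) ≡⟨ sum-*ˡ 72 (bit ∘ S) ⟨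
          sum (λ v → 72 * bit (S v)) ≤⟨ sum-mono _ _ per-vertex ⟩
          sum (λ v → sum (λ x → if ⌊ vtx x ≟F v ⌋ then on vert x else 0)) ≡⟨ ∑-comm (λ v x → if ⌊ vtx x ≟F v ⌋ then on vert x else 0) ⟩
          sum (λ x → sum (λ v → if ⌊ vtx x ≟F v ⌋ then on vert x else 0)) ≤⟨ sum-mono _ _ (only-one (on vert)) ⟩
          sum (on vert) ∎
          where open ≤-Reasoning

        iso : V → Bool
        iso v = not (anyFin (λ h → ⌊ vtx h ≟F v ⌋))

        per-outside : ∀ v → bit (iso v) + sum (λ x → if ⌊ vtx x ≟F v ⌋ then bit (mark x) else 0) ≤ bit (not (S v))
        per-outside v = go (S v ≟B true)
          where
          Σv : ℕ
          Σv = sum (λ x → if ⌊ vtx x ≟F v ⌋ then bit (mark x) else 0)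
          get : ∀ x → (if ⌊ vtx x ≟F v ⌋ then bit (mark x) else 0) ≢ 0 → vtx x ≡ v × mark x ≡ true
          get x n with vtx x ≟F v | mark x
          ... | yes e | true = e , refl
          ... | yes _ | false = ⊥-elim (n refl)
          ... | no _ | _ = ⊥-elim (n refl)
          zero' : ∀ x → ((vtx x ≡ v × mark x ≡ true) → ⊥) → (if ⌊ vtx x ≟F v ⌋ then bit (mark x) else 0) ≡ 0
          zero' x n with vtx x ≟F v | mark x
          ... | yes e | true = ⊥-elim (n (e , refl))
          ... | yes _ | false = refl
          ... | no _ | _ = refl
          none-sum : (∀ x → (vtx x ≡ v × mark x ≡ true) → ⊥) → Σv ≡ 0
          none-sum h = trans (sum-cong-≗ λ x → zero' x (h x)) (sum-replicate-zero d)
          go : Dec (S v ≡ true) → bit (iso v) + Σv ≤ bit (not (S v))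
          go (yes Sv) = ≤-trans (≤-reflexive (cong₂ _+_ i0 (none-sum λ { x (refl , m) → true≢false (trans (sym (proj₂ (∧-true {firstB _≟F_ vtx x} m))) (cong not Sv)) }))) z≤n
            where
            i0 : bit (iso v) ≡ 0
            i0 = let h , ah , e = alive-at v Sv in
              cong (bit ∘ not) (anyFin-complete (λ h → ⌊ vtx h ≟F v ⌋) h (true-⌊⌋ {d = vtx h ≟F v} e))
          go (no nS) rewrite ¬true nS with iso v in e
          ... | true = ≤-reflexive (cong suc (none-sum λ x p → true≢false (trans (sym e)
                  (cong not (anyFin-complete (λ h → ⌊ vtx h ≟F v ⌋) x (true-⌊⌋ {d = vtx x ≟F v} (proj₁ p)))))))
          ... | false = sum-single _ 1 le λ i j p q → first-unique _≟F_ vtx i j (fst i p) (fst j q) (trans (proj₁ (get i p)) (sym (proj₁ (get j q))))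
            where
            fst : ∀ i → (if ⌊ vtx i ≟F v ⌋ then bit (mark i) else 0) ≢ 0 → firstB _≟F_ vtx i ≡ true
            fst i p = proj₁ (∧-true (proj₂ (get i p)))
            le : ∀ x → (if ⌊ vtx x ≟F v ⌋ then bit (mark x) else 0) ≤ 1
            le x with vtx x ≟F v | mark x
            ... | yes _ | true = ≤-refl
            ... | yes _ | false = z≤n
            ... | no _ | _ = z≤n

        -- A vertex outside `S` is counted at most once on the left, as isolated or by its mark; a
        -- vertex of `S` has an alive dart and no mark.
        marks≤ : isolated + N ≤ M
        marks≤ = begin
          isolated + N ≡⟨ cong₂ _+_ (countB-sum iso) (countB-sum mark) ⟩
          sum (bit ∘ iso) + sum (bit ∘ mark) ≤⟨ +-monoʳ-≤ (sum (bit ∘ iso)) (sum-mono _ _ self) ⟩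
          sum (bit ∘ iso) + sum (λ x → sum (λ v → if ⌊ vtx x ≟F v ⌋ then bit (mark x) else 0)) ≡⟨ cong (sum (bit ∘ iso) +_) (∑-comm (λ x v → if ⌊ vtx x ≟F v ⌋ then bit (mark x) else 0)) ⟩
          sum (bit ∘ iso) + sum (λ v → sum (λ x → if ⌊ vtx x ≟F v ⌋ then bit (mark x) else 0)) ≡⟨ ∑-distrib-+ (bit ∘ iso) _ ⟨
          sum (λ v → bit (iso v) + sum (λ x → if ⌊ vtx x ≟F v ⌋ then bit (mark x) else 0)) ≤⟨ sum-mono _ _ per-outside ⟩
          sum (bit ∘ not ∘ S) ≡⟨ countB-sum (not ∘ S) ⟨
          M ∎
          where
          open ≤-Reasoning
          self : ∀ x → bit (mark x) ≤ sum (λ v → if ⌊ vtx x ≟F v ⌋ then bit (mark x) else 0)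
          self x = ≤-trans (≤-reflexive (sym same')) (sum-≥ (λ v → if ⌊ vtx x ≟F v ⌋ then bit (mark x) else 0) (vtx x))
            where
            same' : (if ⌊ vtx x ≟F vtx x ⌋ then bit (mark x) else 0) ≡ bit (mark x)
            same' with vtx x ≟F vtx x
            ... | yes _ = refl
            ... | no n = ⊥-elim (n refl)

        split-V : s + M ≡ n
        split-V = trans (cong₂ _+_ (countB-sum S) (countB-sum (not ∘ S))) (trans (sym (∑-distrib-+ (bit ∘ S) (bit ∘ not ∘ S)))
          (trans (sum-cong-≗ λ v → bits (S v)) (trans (sum-const n 1) (*-identityʳ n))))
          where
          bits : ∀ b → bit b + bit (not b) ≡ 1
          bits true = refl
          bits false = refl

        -- payments across edges cancel
        total : sum (on vert) + sum face⁺ ≡ 36 * A + 72 * N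
        total = begin
          sum (on vert) + sum face⁺ ≡⟨ ∑-distrib-+ (on vert) face⁺ ⟨
          sum (λ x → on vert x + face⁺ x) ≡⟨ sum-cong-≗ pt ⟩
          sum (λ x → (24 * bit (alive x) + 72 * bit (mark x)) + (on c x + on (λ x → 12 ∸ c (α x)) x)) ≡⟨ ∑-distrib-+ (λ x → 24 * bit (alive x) + 72 * bit (mark x)) _ ⟩
          sum (λ x → 24 * bit (alive x) + 72 * bit (mark x)) + sum (λ x → on c x + on (λ x → 12 ∸ c (α x)) x)
            ≡⟨ cong₂ _+_ (trans (∑-distrib-+ (λ x → 24 * bit (alive x)) _) (cong₂ _+_ (times 24 alive) (times 72 mark))) pay ⟩
          24 * A + 72 * N + 12 * A ≡⟨ ar A N ⟩
          36 * A + 72 * N ∎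
          where
          open ≡-Reasoning
          ar : ∀ a b → 24 * a + 72 * b + 12 * a ≡ 36 * a + 72 * b
          ar = solve-∀
          times : ∀ k (p : Fin d → Bool) → sum (λ x → k * bit (p x)) ≡ k * countB p
          times k p = trans (sum-*ˡ k (bit ∘ p)) (cong (k *_) (sym (countB-sum p)))
          alive-unmarked : ∀ x → Alive x → mark x ≡ false
          alive-unmarked x a = ¬true λ m → true≢false (trans (sym (proj₂ (∧-true {firstB _≟F_ vtx x} m))) (cong not (alive-S a)))
          pt : ∀ x → on vert x + face⁺ x ≡ (24 * bit (alive x) + 72 * bit (mark x)) + (on c x + on (λ x → 12 ∸ c (α x)) x)
          pt x = go (alive x ≟B true)
            where
            go : Dec (Alive x) → on vert x + face⁺ x ≡ (24 * bit (alive x) + 72 * bit (mark x)) + (on c x + on (λ x → 12 ∸ c (α x)) x)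
            go (yes a) rewrite alive-unmarked x a | a = trans (sym (+-assoc (vert x) (gain x) _)) (cong (_+ (c x + (12 ∸ c (α x)))) (m∸n+n≡m (≤-trans (gain≤18 x) (m≤m+n 18 6))))
            go (no na) rewrite ¬true na = sym (+-identityʳ _)
          αp = permutation α α α-inv α-inv
          pay : sum (λ x → on c x + on (λ x → 12 ∸ c (α x)) x) ≡ 12 * A
          pay = begin
            sum (λ x → on c x + on (λ x → 12 ∸ c (α x)) x) ≡⟨ ∑-distrib-+ (on c) _ ⟩
            sum (on c) + sum (on (λ x → 12 ∸ c (α x))) ≡⟨ cong (_+ sum (on (λ x → 12 ∸ c (α x)))) (sum-permute (on c) αp) ⟩
            sum (λ x → on c (α x)) + sum (on (λ x → 12 ∸ c (α x))) ≡⟨ ∑-distrib-+ (λ x → on c (α x)) _ ⟨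
            sum (λ x → on c (α x) + on (λ x → 12 ∸ c (α x)) x) ≡⟨ sum-cong-≗ q ⟩
            sum (λ x → 12 * bit (alive x)) ≡⟨ times 12 alive ⟩
            12 * A ∎
            where
            q : ∀ x → on c (α x) + on (λ x → 12 ∸ c (α x)) x ≡ 12 * bit (alive x)
            q x rewrite alive-closed x with alive x
            ... | true = m+[n∸m]≡n (c≤12 (α x))
            ... | false = refl

      -- Euler's inequality times 36, added to the bounds for faces and vertices: everything cancels
      -- except 144 = 36 · 4, the contribution of `S` as a vertex class.
      too-few : ⊥
      too-few = <⇒≱ (m≤n+m 144 0) (≤-trans (+-cancelʳ-≤ R 144 0 final) z≤n)
        where
        open ≤-Reasoning
        R : ℕ
        R = 144 * M + 72 * s + 36 * A
        final : 144 + R ≤ 0 + R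
        final = +-cancelʳ-≤ (72 * Fc) _ _ (begin
          144 + (144 * M + 72 * s + 36 * A) + 72 * Fc ≡⟨ e₁ M s A Fc ⟩
          36 * (4 * suc M + A) + (72 * s + 72 * Fc) ≤⟨ +-mono-≤ (*-monoʳ-≤ 36 (proj₂ (proj₂ euler-S))) (≤-trans (+-mono-≤ verts≤ faces≤) (≤-reflexive total)) ⟩
          36 * (2 * n + 2 * Fc + 2 * isolated) + (36 * A + 72 * N) ≡⟨ e₂ n Fc isolated A N ⟩
          72 * n + 72 * (isolated + N) + 36 * A + 72 * Fc ≤⟨ +-monoˡ-≤ (72 * Fc) (+-monoˡ-≤ (36 * A) (+-mono-≤ (≤-reflexive (cong (72 *_) (sym split-V))) (*-monoʳ-≤ 72 marks≤))) ⟩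
          72 * (s + M) + 72 * M + 36 * A + 72 * Fc ≡⟨ e₃ s M A Fc ⟩
          144 * M + 72 * s + 36 * A + 72 * Fc ∎)
          where
          e₁ : ∀ M s A Fc → 144 + (144 * M + 72 * s + 36 * A) + 72 * Fc ≡ 36 * (4 * suc M + A) + (72 * s + 72 * Fc)
          e₁ = solve-∀
          e₂ : ∀ n Fc i A N → 36 * (2 * n + 2 * Fc + 2 * i) + (36 * A + 72 * N) ≡ 72 * n + 72 * (i + N) + 36 * A + 72 * Fc
          e₂ = solve-∀
          e₃ : ∀ s M A Fc → 72 * (s + M) + 72 * M + 36 * A + 72 * Fc ≡ 144 * M + 72 * s + 36 * A + 72 * Fc
          e₃ = solve-∀

  -- Edge types and payments across edges

  Poor? : ∀ f → Dec (Poor f)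
  Poor? f = map′ to from ((len f ≟ 10) ×-dec (F.all? {10} (λ i → deg (iter ψ (toℕ i) f) ≟ 3) ×-dec
      F.all? {10} (λ i → (len (α (iter ψ (toℕ i) f)) ≟ 3) ⊎-dec (len (α (ψ (iter ψ (toℕ i) f))) ≟ 3))))
    where
    Fin10 : (P : Fin d → Set) → (∀ (i : Fin 10) → P (iter ψ (toℕ i) f)) → ∀ i → i < 10 → P (iter ψ i f)
    Fin10 P h i lt = subst (λ z → P (iter ψ z f)) (F.toℕ-fromℕ< lt) (h (fromℕ< lt))
    Parts : Set
    Parts = Len 10 f × (∀ (i : Fin 10) → deg (iter ψ (toℕ i) f) ≡ 3) × (∀ (i : Fin 10) → T (iter ψ (toℕ i) f) ⊎ T (ψ (iter ψ (toℕ i) f)))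
    to : Parts → Poor f
    to (l , c3 , al) = mkPoor l (everywhere (λ g → deg g ≡ 3) l (Fin10 (λ g → deg g ≡ 3) c3)) (everywhere (λ g → T g ⊎ T (ψ g)) l (Fin10 (λ g → T g ⊎ T (ψ g)) al))
    from : Poor f → Parts
    from (mkPoor l c3 al) = l , (λ i → c3 (toℕ i)) , λ i → al (toℕ i)

  dem : Fin d → ℕ
  dem f = demand (big f) (big (iter ψ 1 f)) (big (iter ψ 2 f)) (big (iter ψ 3 f)) (big (iter ψ 4 f)) (isLen 5 (α (iter ψ 4 f))) (isLen 5 (α (ψ f)))

  cost≤12 : ∀ e → cost e ≤ 12
  cost≤12 eT = z≤n
  cost≤12 eA = m≤m+n 8 4
  cost≤12 eB = m≤m+n 9 3
  cost≤12 eZ = ≤-refl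
  cost≤12 eN = ≤-refl
  cost≤12 eL = m≤m+n 9 3

  isLen-yes : ∀ {k h} → Len k h → isLen k h ≡ true
  isLen-yes {k} {h} l = true-⌊⌋ {d = len h ≟ k} l

  isLen-no : ∀ {k h} → ¬ Len k h → isLen k h ≡ false
  isLen-no {k} {h} n = ⌊⌋-no {D = len h ≟ k} n

  data Kind (x : Fin d) : Edge → Set where
    isTri : T x → Kind x eT
    isFive : ∀ {e} → Len 5 (α x) → type₅ (dem (α x)) ≡ e → Kind x e
    isEight : Len 8 (α x) → Kind x eZ
    isPoor : Poor (α x) → Kind x eL
    isRest : ¬ T x → ¬ Len 5 (α x) → ¬ Len 8 (α x) → Kind x eN

  opaque
    typ : Fin d → Edge
    typ x = if isLen 3 (α x) then eT else if isLen 5 (α x) then type₅ (dem (α x)) else if isLen 8 (α x) then eZ else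
      if ⌊ Poor? (α x) ⌋ then eL else eN

    -- The share of 12 that the face of `x` keeps of the edge `x`; faces of length below 8 pay
    -- nothing.
    c : Fin d → ℕ
    c x = if ⌊ 8 ≤? len x ⌋ then cost (typ x) else 12

    c≤12 : ∀ x → c x ≤ 12
    c≤12 x with ⌊ 8 ≤? len x ⌋
    ... | true = cost≤12 (typ x)
    ... | false = ≤-refl

    c-long : ∀ {x} → 8 ≤ len x → c x ≡ cost (typ x)
    c-long {x} h rewrite true-⌊⌋ {d = 8 ≤? len x} h = refl

    c-short : ∀ {x} → len x < 8 → c x ≡ 12
    c-short {x} h rewrite ⌊⌋-no {D = 8 ≤? len x} (<⇒≱ h) = refl

    typ-T : ∀ {x} → T x → typ x ≡ eT
    typ-T {x} t rewrite isLen-yes {3} {α x} t = refl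

    typ-5 : ∀ {x} → Len 5 (α x) → typ x ≡ type₅ (dem (α x))
    typ-5 {x} l rewrite isLen-no {3} {α x} (λ z → case trans (sym l) z of λ ()) | isLen-yes {5} {α x} l = refl

    typ-L : ∀ {x} → Poor (α x) → typ x ≡ eL
    typ-L {x} p rewrite isLen-no {3} {α x} (λ z → case trans (sym (Poor.l p)) z of λ ()) | isLen-no {5} {α x} (λ z → case trans (sym (Poor.l p)) z of λ ())
      | isLen-no {8} {α x} (λ z → case trans (sym (Poor.l p)) z of λ ()) | true-⌊⌋ {d = Poor? (α x)} p = refl

    kind : ∀ x → Kind x (typ x)
    kind x = go (len (α x) ≟ 3) (len (α x) ≟ 5) (len (α x) ≟ 8) (Poor? (α x))
      where
      go : (a : Dec (T x)) (b : Dec (Len 5 (α x))) (e : Dec (Len 8 (α x))) (p : Dec (Poor (α x))) →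
        Kind x (if ⌊ a ⌋ then eT else if ⌊ b ⌋ then type₅ (dem (α x)) else if ⌊ e ⌋ then eZ else if ⌊ p ⌋ then eL else eN)
      go (yes t) _ _ _ = isTri t
      go (no _) (yes l) _ _ = isFive l refl
      go (no _) (no _) (yes l) _ = isEight l
      go (no _) (no _) (no _) (yes p) = isPoor p
      go (no a) (no b) (no e) (no p) = isRest a b e

  kind' : ∀ {x e} → typ x ≡ e → Kind x e
  kind' refl = kind _

  opaque
    W : Fin d → ℕ
    W x = gain x + (c x + (12 ∸ c (α x)))

    W-def : ∀ x → W x ≡ gain x + (c x + (12 ∸ c (α x)))
    W-def x = refl

  -- Drops what is received across the edge; only triangles, pentagons and poor faces depend on it.
  W≥ : ∀ x → gain x + c x ≤ W x
  W≥ x = ≤-trans (+-monoʳ-≤ (gain x) (m≤m+n (c x) _)) (≤-reflexive (sym (W-def x)))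

  unfold : ∀ {h k} (w : Fin d → ℕ) → Len k h → RF.orbitSum w h ≡ sumN k (λ i → w (iter ψ i h))
  unfold w refl = refl

  -- Faces of length below 10

  tri-far : ∀ {h} → Alive h → Len 3 h → 10 ≤ len (α h)
  tri-far {h} a l = Tri.len≥10 (alive-α a) (trans (cong len (α-inv h)) l)

  -- Each edge keeps its own 12 and receives 12 from the face beyond, which has length at least 10.
  len-3 : ∀ {h} → Alive h → Len 3 h → 72 ≤ RF.orbitSum W h
  len-3 {h} a l = ≤-trans (≤-trans (≤-reflexive (sym (sumN-const 3 24))) (sumN-mono 3 (λ i → each (alive-iterψ i a) (trans (len-iter i h) l)))) (≤-reflexive (sym (unfold W l)))
    where
    each : ∀ {x} → Alive x → Len 3 x → 24 ≤ W x
    each {x} ax lx rewrite W-def x | c-short {x} (subst (_< 8) (sym lx) (s≤s (s≤s (s≤s (s≤s z≤n)))))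
      | c-long {α x} (≤-trans (m≤m+n 8 2) (tri-far ax lx)) | typ-T {α x} (trans (cong len (α-inv x)) lx) = m≤n+m 24 (gain x)

  next-corner : ∀ {x} → Alive x → len (sg x) ≡ len (α x)
  next-corner a = sym (len-α a)

  inv-alive : ∀ {x} → Alive x → Alive (RS.inv x)
  inv-alive {x} a = alive-itersg (pred (deg x)) a

  prev-corner : ∀ {x} → Alive x → len (α (RS.inv x)) ≡ len x
  prev-corner {x} a = trans (len-α (inv-alive a)) (cong len (RS.π-inv x))

  near-small : ∀ {x} → Alive x → len x < 10 → ¬ Len 3 (RS.inv x) × ¬ Len 3 (sg x)
  near-small {x} a lt = (λ z → <⇒≱ lt (subst (10 ≤_) (prev-corner a) (tri-far (inv-alive a) z))) ,
    λ z → <⇒≱ lt (Tri.len≥10 a (trans (len-α a) z))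

  small-≢3 : ∀ {x} → small x ≡ true → ¬ Len 3 x
  small-≢3 {x} s z with len x ≟ 5 | len x ≟ 8
  ... | yes e | _ = case trans (sym e) z of λ ()
  ... | no _ | yes e = case trans (sym e) z of λ ()
  small-≢3 {x} () z | no _ | no _

  gain-small : ∀ {x} → Alive x → small x ≡ true → len x < 10 → gain x ≡ six (big x)
  gain-small {x} a s lt with big x
  ... | false = refl
  ... | true rewrite isLen-no {3} {x} (small-≢3 s) | isLen-no {3} {RS.inv x} (proj₁ (near-small a lt)) | isLen-no {3} {sg x} (proj₂ (near-small a lt)) | s
    with ⌊ deg x ≟ 4 ⌋ ∧ isLen 3 (sg (sg x))
  ...   | true = refl
  ...   | false = refl

  five-across : ∀ {x} → Alive x → Len 5 x → ¬ Len 5 (α x) → 8 ≤ len (α x)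
  five-across {x} a l n5 with len (α x) in e | RF.per>0 (α x)
  ... | 1 | _ = ⊥-elim (len≢1 (alive-α a) e)
  ... | 2 | _ = ⊥-elim (len≢2 (alive-α a) e)
  ... | 3 | _ = ⊥-elim (Tri.len≢5 a e l)
  ... | 4 | _ = ⊥-elim (len≢4 (alive-α a) e)
  ... | 5 | _ = ⊥-elim (n5 refl)
  ... | 6 | _ = ⊥-elim (five-six a l e)
  ... | 7 | _ = ⊥-elim (len≢7 (alive-α a) e)
  ... | suc (suc (suc (suc (suc (suc (suc (suc k))))))) | _ = m≤m+n 8 k

  small-5 : ∀ {x} → Len 5 x → small x ≡ true
  small-5 {x} l rewrite isLen-yes {5} {x} l = refl

  small-8 : ∀ {x} → Len 8 x → small x ≡ true
  small-8 {x} l rewrite isLen-no {5} {x} (λ z → case trans (sym l) z of λ ()) | isLen-yes {8} {x} l = refl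

  deg-of-big : ∀ {x} → big x ≡ false → deg x ≡ 3
  deg-of-big {x} e with deg x ≟ 3
  ... | yes q = q
  deg-of-big {x} () | no _

  len-5 : ∀ {h} → Alive h → Len 5 h → 72 ≤ RF.orbitSum W h
  len-5 {h} a l = ≤-trans (+-monoʳ-≤ 60 (pentagon-total (y 0) (y 1) (y 2) (y 3) (y 4) (s 0) (s 1) (s 2) (s 3) (s 4)
      (turn 0) (turn 1) (turn 2) (turn 3) (subst (λ z → big z ∨ not (s 4 ∧ isLen 5 (α z)) ≡ true) back (turn 4))))
      (≤-reflexive (sym (trans (unfold W l) total)))
    where
    x : ℕ → Fin d
    x i = iter ψ i h
    y s : ℕ → Bool
    y i = big (x i)
    s i = isLen 5 (α (x i))
    back : x 5 ≡ h
    back = wrapD l 0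
    al : ∀ i → Alive (x i)
    al i = alive-iterψ i a
    lx : ∀ i → Len 5 (x i)
    lx i = trans (len-iter i h) l
    turn : ∀ i → y (suc i) ∨ not (s i ∧ s (suc i)) ≡ true
    turn i with y (suc i) in e
    ... | true = refl
    ... | false = not-∧ λ p q → three-fives (al (suc i)) (deg-of-big e) (lx (suc i))
            (trans (next-corner (al (suc i))) (⌊⌋-true {d = len (α (x (suc i))) ≟ 5} q))
            (trans (cong len (sgsg-back (al i) (deg-of-big e))) (⌊⌋-true {d = len (α (x i)) ≟ 5} p))
    W-i : ∀ i → W (x i) ≡ 12 + (six (y i) + (if s i then 0 else 12 ∸ cost (type₅ (dem (x i)))))
    W-i i = trans (W-def (x i)) (trans (cong₂ _+_ (gain-small (al i) (small-5 (lx i)) (subst (_< 10) (sym (lx i)) (m≤m+n 6 4))) (cong₂ _+_ (c-short (subst (_< 8) (sym (lx i)) (m≤m+n 6 2))) (r (len (α (x i)) ≟ 5))))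
        (ar (six (y i)) _))
      where
      ar : ∀ u v → u + (12 + v) ≡ 12 + (u + v)
      ar = solve-∀
      r : (D : Dec (Len 5 (α (x i)))) → 12 ∸ c (α (x i)) ≡ (if ⌊ D ⌋ then 0 else 12 ∸ cost (type₅ (dem (x i))))
      r (yes e) = cong (12 ∸_) (c-short (subst (_< 8) (sym e) (m≤m+n 6 2)))
      r (no n) = cong (12 ∸_) (trans (c-long (five-across (al i) (lx i) n)) (cong cost (trans (typ-5 {α (x i)} (trans (cong len (α-inv _)) (lx i))) (cong (type₅ ∘ dem) (α-inv (x i))))))
    dem-i : ∀ i z₁ z₂ z₃ z₄ → x (1 + i) ≡ z₁ → x (2 + i) ≡ z₂ → x (3 + i) ≡ z₃ → x (4 + i) ≡ z₄ →
      dem (x i) ≡ demand (y i) (big z₁) (big z₂) (big z₃) (big z₄) (isLen 5 (α z₄)) (isLen 5 (α z₁))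
    dem-i i _ _ _ _ refl refl refl refl = refl
    b : ∀ i → x (5 + i) ≡ x i
    b i = trans (cong (λ z → iter ψ z h) (+-comm 5 i)) (wrapD l i)
    part : ∀ i {z₁ z₂ z₃ z₄} → x (1 + i) ≡ z₁ → x (2 + i) ≡ z₂ → x (3 + i) ≡ z₃ → x (4 + i) ≡ z₄ →
      W (x i) ≡ 12 + (six (y i) + paid (s i) (y i) (big z₁) (big z₂) (big z₃) (big z₄) (isLen 5 (α z₄)) (isLen 5 (α z₁)))
    part i e₁ e₂ e₃ e₄ = trans (W-i i) (cong (λ z → 12 + (six (y i) + (if s i then 0 else 12 ∸ cost (type₅ z)))) (dem-i i _ _ _ _ e₁ e₂ e₃ e₄))
    v₀ v₁ v₂ v₃ v₄ : ℕ
    v₀ = six (y 0) + paid (s 0) (y 0) (y 1) (y 2) (y 3) (y 4) (s 4) (s 1)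
    v₁ = six (y 1) + paid (s 1) (y 1) (y 2) (y 3) (y 4) (y 0) (s 0) (s 2)
    v₂ = six (y 2) + paid (s 2) (y 2) (y 3) (y 4) (y 0) (y 1) (s 1) (s 3)
    v₃ = six (y 3) + paid (s 3) (y 3) (y 4) (y 0) (y 1) (y 2) (s 2) (s 4)
    v₄ = six (y 4) + paid (s 4) (y 4) (y 0) (y 1) (y 2) (y 3) (s 3) (s 0)
    total : sumN 5 (λ i → W (x i)) ≡ 60 + (v₀ + (v₁ + (v₂ + (v₃ + (v₄ + 0)))))
    total = trans (cong₂ _+_ (part 0 refl refl refl refl) (cong₂ _+_ (part 1 refl refl refl back) (cong₂ _+_ (part 2 refl refl back (b 1))
        (cong₂ _+_ (part 3 refl back (b 1) (b 2)) (cong₂ _+_ (part 4 back (b 1) (b 2) (b 3)) refl)))))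
      (ar v₀ v₁ v₂ v₃ v₄)
      where
      ar : ∀ u v w p q → (12 + u) + ((12 + v) + ((12 + w) + ((12 + p) + ((12 + q) + 0)))) ≡ 60 + (u + (v + (w + (p + (q + 0)))))
      ar = solve-∀

  big-vtx : ∀ {g k} → Alive g → Alive k → vtx g ≡ vtx k → big g ≡ big k
  big-vtx ag ak e = cong (λ z → not ⌊ z ≟ 3 ⌋) (deg-vtx ag ak e)

  big-α : ∀ {x} → Alive x → big (α x) ≡ big (ψ x)
  big-α a = big-vtx (alive-α a) (alive-ψ a) (at-α0 a)

  big-ψα : ∀ {x} → Alive x → big (ψ (α x)) ≡ big x
  big-ψα a = big-vtx (alive-ψ (alive-α a)) a (at-α1 a)

  record Small₅ (x : Fin d) : Set where
    field
      l₅ : Len 5 (α x)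
      c₃ : CubicFace (α x)
      tail : big x ≡ false
      head : big (ψ x) ≡ false

  A-small : ∀ {x} → Alive x → typ x ≡ eA → Small₅ x
  A-small {x} a e with kind' e
  ... | isFive l q with demand-4 (big (α x)) (big (iter ψ 1 (α x))) (big (iter ψ 2 (α x))) (big (iter ψ 3 (α x))) (big (iter ψ 4 (α x))) (isLen 5 (α (iter ψ 4 (α x)))) (isLen 5 (α (ψ (α x)))) q
  ...   | (e₀ , e₁) , (e₂ , e₃ , e₄) = record
    { l₅ = l
    ; c₃ = everywhere (λ g → deg g ≡ 3) l λ
        { 0 _ → deg-of-big e₀ ; 1 _ → deg-of-big e₁ ; 2 _ → deg-of-big e₂ ; 3 _ → deg-of-big e₃ ; 4 _ → deg-of-big e₄
        ; (suc (suc (suc (suc (suc _))))) (s≤s (s≤s (s≤s (s≤s (s≤s ()))))) }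
    ; tail = trans (sym (big-ψα a)) e₁ ; head = trans (sym (big-α a)) e₀ }

  T-of : ∀ {x e} → Kind x e → isT e ≡ true → T x
  T-of (isTri t) _ = t
  T-of {x} (isFive _ refl) q = ⊥-elim (true≢false (trans (sym q) (isT-type₅ (dem (α x)))))

  L-of : ∀ {x e} → Kind x e → isL e ≡ true → Poor (α x)
  L-of (isPoor p) _ = p
  L-of {x} (isFive _ refl) q = ⊥-elim (true≢false (trans (sym q) (isL-type₅ (dem (α x)))))

  S-of : ∀ {x e} → Kind x e → isS e ≡ true → Len 5 (α x) ⊎ Len 8 (α x)
  S-of (isFive l _) _ = inj₁ l
  S-of (isEight l) _ = inj₂ l

  isT-typ : ∀ x → isT (typ x) ≡ isLen 3 (α x)
  isT-typ x = go (kind x)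
    where
    go : ∀ {e} → Kind x e → isT e ≡ isLen 3 (α x)
    go (isTri t) = sym (isLen-yes {3} {α x} t)
    go (isFive l refl) = trans (isT-type₅ (dem (α x))) (sym (isLen-no {3} {α x} (λ z → case trans (sym l) z of λ ())))
    go (isEight l) = sym (isLen-no {3} {α x} (λ z → case trans (sym l) z of λ ()))
    go (isPoor p) = sym (isLen-no {3} {α x} (λ z → case trans (sym (Poor.l p)) z of λ ()))
    go (isRest n _ _) = sym (isLen-no {3} {α x} n)

  small-no : ∀ {x} → ¬ Len 5 x → ¬ Len 8 x → small x ≡ false
  small-no {x} p q rewrite isLen-no {5} {x} p | isLen-no {8} {x} q = refl

  isS-typ : ∀ x → isS (typ x) ≡ small (α x)
  isS-typ x = go (kind x)
    where
    go : ∀ {e} → Kind x e → isS e ≡ small (α x)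
    go (isTri t) = sym (small-no {α x} (λ z → case trans (sym t) z of λ ()) (λ z → case trans (sym t) z of λ ()))
    go (isFive l refl) = trans (type₅-S (dem (α x))) (sym (small-5 {α x} l))
    go (isEight l) = sym (small-8 {α x} l)
    go (isPoor p) = sym (small-no {α x} (λ z → case trans (sym (Poor.l p)) z of λ ()) (λ z → case trans (sym (Poor.l p)) z of λ ()))
    go (isRest _ a b) = sym (small-no {α x} a b)

  no-T : ∀ {x} → ¬ T x → typ x ≢ eT
  no-T {x} n e = n (T-of (kind' e) refl)

  c≥8 : ∀ {x} → 8 ≤ len x → ¬ T x → 8 ≤ W x
  c≥8 {x} l n = ≤-trans (subst (8 ≤_) (sym (c-long l)) (cost≥8 (typ x) (no-T n))) (≤-trans (m≤n+m (c x) (gain x)) (W≥ x))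

  c≥9 : ∀ {x} → 8 ≤ len x → ¬ T x → typ x ≢ eA → 9 ≤ c x
  c≥9 {x} l n na = subst (9 ≤_) (sym (c-long l)) (cost≥9 (typ x) (no-T n) na)

  W≥c : ∀ x → c x ≤ W x
  W≥c x = ≤-trans (m≤n+m (c x) (gain x)) (W≥ x)

  sum-const≤ : ∀ {h k} v → Len k h → (∀ i → v ≤ W (iter ψ i h)) → k * v ≤ RF.orbitSum W h
  sum-const≤ {h} {k} v l f = ≤-trans (≤-reflexive (sym (sumN-const k v))) (≤-trans (sumN-mono k f) (≤-reflexive (sym (unfold W l))))

  -- No triangle borders a 9-face, so every edge keeps at least 8, and 9 · 8 = 72.
  len-9 : ∀ {h} → Alive h → Len 9 h → 72 ≤ RF.orbitSum W h
  len-9 {h} a l = sum-const≤ {h} {9} 8 l λ i → c≥8 (subst (8 ≤_) (sym (lx i)) (m≤m+n 8 1)) λ t → Tri.len≢9 (alive-iterψ i a) t (lx i)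
    where
    lx : ∀ i → Len 9 (iter ψ i h)
    lx i = trans (len-iter i h) l

  -- an 8-face next to a cubic pentagon passes the head of the common edge only once
  fresh-8 : ∀ {h} → Alive h → Len 8 h → Len 5 (α h) → CubicFace (α h) → ∀ i → suc i < 7 → at (2 + i) h ≢ at 1 h
  fresh-8 {h} a l l₅ c₃ = go
    where
    x : ℕ → V
    x i = at i h
    e : ∀ i → Adj (x i) (x (suc i))
    e = adj a
    f = α h
    af = alive-α a
    F = face-five af l₅
    b≡ : at 0 f ≡ x 1
    b≡ = at-α0 a
    a≡ : at 1 f ≡ x 0
    a≡ = at-α1 a
    Cb : Cubic (at 5 f) (at 4 f) (at 6 f) (outer (iter ψ 5 f))
    Cb = cub-at af c₃ 4
    out : outer (iter ψ 5 f) ≡ x 2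
    out = trans (cong outer (wrapD l₅ 0)) (trans (cong (vtx ∘ α) (sym (ψ-alive a))) (sym (vtx-ψ (alive-ψ a))))
    no-apex : ∀ y → Adj y (x 0) → Adj y (x 1) → ⊥
    no-apex y p q = no35 y F (adj-sym (subst (Adj y) (sym b≡) q)) (subst (Adj y) (sym a≡) p)
    no-apex' : ∀ y → Adj y (at 4 f) → Adj y (x 1) → ⊥
    no-apex' y p q = no35 y (rot5 (rot5 (rot5 (rot5 F)))) (adj-sym p) (subst (Adj y) (sym b≡) q)
    w1 = wrap l 1
    go : ∀ i → suc i < 7 → x (2 + i) ≢ x 1
    go 0 _ q = adj-≢ (e 1) (sym q)
    go 1 _ q = nb2 a 1 (sym q)
    go 2 _ q = third (Cubic.nb Cb (x 3) (subst (λ z → Adj z (x 3)) (sym (trans (wrap l₅ 0) b≡)) (adj-sym (subst (Adj (x 3)) q (e 3)))) (alive-S (alive-iterψ 3 a)))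
      where
      third : x 3 ≡ at 4 f ⊎ x 3 ≡ at 6 f ⊎ x 3 ≡ outer (iter ψ 5 f) → ⊥
      third (inj₁ z) = no-apex' (x 2) (subst (Adj (x 2)) z (e 2)) (adj-sym (e 1))
      third (inj₂ (inj₁ z)) = no-apex (x 2) (subst (Adj (x 2)) (trans z (trans (wrap l₅ 1) a≡)) (e 2)) (adj-sym (e 1))
      third (inj₂ (inj₂ z)) = adj-≢ (e 2) (sym (trans z out))
    go 3 _ q = noC4 (e 1) (e 2) (e 3) (subst (Adj (x 4)) q (e 4)) (nb2 a 1) (nb2 a 2)
    go 4 _ q = no-apex (x 7) (subst (Adj (x 7)) (wrap l 0) (e 7)) (adj-sym (subst (λ z → Adj z (x 7)) q (e 6)))
    go 5 _ q = nb2 a 7 (trans q (sym w1))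
    go (suc (suc (suc (suc (suc (suc i)))))) (s≤s (s≤s (s≤s (s≤s (s≤s (s≤s (s≤s ()))))))) q

  -- No triangle borders an 8-face. A corner of degree at least 4 gives 6 and forbids `eA` on both
  -- its edges: 6 + 2 · 9 + 6 · 8 = 72. If all degrees are 3, `no-small-ring` forbids `eA`
  -- everywhere: 8 · 9 = 72.
  len-8 : ∀ {h} → Alive h → Len 8 h → 72 ≤ RF.orbitSum W h
  len-8 {h} a l = go (F.any? {8} λ i → big (iter ψ (toℕ i) h) ≟B true)
    where
    lx : ∀ {h} → Len 8 h → ∀ i → Len 8 (iter ψ i h)
    lx {h} l i = trans (len-iter i h) l
    long : ∀ {x} → Len 8 x → 8 ≤ len x
    long e = ≤-reflexive (sym e)
    with-big : ∀ {h} → Alive h → Len 8 h → big h ≡ true → 72 ≤ RF.orbitSum W h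
    with-big {h} a l b = ≤-trans (+-mono-≤ w0 (+-mono-≤ (w 1) (+-mono-≤ (w 2) (+-mono-≤ (w 3) (+-mono-≤ (w 4) (+-mono-≤ (w 5) (+-mono-≤ (w 6) (+-mono-≤ w7 (z≤n {0})))))))))
        (≤-reflexive (sym (unfold W l)))
      where
      w : ∀ i → 8 ≤ W (iter ψ i h)
      w i = c≥8 (long (lx l i)) λ t → Tri.len≢8 (alive-iterψ i a) t (lx l i)
      w0 : 15 ≤ W h
      w0 = ≤-trans (+-mono-≤ (≤-reflexive (sym (trans (gain-small a (small-8 l) (subst (_< 10) (sym l) (m≤m+n 9 1))) (cong six b))))
        (c≥9 (long l) (λ t → Tri.len≢8 a t l) λ e → true≢false (trans (sym b) (Small₅.tail (A-small a e))))) (W≥ h)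
      w7 : 9 ≤ W (iter ψ 7 h)
      w7 = ≤-trans (c≥9 (long (lx l 7)) (λ t → Tri.len≢8 (alive-iterψ 7 a) t (lx l 7))
        λ e → true≢false (trans (sym b) (trans (cong big (sym (wrapD l 0))) (Small₅.head (A-small (alive-iterψ 7 a) e))))) (W≥c _)
    go : Dec (∃ λ (i : Fin 8) → big (iter ψ (toℕ i) h) ≡ true) → 72 ≤ RF.orbitSum W h
    go (yes (i , b)) = subst (72 ≤_) (RF.orbitSum-iter W (toℕ i) h) (with-big (alive-iterψ (toℕ i) a) (lx l (toℕ i)) b)
    go (no nb) = sum-const≤ {h} {8} 9 l λ i → ≤-trans (c≥9 (long (lx l i)) (λ t → Tri.len≢8 (alive-iterψ i a) t (lx l i)) (noA i)) (W≥c _)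
      where
      c₃ : ∀ i → deg (iter ψ i h) ≡ 3
      c₃ = everywhere (λ g → deg g ≡ 3) l λ i lt → deg-of-big (¬true λ b → nb (fromℕ< lt , trans (cong (λ z → big (iter ψ z h)) (F.toℕ-fromℕ< lt)) b))
      noA : ∀ i → typ (iter ψ i h) ≢ eA
      noA i e = no-small-ring ai (λ j → trans (cong deg (sym (iter-+ ψ j i h))) (c₃ (j + i))) (pentagon-ring (alive-α ai) (Small₅.c₃ sm) (Small₅.l₅ sm)) {5} (lx l i)
          (fresh-8 ai (lx l i) (Small₅.l₅ sm) (Small₅.c₃ sm))
        where
        ai = alive-iterψ i a
        sm = A-small ai e

  -- Corners and consecutive edges of long faces

  module Corner {p : Fin d} (a : Alive p) (l : 10 ≤ len p) where
    x : Fin d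
    x = ψ p
    ax : Alive x
    ax = alive-ψ a
    lx : 10 ≤ len x
    lx = subst (10 ≤_) (sym (len-iter 1 p)) l

    inv-x : RS.inv x ≡ α p
    inv-x = sg-inj _ _ (trans (RS.π-inv x) (ψ-alive a))

    not-short : ∀ {k} → k < 10 → ¬ Len k x
    not-short lt z = <⇒≱ lt (subst (10 ≤_) z lx)

    tri-sg : ∀ {k} → Alive k → Len 3 (sg k) → 10 ≤ len k
    tri-sg ak z = Tri.len≥10 ak (trans (len-α ak) z)

    sg-tri : ∀ {k} → Alive k → Len 3 k → 10 ≤ len (sg k)
    sg-tri ak z = subst (10 ≤_) (len-α ak) (tri-far ak z)

    module Cubic₃ (d3 : deg x ≡ 3) where
      sg² : sg (sg x) ≡ α p
      sg² = sgsg-back a d3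

      T-far : T p → 10 ≤ len (α x)
      T-far t = subst (10 ≤_) (next-corner ax) (tri-sg (alive-sg ax) (trans (cong len sg²) t))

      far-T : T x → 10 ≤ len (α p)
      far-T t = subst (10 ≤_) (cong len sg²) (sg-tri (alive-sg ax) (trans (next-corner ax) t))

      -- Of two consecutive edges of the poor face one borders a triangle. It is not the one shared
      -- with the long face, so it is the third edge at the corner, and the triangle is the face
      -- beyond `x`.
      L-T : Poor (α p) → T x
      L-T P = go (Poor.alternate P 9)
        where
        m = iter ψ 9 (α p)
        am = alive-iterψ 9 (alive-α a)
        sgm : sg (α m) ≡ α p
        sgm = trans (sym (ψ-alive am)) (wrapD (Poor.l P) 0)
        go : T m ⊎ T (ψ m) → T x
        go (inj₁ t) = trans (sym (next-corner ax)) (trans (cong len (sg-inj _ _ (trans sg² (sym sgm)))) t)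
        go (inj₂ t) = ⊥-elim (<⇒≱ (s≤s (m≤m+n 3 6)) (subst (10 ≤_) (trans (cong len (sym (α-inv p))) (trans (cong (len ∘ α) (sym (wrapD (Poor.l P) 0))) t)) l))

      T-L : Poor (α x) → T p
      T-L P = go (Poor.alternate P 0)
        where
        go : T (α x) ⊎ T (ψ (α x)) → T p
        go (inj₁ t) = ⊥-elim (not-short (m≤m+n 4 6) (trans (cong len (sym (α-inv x))) t))
        go (inj₂ t) = trans (cong len (sym sg²)) (trans (sym (len-α (alive-sg ax))) (trans (cong (len ∘ α) (sym (trans (ψ-alive (alive-α ax)) (cong sg (α-inv x))))) t))

    poor-tail : Poor (α x) → big x ≡ false
    poor-tail P = trans (sym (big-ψα ax)) (big-false (Poor.cub P 1))

    poor-head : Poor (α p) → big x ≡ false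
    poor-head P = trans (sym (big-α a)) (big-false (Poor.cub P 0))

    short : ∀ {z} → 10 ≤ len (α z) → Len 5 (α z) ⊎ Len 8 (α z) → ⊥
    short le (inj₁ l₅) = <⇒≱ (m≤m+n 6 4) (subst (10 ≤_) l₅ le)
    short le (inj₂ l₈) = <⇒≱ (m≤m+n 9 1) (subst (10 ≤_) l₈ le)

    check₂ : ∀ y → ok₂ (y , typ p) (big x , typ x) ≡ true
    check₂ y = go (big x) refl
      where
      noAL : ∀ {z} e → typ z ≡ e → (typ z ≡ eA → ⊥) → (Poor (α z) → ⊥) → isAL e ≡ true → ⊥
      noAL eA e nA nL _ = nA e
      noAL {z} eL e nA nL _ = nL (L-of (kind' e) refl)
      far : ∀ {z} → 10 ≤ len (α z) → isT (typ z) ∨ isS (typ z) ≡ true → ⊥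
      far {z} le q = either (∨-true {isT (typ z)} q)
        where
        either : isT (typ z) ≡ true ⊎ isS (typ z) ≡ true → ⊥
        either (inj₁ t) = <⇒≱ (m≤m+n 4 6) (subst (10 ≤_) (T-of (kind z) t) le)
        either (inj₂ s) = short le (S-of (kind z) s)
      go : ∀ b → big x ≡ b → ok₂ (y , typ p) (b , typ x) ≡ true
      go true b = not-true λ q → either (∨-true {isAL (typ p)} q)
        where
        either : isAL (typ p) ≡ true ⊎ isAL (typ x) ≡ true → ⊥
        either (inj₁ z) = noAL (typ p) refl (λ e → true≢false (trans (sym b) (Small₅.head (A-small a e)))) (λ P → true≢false (trans (sym b) (poor-head P))) z
        either (inj₂ z) = noAL (typ x) refl (λ e → true≢false (trans (sym b) (Small₅.tail (A-small ax e)))) (λ P → true≢false (trans (sym b) (poor-tail P))) z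
      go false b = and (not-∧ λ t q → far (T-far (T-of (kind p) t)) q)
        (and (not-∧ λ s t → far (far-T (T-of (kind x) t)) (or (isT (typ p)) s))
        (and (imp λ q → trans (isT-typ x) (isLen-yes {3} {α x} (L-T (L-of (kind p) q))))
             (imp λ q → trans (isT-typ p) (isLen-yes {3} {α p} (T-L (L-of (kind x) q))))))
        where
        open Cubic₃ (deg-of-big b)
        or : ∀ u {v} → v ≡ true → u ∨ v ≡ true
        or true _ = refl
        or false e = e

    check-gain : gainLow (typ p) (big x) (typ x) ≤ gain x
    check-gain = go (big x) refl
      where
      go : ∀ b → big x ≡ b → gainLow (typ p) b (typ x) ≤ gain x
      go false _ = z≤n
      go true b = subst (gainLow (typ p) true (typ x) ≤_) (sym eq) (gainLow-give (typ p) (typ x) q t₂ (not-true con))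
        where
        q t₂ : Bool
        q = ⌊ deg x ≟ 4 ⌋
        t₂ = isLen 3 (sg (sg x))
        -- The faces beyond `p` and `x` both border the triangle at the opposite corner, so they
        -- have length at least 10.
        con' : deg x ≡ 4 → Len 3 (sg (sg x)) → isS (typ p) ≡ true ⊎ isS (typ x) ≡ true → ⊥
        con' d4 tri (inj₂ s) = short (subst (10 ≤_) (next-corner ax) (tri-sg (alive-sg ax) tri)) (S-of (kind x) s)
        con' d4 tri (inj₁ s) = short (subst (10 ≤_) (cong len s3) (sg-tri (alive-sg (alive-sg ax)) tri)) (S-of (kind p) s)
          where
          s3 : sg (sg (sg x)) ≡ α p
          s3 = sg-inj _ _ (trans (trans (cong (λ t → iter sg t x) (sym d4)) (RS.per-return x)) (ψ-alive a))
        con : q ∧ t₂ ∧ (isS (typ p) ∨ isS (typ x)) ≡ true → ⊥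
        con h = con' (⌊⌋-true {d = deg x ≟ 4} (proj₁ (∧-true {q} h))) (⌊⌋-true {d = len (sg (sg x)) ≟ 3} (proj₁ (∧-true {t₂} h'))) (∨-true {isS (typ p)} (proj₂ (∧-true {t₂} h')))
          where
          h' : t₂ ∧ (isS (typ p) ∨ isS (typ x)) ≡ true
          h' = proj₂ (∧-true {q} h)
        isLen-cong : ∀ {k g g'} → len g ≡ len g' → isLen k g ≡ isLen k g'
        isLen-cong {k} e = cong (λ z → ⌊ z ≟ k ⌋) e
        small-cong : ∀ {g g'} → len g ≡ len g' → small g ≡ small g'
        small-cong e = cong₂ _∨_ (isLen-cong {5} e) (isLen-cong {8} e)
        g₁ : gain x ≡ gives q (isLen 3 x) (isLen 3 (RS.inv x)) (isLen 3 (sg x)) t₂ (small (RS.inv x)) (small (sg x)) (small x)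
        g₁ = cong (λ z → if z then gives q (isLen 3 x) (isLen 3 (RS.inv x)) (isLen 3 (sg x)) t₂ (small (RS.inv x)) (small (sg x)) (small x) else 0) b
        eq : gain x ≡ give q (isT (typ p)) (isT (typ x)) t₂ (isS (typ p)) (isS (typ x)) false
        eq = trans g₁ (trans (cong₂ (λ u v → gives q u (isLen 3 (RS.inv x)) (isLen 3 (sg x)) t₂ (small (RS.inv x)) (small (sg x)) v)
            (isLen-no {3} {x} (not-short (m≤m+n 4 6))) (small-no {x} (not-short (m≤m+n 6 4)) (not-short (m≤m+n 9 1))))
          (trans (cong₂ (λ u v → give q u (isLen 3 (sg x)) t₂ v (small (sg x)) false) (trans (cong (isLen 3) inv-x) (sym (isT-typ p))) (trans (cong small inv-x) (sym (isS-typ p))))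
            (cong₂ (λ u v → give q (isT (typ p)) u t₂ (isS (typ p)) v false) (trans (isLen-cong {3} (next-corner ax)) (sym (isT-typ x))) (trans (small-cong (next-corner ax)) (sym (isS-typ x))))))

  module Window {p : Fin d} (a : Alive p) (l : 10 ≤ len p) where
    x z : Fin d
    x = ψ p
    z = ψ x
    ax = alive-ψ a
    az = alive-ψ ax
    module X = Corner a l
    module Z = Corner ax X.lx

    -- The triangle beyond `x` borders the poor face along the third edge at this corner, and the
    -- far end of `x` is its tip, which `tip-big` makes large.
    L-then : Poor (α p) → T x → deg x ≡ 3 → deg z ≡ 3 → ⊥
    L-then P t dx dz = go (Poor.alternate P 9)
      where
      module PF = PoorFace (alive-α a) P
      m = iter ψ 9 (α p)
      am = alive-iterψ 9 (alive-α a)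
      sgx : sg x ≡ α m
      sgx = sg-inj _ _ (trans (sgsg-back a dx) (sym (trans (sym (ψ-alive am)) (wrapD (Poor.l P) 0))))
      tip≡ : iter ψ 2 (α m) ≡ α x
      tip≡ = trans (cong (iter ψ 2) (trans (sym sgx) (trans (cong sg (sym (α-inv x))) (sym (ψ-alive (alive-α ax)))))) (trans (sym (iter-suc ψ 2 (α x))) (wrapD t 0))
      go : T m ⊎ T (ψ m) → ⊥
      go (inj₁ tm) = PF.tip-big 9 tm (trans (cong deg tip≡) (trans (deg-vtx (alive-α ax) az (at-α0 ax)) dz))
      go (inj₂ t') = <⇒≱ (m≤m+n 4 6) (subst (10 ≤_) (trans (cong len (sym (α-inv p))) (trans (cong (len ∘ α) (sym (wrapD (Poor.l P) 0))) t')) l)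

    then-L : Poor (α z) → deg x ≡ 3 → deg z ≡ 3 → ⊥
    then-L P dx dz = go (Poor.alternate P 0)
      where
      module PF = PoorFace (alive-α az) P
      m = ψ (α z)
      am = alive-ψ (alive-α az)
      m≡ : m ≡ sg z
      m≡ = trans (ψ-alive (alive-α az)) (cong sg (α-inv z))
      ψm : ψ (α m) ≡ α x
      ψm = trans (ψ-alive (alive-α am)) (trans (cong sg (trans (α-inv m) m≡)) (sgsg-back ax dz))
      go : T (α z) ⊎ T m → ⊥
      go (inj₁ t) = Z.not-short (m≤m+n 4 6) (trans (cong len (sym (α-inv z))) t)
      go (inj₂ t) = PF.tip-big 1 t (trans (deg-vtx (alive-iterψ 2 (alive-α am)) ax (trans (cong (vtx ∘ ψ) ψm) (at-α1 ax))) dx)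

    -- With both ends of degree 3 a demand of 3 is raised only in place of a neighbouring edge of
    -- the pentagon that borders another pentagon.
    B-then : typ x ≡ eB → deg x ≡ 3 → deg z ≡ 3 → Len 5 (α p) ⊎ Len 5 (α z)
    B-then e dx dz = five' (kind' e)
      where
      five' : Kind x eB → Len 5 (α p) ⊎ Len 5 (α z)
      five' (isFive l₅ q) = go (demand-3 (big (iter ψ 2 f)) (big (iter ψ 3 f)) (big (iter ψ 4 f)) (isLen 5 (α g)) (isLen 5 (α (ψ f))) (subst₂ (λ u v → type₅ (demand u v (big (iter ψ 2 f)) (big (iter ψ 3 f)) (big (iter ψ 4 f)) (isLen 5 (α (iter ψ 4 f))) (isLen 5 (α (ψ f)))) ≡ eB)
              (trans (big-α ax) (big-false dz)) (trans (big-ψα ax) (big-false dx)) q))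
        where
        f = α x
        g = iter ψ 4 f
        ag = alive-iterψ 4 (alive-α ax)
        αg : α g ≡ sg z
        αg = sg-inj _ _ (trans (sym (ψ-alive ag)) (trans (wrapD l₅ 0) (sym (sgsg-back ax dz))))
        go : isLen 5 (α g) ≡ true ⊎ isLen 5 (α (ψ f)) ≡ true → Len 5 (α p) ⊎ Len 5 (α z)
        go (inj₁ s) = inj₂ (trans (sym (next-corner az)) (trans (cong len (sym αg)) (⌊⌋-true {d = len (α g) ≟ 5} s)))
        go (inj₂ s) = inj₁ (trans (cong len (sym (sgsg-back a dx))) (trans (sym (len-α (alive-sg ax)))
          (trans (cong (len ∘ α) (sym (trans (ψ-alive (alive-α ax)) (cong sg (α-inv x))))) (⌊⌋-true {d = len (α (ψ f)) ≟ 5} s))))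

    check₃ : ∀ y → ok₃ (y , typ p) (big x , typ x) (big z , typ z) ≡ true
    check₃ y = and (not-true c₁) (and (not-true c₂) (not-true c₃))
      where
      five-S : ∀ {u} → Len 5 (α u) → isS (typ u) ≡ true
      five-S {u} l₅ = trans (isS-typ u) (small-5 {α u} l₅)
      B-of : ∀ e → isB e ≡ true → e ≡ eB
      B-of eB _ = refl
      cases : ∀ {u v w : Bool} {A : Set} → u ∧ v ∧ w ≡ true → (u ≡ true → v ≡ true → w ≡ true → A) → A
      cases {u} {v} h k = k (proj₁ (∧-true {u} h)) (proj₁ (∧-true {v} (proj₂ (∧-true {u} h)))) (proj₂ (∧-true {v} (proj₂ (∧-true {u} h))))
      cub : ∀ {u} → not (big u) ≡ true → deg u ≡ 3
      cub h = deg-of-big (not-false h)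
      c₁ : isL (typ p) ∧ isT (typ x) ∧ not (big x) ∧ not (big z) ≡ true → ⊥
      c₁ h = cases {isL (typ p)} {isT (typ x)} h λ h₁ h₂ h₃ →
        L-then (L-of (kind p) h₁) (T-of (kind x) h₂) (cub (proj₁ (∧-true {not (big x)} h₃))) (cub (proj₂ (∧-true {not (big x)} h₃)))
      c₂ : isL (typ z) ∧ isT (typ x) ∧ not (big x) ∧ not (big z) ≡ true → ⊥
      c₂ h = cases {isL (typ z)} {isT (typ x)} h λ h₁ _ h₃ →
        then-L (L-of (kind z) h₁) (cub (proj₁ (∧-true {not (big x)} h₃))) (cub (proj₂ (∧-true {not (big x)} h₃)))
      c₃ : isB (typ x) ∧ not (big x) ∧ not (big z) ∧ not (isS (typ p)) ∧ not (isS (typ z)) ≡ true → ⊥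
      c₃ h = cases {isB (typ x)} {not (big x)} h λ h₁ h₂ h' → cases {not (big z)} {not (isS (typ p))} h' λ h₃ h₄ h₅ →
        neither h₄ h₅ (B-then (B-of (typ x) h₁) (cub h₂) (cub h₃))
        where
        neither : not (isS (typ p)) ≡ true → not (isS (typ z)) ≡ true → Len 5 (α p) ⊎ Len 5 (α z) → ⊥
        neither h₄ h₅ (inj₁ q) = true≢false (trans (sym (five-S q)) (not-false h₄))
        neither h₄ h₅ (inj₂ q) = true≢false (trans (sym (five-S q)) (not-false h₅))

  -- The cyclic word of a long face

  sym-at : Fin d → Sym
  sym-at x = big x , typ x

  module Word {h : Fin d} (a : Alive h) (l : 10 ≤ len h) where
    D : ℕ → Fin d
    D i = iter ψ i h
    s : ℕ → Sym
    s i = sym-at (D i)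
    al : ∀ i → Alive (D i)
    al i = alive-iterψ i a
    ll : ∀ i → 10 ≤ len (D i)
    ll i = subst (10 ≤_) (sym (len-iter i h)) l
    wt : ℕ → ℕ
    wt i = weight (s i) (s (suc i))

    o₂ : ∀ i → ok₂ (s i) (s (suc i)) ≡ true
    o₂ i = Corner.check₂ (al i) (ll i) (big (D i))

    o₃ : ∀ i → ok₃ (s i) (s (suc i)) (s (2 + i)) ≡ true
    o₃ i = Window.check₃ (al i) (ll i) (big (D i))

    c-is : ∀ i → c (D i) ≡ cost (typ (D i))
    c-is i = c-long (≤-trans (m≤m+n 8 2) (ll i))

    wt≤ : ∀ i → wt i ≤ 2 * gain (D (suc i)) + (c (D i) + c (D (suc i)))
    wt≤ i = +-mono-≤ (*-monoʳ-≤ 2 (Corner.check-gain (al i) (ll i))) (≤-reflexive (cong₂ _+_ (sym (c-is i)) (sym (c-is (suc i)))))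

    sum-wt : sumN (len h) wt ≤ 2 * RF.orbitSum W h
    sum-wt = begin
      sumN (len h) wt ≤⟨ sumN-mono (len h) wt≤ ⟩
      sumN (len h) (λ i → 2 * gain (D (suc i)) + (c (D i) + c (D (suc i)))) ≡⟨ sumN-+ (len h) (λ i → 2 * gain (D (suc i))) (λ i → c (D i) + c (D (suc i))) ⟩
      sumN (len h) (λ i → 2 * gain (D (suc i))) + sumN (len h) (λ i → c (D i) + c (D (suc i)))
        ≡⟨ cong₂ _+_ (trans (sumN-*ˡ (len h) 2 (λ i → gain (D (suc i)))) (cong (2 *_) (RF.orbitSum-π gain h)))
             (trans (sumN-+ (len h) (λ i → c (D i)) (λ i → c (D (suc i)))) (cong (RF.orbitSum c h +_) (RF.orbitSum-π c h))) ⟩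
      2 * RF.orbitSum gain h + (RF.orbitSum c h + RF.orbitSum c h) ≡⟨ ar (RF.orbitSum gain h) (RF.orbitSum c h) ⟩
      2 * (RF.orbitSum gain h + RF.orbitSum c h) ≡⟨ cong (2 *_) (sumN-+ (len h) (λ i → gain (D i)) (λ i → c (D i))) ⟨
      2 * sumN (len h) (λ i → gain (D i) + c (D i)) ≤⟨ *-monoʳ-≤ 2 (sumN-mono (len h) λ i → W≥ (D i)) ⟩
      2 * RF.orbitSum W h ∎
      where
      open ≤-Reasoning
      ar : ∀ x y → 2 * x + (y + y) ≡ 2 * (x + y)
      ar = solve-∀

    enough : 144 ≤ sumN (len h) wt → 72 ≤ RF.orbitSum W h
    enough le = *-cancelˡ-≤ 2 (≤-trans le sum-wt)

    -- Summed over the cyclic word, the `eL` terms of `low-shift` cancel, since 3 + 3 = 6. At least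
    -- 12 per corner remains, and twelve corners reach 144.
    long : 12 ≤ len h → 72 ≤ RF.orbitSum W h
    long le = enough (≤-trans (*-monoʳ-≤ 12 le) (+-cancelʳ-≤ (6 * Λ) _ _ main))
      where
      open ≤-Reasoning
      b : ℕ → ℕ
      b i = bit (has-L (s i))
      N = len h
      Λ = sumN N b
      per : ∀ i → s (i + N) ≡ s i
      per i = cong sym-at (wrapD refl i)
      shift1 : ∀ (f : ℕ → ℕ) → f N ≡ f 0 → sumN N (f ∘ suc) ≡ sumN N f
      shift1 = sumN-shift N
      b1 : sumN N (b ∘ suc) ≡ Λ
      b1 = shift1 b (cong (bit ∘ has-L) (per 0))
      b2 : sumN N (λ i → b (2 + i)) ≡ Λ
      b2 = trans (shift1 (b ∘ suc) (cong (bit ∘ has-L) (per 1))) b1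
      w1 : sumN N (wt ∘ suc) ≡ sumN N wt
      w1 = shift1 wt (cong₂ weight (per 0) (per 1))
      main : 12 * N + 6 * Λ ≤ sumN N wt + 6 * Λ
      main = begin
        12 * N + 6 * Λ ≡⟨ cong₂ _+_ (trans (sumN-const N 12) (*-comm N 12)) (sumN-*ˡ N 6 b) ⟨
        sumN N (λ _ → 12) + sumN N (λ i → 6 * b i) ≡⟨ sumN-+ N (λ _ → 12) (λ i → 6 * b i) ⟨
        sumN N (λ i → 12 + 6 * b i) ≤⟨ sumN-mono N (λ i → low-shift (s i) (s (suc i)) (s (2 + i)) (o₂ i) (o₂ (suc i)) (o₃ i)) ⟩
        sumN N (λ i → wt (suc i) + (3 * b (suc i) + 3 * b (2 + i))) ≡⟨ sumN-+ N (wt ∘ suc) (λ i → 3 * b (suc i) + 3 * b (2 + i)) ⟩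
        sumN N (wt ∘ suc) + sumN N (λ i → 3 * b (suc i) + 3 * b (2 + i)) ≡⟨ cong₂ _+_ w1 (trans (sumN-+ N (λ i → 3 * b (suc i)) (λ i → 3 * b (2 + i)))
            (cong₂ _+_ (trans (sumN-*ˡ N 3 (b ∘ suc)) (cong (3 *_) b1)) (trans (sumN-*ˡ N 3 (λ i → b (2 + i))) (cong (3 *_) b2)))) ⟩
        sumN N wt + (3 * Λ + 3 * Λ) ≡⟨ cong (sumN N wt +_) (ar Λ) ⟩
        sumN N wt + 6 * Λ ∎
        where
        ar : ∀ x → 3 * x + 3 * x ≡ 6 * x
        ar = solve-∀

    low₉ : ∀ i → 9 ≤ wt i
    low₉ i = low-9 (s i) (s (suc i)) (o₂ i)

    low₁₂ : (∀ i → has-L (s i) ≡ false) → ∀ i → 12 ≤ wt i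
    low₁₂ n i = low-12 (s i) (s (suc i)) (n i) (n (suc i)) (o₂ i)

    decide : ∀ {k} → Len k h → (sumN k wt < 144 → 72 ≤ RF.orbitSum W h) → 72 ≤ RF.orbitSum W h
    decide refl f with 144 ≤? sumN (len h) wt
    ... | yes q = enough q
    ... | no nq = f (≰⇒> nq)

  sum-list : ∀ {h k} → Len k h → ∀ (v : ℕ → ℕ) → (∀ i → i < k → v i ≤ W (iter ψ i h)) → sumN k v ≤ RF.orbitSum W h
  sum-list {h} {k} l v f = ≤-trans (go k 0 f) (≤-reflexive (sym (unfold W l)))
    where
    go : ∀ k j → (∀ i → i < k → v (j + i) ≤ W (iter ψ (j + i) h)) → sumN k (λ i → v (j + i)) ≤ sumN k (λ i → W (iter ψ (j + i) h))
    go zero j f = z≤n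
    go (suc k) j f = +-mono-≤ (f 0 (s≤s z≤n)) (≤-trans (≤-reflexive (sumN-cong k λ i → cong v (+-suc j i)))
      (≤-trans (go k (suc j) λ i lt → subst (λ z → v z ≤ W (iter ψ z h)) (+-suc j i) (f (suc i) (s≤s lt)))
        (≤-reflexive (sumN-cong k λ i → cong (λ z → W (iter ψ z h)) (sym (+-suc j i))))))

  -- Faces of length 10 and 11

  module Ten {h : Fin d} (a : Alive h) (l : Len 10 h) where
    open Word a (≤-reflexive (sym l)) public

    wrap₀ : s 10 ≡ s 0
    wrap₀ = cong sym-at (wrapD l 0)
    wrap₁ : s 11 ≡ s 1
    wrap₁ = cong sym-at (wrapD l 1)

    c≤W : ∀ i {e} → typ (D i) ≡ e → cost e ≤ W (D i)
    c≤W i refl = ≤-trans (≤-reflexive (sym (c-is i))) (W≥c (D i))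

    is-T : ∀ i → typ (D i) ≡ eT → T (D i)
    is-T i e = T-of (kind' e) refl

    from : ∀ {xs} → revL s 10 ≡ xs → ∀ i → nth i (revL s 10) ≡ nth i xs
    from e i = cong (nth i) e

    L-case : isL (typ h) ≡ true → 72 ≤ RF.orbitSum W h
    L-case isl = decide l λ cheap → found (member-one _ _ (L₁₀.sound 8 s wrap₀ wrap₁ o₂ o₃ (λ _ → refl) isl low₉ cheap run-L₁₀))
      where
      found : revL s 10 ≡ wordL → 72 ≤ RF.orbitSum W h
      found eq = by (deg (D 2) ≟ 4) (deg (D 9) ≟ 4)
        where
        e₀ : s 0 ≡ 3L
        e₀ = from eq 9
        e₁ : s 1 ≡ 3T
        e₁ = from eq 8
        e₂ : s 2 ≡ YT
        e₂ = from eq 7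
        e₃ : s 3 ≡ 3N
        e₃ = from eq 6
        e₄ : s 4 ≡ 3T
        e₄ = from eq 5
        e₅ : s 5 ≡ 3N
        e₅ = from eq 4
        e₆ : s 6 ≡ 3T
        e₆ = from eq 3
        e₇ : s 7 ≡ 3N
        e₇ = from eq 2
        e₈ : s 8 ≡ 3T
        e₈ = from eq 1
        e₉ : s 9 ≡ YT
        e₉ = from eq 0
        cubic' : ∀ i {e} → s i ≡ (false , e) → deg (D i) ≡ 3
        cubic' i q = deg-of-big (cong proj₁ q)
        tri' : ∀ i {y} → s i ≡ (y , eT) → T (D i)
        tri' i q = is-T i (cong proj₂ q)
        -- a corner between two triangles gains 12, or 18 if its degree is at least 5
        gain≥ : ∀ i {y} → s i ≡ (y , eT) → s (suc i) ≡ YT → (deg (D (suc i)) ≢ 4 → 18 ≤ gain (D (suc i))) × 12 ≤ gain (D (suc i))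
        gain≥ i q r = (λ n → ≤-reflexive (sym (trans g (cong (λ z → if z then 12 else 18) (⌊⌋-no {D = deg x ≟ 4} n))))) ,
            ≤-trans (least12 ⌊ deg x ≟ 4 ⌋) (≤-reflexive (sym g))
          where
          x = D (suc i)
          module C = Corner (al i) (ll i)
          least12 : ∀ z → 12 ≤ (if z then 12 else 18)
          least12 true = ≤-refl
          least12 false = m≤m+n 12 6
          g : gain x ≡ (if ⌊ deg x ≟ 4 ⌋ then 12 else 18)
          g = trans (cong (λ z → if z then gives ⌊ deg x ≟ 4 ⌋ (isLen 3 x) (isLen 3 (RS.inv x)) (isLen 3 (sg x)) (isLen 3 (sg (sg x))) (small (RS.inv x)) (small (sg x)) (small x) else 0) (cong proj₁ r))
            (trans (cong (λ z → gives ⌊ deg x ≟ 4 ⌋ z (isLen 3 (RS.inv x)) (isLen 3 (sg x)) (isLen 3 (sg (sg x))) (small (RS.inv x)) (small (sg x)) (small x)) (isLen-no {3} {x} (C.not-short (m≤m+n 4 6))))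
            (cong₂ (λ u v → give ⌊ deg x ≟ 4 ⌋ u v (isLen 3 (sg (sg x))) (small (RS.inv x)) (small (sg x)) (small x))
              (trans (cong (isLen 3) C.inv-x) (isLen-yes {3} {α (D i)} (tri' i q)))
              (isLen-yes {3} {sg x} (trans (next-corner (al (suc i))) (tri' (suc i) r)))))
        gW : ∀ i {v} → v ≤ gain (D i) → v ≤ W (D i)
        gW i le = ≤-trans le (≤-trans (m≤m+n _ _) (W≥ (D i)))
        total : ∀ u v → u ≤ W (D 2) → v ≤ W (D 9) → 72 ≤ 9 + (u + (12 + (12 + (12 + v)))) → 72 ≤ RF.orbitSum W h
        total u v p q le = ≤-trans le (≤-trans (≤-reflexive (ar u v)) (sum-list l val pt))
          where
          val : ℕ → ℕ
          val 0 = 9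
          val 2 = u
          val 3 = 12
          val 5 = 12
          val 7 = 12
          val 9 = v
          val _ = 0
          ar : ∀ u v → 9 + (u + (12 + (12 + (12 + v)))) ≡ 9 + (0 + (u + (12 + (0 + (12 + (0 + (12 + (0 + (v + 0)))))))))
          ar = solve-∀
          pt : ∀ i → i < 10 → val i ≤ W (D i)
          pt 0 _ = c≤W 0 (cong proj₂ e₀)
          pt 1 _ = z≤n
          pt 2 _ = p
          pt 3 _ = c≤W 3 (cong proj₂ e₃)
          pt 4 _ = z≤n
          pt 5 _ = c≤W 5 (cong proj₂ e₅)
          pt 6 _ = z≤n
          pt 7 _ = c≤W 7 (cong proj₂ e₇)
          pt 8 _ = z≤n
          pt 9 _ = q
          pt (suc (suc (suc (suc (suc (suc (suc (suc (suc (suc i)))))))))) lt = ⊥-elim (<⇒≱ lt (m≤m+n 10 i))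
        -- With two corners of degree 4 the known sum is 9 + 5 · 12 = 69, three too few, and
        -- `Reduce` excludes this face. A larger degree at either corner gives 18 instead of 12,
        -- hence 75.
        by : Dec (deg (D 2) ≡ 4) → Dec (deg (D 9) ≡ 4) → 72 ≤ RF.orbitSum W h
        by (no n) _ = total 18 12 (gW 2 (proj₁ (gain≥ 1 e₁ e₂) n)) (gW 9 (proj₂ (gain≥ 8 e₈ e₉))) (m≤m+n 72 3)
        by (yes _) (no n) = total 12 18 (gW 2 (proj₂ (gain≥ 1 e₁ e₂))) (gW 9 (proj₁ (gain≥ 8 e₈ e₉) n)) (m≤m+n 72 3)
        by (yes d₂) (yes d₉) = ⊥-elim (Reduce.contradiction a l (L-of (kind h) isl) (cubic' 0 e₀) (cubic' 1 e₁) d₂ (cubic' 3 e₃) (cubic' 4 e₄) (cubic' 5 e₅)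
          (cubic' 8 e₈) d₉ (tri' 1 e₁) (tri' 2 e₂) (tri' 4 e₄) (tri' 6 e₆) (tri' 8 e₈) (tri' 9 e₉))

    -- In the only cheap word all corners have degree 3, so the face cannot lie beside the pentagon
    -- of its `eA` edge. The triangles in the word keep the head of `h` from recurring.
    A-case : (∀ i → has-L (s i) ≡ false) → isA (typ h) ≡ true → 72 ≤ RF.orbitSum W h
    A-case nL isa = decide l λ cheap → ⊥-elim (found (member-one _ _ (A₁₀.sound 8 s wrap₀ wrap₁ o₂ o₃ nL isa (low₁₂ nL) cheap run-A₁₀)))
      where
      A-eq : ∀ e → isA e ≡ true → e ≡ eA
      A-eq eA _ = refl
      found : revL s 10 ≡ wordA → ⊥
      found eq = no-small-ring a c₃ (pentagon-ring (alive-α a) (Small₅.c₃ sm) (Small₅.l₅ sm)) {7} l fresh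
        where
        sm = A-small a (A-eq (typ h) isa)
        open Near a using (dist3; dist4; dist5)
        c₃ : CubicFace h
        c₃ = everywhere (λ g → deg g ≡ 3) l λ
          { 0 _ → deg-of-big (cong proj₁ (from eq 9)) ; 1 _ → deg-of-big (cong proj₁ (from eq 8)) ; 2 _ → deg-of-big (cong proj₁ (from eq 7))
          ; 3 _ → deg-of-big (cong proj₁ (from eq 6)) ; 4 _ → deg-of-big (cong proj₁ (from eq 5)) ; 5 _ → deg-of-big (cong proj₁ (from eq 4))
          ; 6 _ → deg-of-big (cong proj₁ (from eq 3)) ; 7 _ → deg-of-big (cong proj₁ (from eq 2)) ; 8 _ → deg-of-big (cong proj₁ (from eq 1))
          ; 9 _ → deg-of-big (cong proj₁ (from eq 0)) ; (suc (suc (suc (suc (suc (suc (suc (suc (suc (suc i)))))))))) lt → ⊥-elim (<⇒≱ lt (m≤m+n 10 i)) }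
        t2 : T (D 2)
        t2 = is-T 2 (cong proj₂ (from eq 7))
        t8 : T (D 8)
        t8 = is-T 8 (cong proj₂ (from eq 1))
        w1 = wrap l 1
        fresh : ∀ i → suc i < 9 → at (2 + i) h ≢ at 1 h
        fresh 0 _ q = adj-≢ (adj a 1) (sym q)
        fresh 1 _ q = nb2 a 1 (sym q)
        fresh 2 _ q = dist3 1 (inj₂ (inj₁ t2)) (sym q)
        fresh 3 _ q = dist4 1 (sym q)
        fresh 4 _ q = dist5 1 (inj₂ (inj₁ t2)) (inj₁ t2) (sym q)
        fresh 5 _ q = dist4 7 (trans q (sym w1))
        fresh 6 _ q = dist3 8 (inj₁ t8) (trans q (sym w1))
        fresh 7 _ q = nb2 a 9 (trans q (sym w1))
        fresh (suc (suc (suc (suc (suc (suc (suc (suc i)))))))) (s≤s (s≤s (s≤s (s≤s (s≤s (s≤s (s≤s (s≤s (s≤s ()))))))))) q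

    -- The face is itself poor. Across each edge that borders no triangle it keeps 12 and receives
    -- 3: the face beyond also borders a triangle, so it is long enough to pay. In total 5 · 15 =
    -- 75.
    poor-case : (∀ i → i < 10 → big (D i) ≡ false) → T (D 0) → T (D 2) → T (D 4) → T (D 6) → T (D 8) →
      typ (D 1) ≡ eN → typ (D 3) ≡ eN → typ (D 5) ≡ eN → typ (D 7) ≡ eN → typ (D 9) ≡ eN → 72 ≤ RF.orbitSum W h
    poor-case nb t0 t2 t4 t6 t8 n1 n3 n5 n7 n9 = ≤-trans (m≤m+n 72 3) (sum-list l val pt)
      where
      c₃ : CubicFace h
      c₃ = everywhere (λ g → deg g ≡ 3) l λ i lt → deg-of-big (nb i lt)
      P : ∀ i → Poor (D i)
      P i = mkPoor (trans (len-iter i h) l) (λ j → trans (cong deg (sym (iter-+ ψ j i h))) (c₃ (j + i)))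
          λ j → subst₂ (λ u v → T u ⊎ T v) (iter-+ ψ j i h) (iter-+ ψ (1 + j) i h) (alt (j + i))
        where
        alt : ∀ i → T (iter ψ i h) ⊎ T (iter ψ (1 + i) h)
        alt = everywhere (λ g → T g ⊎ T (ψ g)) l λ
          { 0 _ → inj₁ t0 ; 1 _ → inj₂ t2 ; 2 _ → inj₁ t2 ; 3 _ → inj₂ t4 ; 4 _ → inj₁ t4 ; 5 _ → inj₂ t6 ; 6 _ → inj₁ t6 ; 7 _ → inj₂ t8 ; 8 _ → inj₁ t8
          ; 9 _ → inj₂ (subst T (sym (wrapD l 0)) t0) ; (suc (suc (suc (suc (suc (suc (suc (suc (suc (suc i)))))))))) lt → ⊥-elim (<⇒≱ lt (m≤m+n 10 i)) }
      link : ∀ i → T (D i) → typ (D (suc i)) ≡ eN → 15 ≤ W (D (suc i))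
      link i t n = ≤-trans (≤-trans (≤-reflexive (sym (cong₂ _+_ (trans (c-is (suc i)) (cong cost n)) recv))) (m≤n+m _ (gain x))) (≤-reflexive (sym (W-def x)))
        where
        x = D (suc i)
        far : 10 ≤ len (α x)
        far = Corner.Cubic₃.T-far (al i) (ll i) (c₃ (suc i)) t
        recv : 12 ∸ c (α x) ≡ 3
        recv = cong (12 ∸_) (trans (c-long (≤-trans (m≤m+n 8 2) far)) (cong cost (typ-L {α x} (subst Poor (sym (α-inv x)) (P (suc i))))))
      val : ℕ → ℕ
      val 1 = 15
      val 3 = 15
      val 5 = 15
      val 7 = 15
      val 9 = 15
      val _ = 0
      pt : ∀ i → i < 10 → val i ≤ W (D i)
      pt 0 _ = z≤n
      pt 1 _ = link 0 t0 n1
      pt 2 _ = z≤n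
      pt 3 _ = link 2 t2 n3
      pt 4 _ = z≤n
      pt 5 _ = link 4 t4 n5
      pt 6 _ = z≤n
      pt 7 _ = link 6 t6 n7
      pt 8 _ = z≤n
      pt 9 _ = link 8 t8 n9
      pt (suc (suc (suc (suc (suc (suc (suc (suc (suc (suc i)))))))))) lt = ⊥-elim (<⇒≱ lt (m≤m+n 10 i))

  plain-case : ∀ {h} (a : Alive h) (l : Len 10 h) → (∀ i → has-AL (sym-at (iter ψ i h)) ≡ false) → (∀ i → has-L (sym-at (iter ψ i h)) ≡ false) → 72 ≤ RF.orbitSum W h
  plain-case {h} a l nAL nL = decide l λ cheap → found (member-two _ _ _ (P₁₀.sound 8 s wrap₀ wrap₁ o₂ o₃ nAL refl (low₁₂ nL) cheap run-P₁₀))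
    where
    open Ten a l
    nb : ∀ {xs} → revL s 10 ≡ xs → (∀ i → i < 10 → proj₁ (nth i xs) ≡ false) → ∀ i → i < 10 → big (D i) ≡ false
    nb eq f 0 _ = trans (cong proj₁ (from eq 9)) (f 9 ≤-refl)
    nb eq f 1 _ = trans (cong proj₁ (from eq 8)) (f 8 (m≤m+n 9 1))
    nb eq f 2 _ = trans (cong proj₁ (from eq 7)) (f 7 (m≤m+n 8 2))
    nb eq f 3 _ = trans (cong proj₁ (from eq 6)) (f 6 (m≤m+n 7 3))
    nb eq f 4 _ = trans (cong proj₁ (from eq 5)) (f 5 (m≤m+n 6 4))
    nb eq f 5 _ = trans (cong proj₁ (from eq 4)) (f 4 (m≤m+n 5 5))
    nb eq f 6 _ = trans (cong proj₁ (from eq 3)) (f 3 (m≤m+n 4 6))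
    nb eq f 7 _ = trans (cong proj₁ (from eq 2)) (f 2 (m≤m+n 3 7))
    nb eq f 8 _ = trans (cong proj₁ (from eq 1)) (f 1 (m≤m+n 2 8))
    nb eq f 9 _ = trans (cong proj₁ (from eq 0)) (f 0 (m≤m+n 1 9))
    nb eq f (suc (suc (suc (suc (suc (suc (suc (suc (suc (suc i)))))))))) lt = ⊥-elim (<⇒≱ lt (m≤m+n 10 i))
    f₀ : ∀ i → i < 10 → proj₁ (nth i wordP) ≡ false
    f₁ : ∀ i → i < 10 → proj₁ (nth i wordP') ≡ false
    f₀ i lt = trans (cong (λ z → proj₁ (nth z wordP)) (sym (F.toℕ-fromℕ< lt))) (not-false (allFin-sound {10} (λ i → not (proj₁ (nth (toℕ i) wordP))) refl (fromℕ< lt)))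
    f₁ i lt = trans (cong (λ z → proj₁ (nth z wordP')) (sym (F.toℕ-fromℕ< lt))) (not-false (allFin-sound {10} (λ i → not (proj₁ (nth (toℕ i) wordP'))) refl (fromℕ< lt)))
    found : revL s 10 ≡ wordP ⊎ revL s 10 ≡ wordP' → 72 ≤ RF.orbitSum W h
    found (inj₁ eq) = poor-case (nb eq f₀) (is-T 0 (t 9)) (is-T 2 (t 7)) (is-T 4 (t 5)) (is-T 6 (t 3)) (is-T 8 (t 1)) (t 8) (t 6) (t 4) (t 2) (t 0)
      where
      t : ∀ i → proj₂ (nth i (revL s 10)) ≡ proj₂ (nth i wordP)
      t i = cong proj₂ (from eq i)
    -- The same alternating word begun one edge later; the sum does not depend on the starting dart.
    found (inj₂ eq) = subst (72 ≤_) (RF.orbitSum-shift W h) (Ten.poor-case (alive-ψ a) l' nb' (T' 0 (t 8)) (T' 2 (t 6)) (T' 4 (t 4)) (T' 6 (t 2)) (T' 8 (t 0)) (n' 1 (t 7)) (n' 3 (t 5)) (n' 5 (t 3)) (n' 7 (t 1))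
        (trans (cong typ (trans (sym (iter-suc ψ 9 h)) (wrapD l 0))) (t 9)))
      where
      t : ∀ i → proj₂ (nth i (revL s 10)) ≡ proj₂ (nth i wordP')
      t i = cong proj₂ (from eq i)
      l' : Len 10 (ψ h)
      l' = trans (len-iter 1 h) l
      T' : ∀ i → typ (D (suc i)) ≡ eT → T (iter ψ i (ψ h))
      T' i e = subst T (iter-suc ψ i h) (is-T (suc i) e)
      n' : ∀ i {e} → typ (D (suc i)) ≡ e → typ (iter ψ i (ψ h)) ≡ e
      n' i e = trans (cong typ (sym (iter-suc ψ i h))) e
      nb-all : ∀ i → big (iter ψ i h) ≡ false
      nb-all = everywhere (λ g → big g ≡ false) l (nb eq f₁)
      nb' : ∀ i → i < 10 → big (iter ψ i (ψ h)) ≡ false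
      nb' i _ = trans (cong big (sym (iter-suc ψ i h))) (nb-all (suc i))

  none-of : ∀ {h k} (Q : Fin d → Bool) → Len k h → ¬ (∃ λ (i : Fin k) → Q (iter ψ (toℕ i) h) ≡ true) → ∀ i → Q (iter ψ i h) ≡ false
  none-of {h} Q l n = everywhere (λ g → Q g ≡ false) l λ i lt → ¬true λ q → n (fromℕ< lt , trans (cong (λ z → Q (iter ψ z h)) (F.toℕ-fromℕ< lt)) q)

  neither : ∀ e → isL e ≡ false → isA e ≡ false → isAL e ≡ false
  neither eT _ _ = refl
  neither eB _ _ = refl
  neither eZ _ _ = refl
  neither eN _ _ = refl

  module _ {k : ℕ}
    (L-case : ∀ {h} → Alive h → Len k h → isL (typ h) ≡ true → 72 ≤ RF.orbitSum W h)
    (A-case : ∀ {h} → Alive h → Len k h → (∀ i → isL (typ (iter ψ i h)) ≡ false) → isA (typ h) ≡ true → 72 ≤ RF.orbitSum W h)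
    (rest : ∀ {h} → Alive h → Len k h → (∀ i → isL (typ (iter ψ i h)) ≡ false) → (∀ i → isAL (typ (iter ψ i h)) ≡ false) → 72 ≤ RF.orbitSum W h) where

    -- Orbit sums are invariant under rotation, so a worst edge may be taken as the start of the
    -- word, as the searches assume.
    rotate-to-worst : ∀ {h} → Alive h → Len k h → 72 ≤ RF.orbitSum W h
    rotate-to-worst {h} a l = by-L (F.any? {k} λ i → isL (typ (iter ψ (toℕ i) h)) ≟B true)
      where
      by-L : Dec (∃ λ (i : Fin k) → isL (typ (iter ψ (toℕ i) h)) ≡ true) → 72 ≤ RF.orbitSum W h
      by-L (yes (i , q)) = subst (72 ≤_) (RF.orbitSum-iter W (toℕ i) h) (L-case (alive-iterψ (toℕ i) a) (trans (len-iter (toℕ i) h) l) q)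
      by-L (no nL) = by-A (F.any? {k} λ i → isA (typ (iter ψ (toℕ i) h)) ≟B true)
        where
        noL : ∀ i → isL (typ (iter ψ i h)) ≡ false
        noL = none-of (isL ∘ typ) l nL
        by-A : Dec (∃ λ (i : Fin k) → isA (typ (iter ψ (toℕ i) h)) ≡ true) → 72 ≤ RF.orbitSum W h
        by-A (yes (i , q)) = subst (72 ≤_) (RF.orbitSum-iter W (toℕ i) h) (A-case (alive-iterψ (toℕ i) a) (trans (len-iter (toℕ i) h) l)
          (λ j → trans (cong (isL ∘ typ) (sym (iter-+ ψ j (toℕ i) h))) (noL (j + toℕ i))) q)
        by-A (no nA) = rest a l noL λ i → neither (typ (iter ψ i h)) (noL i) (none-of (isA ∘ typ) l nA i)

  len-10 : ∀ {h} → Alive h → Len 10 h → 72 ≤ RF.orbitSum W h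
  len-10 = rotate-to-worst (λ a l → Ten.L-case a l) (λ a l → Ten.A-case a l) (λ a l nL nAL → plain-case a l nAL nL)

  module Eleven {h : Fin d} (a : Alive h) (l : Len 11 h) where
    open Word a (≤-trans (m≤m+n 10 1) (≤-reflexive (sym l)))

    wrap₀ : s 11 ≡ s 0
    wrap₀ = cong sym-at (wrapD l 0)
    wrap₁ : s 12 ≡ s 1
    wrap₁ = cong sym-at (wrapD l 1)

    L-case : isL (typ h) ≡ true → 72 ≤ RF.orbitSum W h
    L-case isl = decide l λ cheap → case L₁₁.sound 9 s wrap₀ wrap₁ o₂ o₃ (λ _ → refl) isl low₉ cheap run-L₁₁ of λ ()

    A-case : (∀ i → has-L (s i) ≡ false) → isA (typ h) ≡ true → 72 ≤ RF.orbitSum W h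
    A-case nL isa = decide l λ cheap → case A₁₁.sound 9 s wrap₀ wrap₁ o₂ o₃ nL isa (low₁₂ nL) cheap run-A₁₁ of λ ()

    P-case : (∀ i → has-AL (s i) ≡ false) → (∀ i → has-L (s i) ≡ false) → 72 ≤ RF.orbitSum W h
    P-case nAL nL = decide l λ cheap → case P₁₁.sound 9 s wrap₀ wrap₁ o₂ o₃ nAL refl (low₁₂ nL) cheap run-P₁₁ of λ ()

  len-11 : ∀ {h} → Alive h → Len 11 h → 72 ≤ RF.orbitSum W h
  len-11 = rotate-to-worst (λ a l → Eleven.L-case a l) (λ a l → Eleven.A-case a l) (λ a l nL nAL → Eleven.P-case a l nAL nL)

  len-6 : ∀ {h} → Alive h → Len 6 h → 72 ≤ RF.orbitSum W h
  len-6 {h} a l = sum-const≤ {h} {6} 12 l λ i → ≤-trans (≤-reflexive (sym (c-short (subst (_< 8) (sym (trans (len-iter i h) l)) (m≤m+n 7 1))))) (W≥c _)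

  face-bound : ∀ {h} → Alive h → 72 ≤ RF.orbitSum W h
  face-bound {h} a = go (len h) refl
    where
    go : ∀ k → Len k h → 72 ≤ RF.orbitSum W h
    go 0 e = ⊥-elim (<⇒≢ (RF.per>0 h) (sym e))
    go 1 e = ⊥-elim (len≢1 a e)
    go 2 e = ⊥-elim (len≢2 a e)
    go 3 e = len-3 a e
    go 4 e = ⊥-elim (len≢4 a e)
    go 5 e = len-5 a e
    go 6 e = len-6 a e
    go 7 e = ⊥-elim (len≢7 a e)
    go 8 e = len-8 a e
    go 9 e = len-9 a e
    go 10 e = len-10 a e
    go 11 e = len-11 a e
    go (suc (suc (suc (suc (suc (suc (suc (suc (suc (suc (suc (suc k)))))))))))) e =
      Word.long a (≤-trans (m≤m+n 10 (2 + k)) (≤-reflexive (sym e))) (≤-trans (m≤m+n 12 k) (≤-reflexive (sym e)))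

  contradiction : (∃ λ v → S v ≡ true) → ⊥
  contradiction nonempty = Count.too-few nonempty c c≤12
    λ {h} a → ≤-trans (face-bound a) (≤-reflexive (sumN-cong (len h) λ i → W-def (iter ψ i h)))

-- Induction on the vertex set and the transversal

module Conclude (G : PlaneGraph)
  (key : ∀ S → (∃ λ v → S v ≡ true) → (∀ v → S v ≡ true → Colouring.Colourable G (Colouring.without G S v)) →
         ¬ Colouring.Colourable G S → ⊥) where
  open PlaneGraph G
  open Colouring G

  colour-all : ∀ f S → countB S < f → Colourable S
  colour-all (suc f) S (s≤s lt) with F.any? (λ v → S v ≟B true)
  ... | no none' = (λ _ → none) , record
        { valid = record { ind = λ _ _ _ () ; forest = λ K x Kx h _ → case h x Kx of λ () }
        ; inside = λ v e → ⊥-elim (none' (v , e)) ; outside = λ _ _ → refl }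
  ... | yes ne with Decide.colourable? S
  ...   | yes c = c
  ...   | no nc = ⊥-elim (key S ne (λ v Sv → colour-all f (without S v) (≤-trans (fewer v Sv) lt)) nc)
    where
    fewer : ∀ v → S v ≡ true → countB (without S v) < countB S
    fewer v Sv = countB-strict _ _ v (without-≡ S v) Sv λ i e → proj₁ (∧-true e)

  module Transversal (κ : V → Col) (c : Colours (λ _ → true) κ) where
    open Colours c

    isI isF : Col → Bool
    isI cI = true
    isI _ = false
    isF cF = true
    isF _ = false

    T : SubsetH G
    T (v , zero) = isI (κ v)
    T (v , suc zero) = isF (κ v)

    transversal : IsTransversal G T
    transversal v with κ v in e
    ... | none = ⊥-elim (inside v refl e)
    ... | cI = inj₁ (refl , refl)
    ... | cF = inj₂ (refl , refl)

    I-of : ∀ v → isI (κ v) ≡ true → κ v ≡ cI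
    I-of v e with κ v
    ... | cI = refl

    F-of : ∀ v → isF (κ v) ≡ true → κ v ≡ cF
    F-of v e with κ v
    ... | cF = refl

    count≤1 : ∀ (p : V → Bool) → (∀ a b → p a ≡ true → p b ≡ true → a ≡ b) → countB p ≤ 1
    count≤1 p h rewrite countB-sum p = sum-single (bit ∘ p) 1 le λ i j x y → h i j (get i x) (get j y)
      where
      le : ∀ i → bit (p i) ≤ 1
      le i with p i
      ... | true = ≤-refl
      ... | false = z≤n
      get : ∀ i → bit (p i) ≢ 0 → p i ≡ true
      get i x with p i
      ... | true = refl
      ... | false = ⊥-elim (x refl)

    count0 : ∀ (p : V → Bool) → (∀ a → p a ≢ true) → countB p ≡ 0
    count0 p h = trans (countB-sum p) (trans (sum-cong-≗ λ i → cong bit (¬true (h i))) (sum-replicate-zero n))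

    -- A vertex of `K` in copy 1 has degree 0 by independence, as copies are not joined to each
    -- other. If `K` lies in copy 2 and every degree is at least 2, its vertices form a leafless set
    -- inside the forest.
    degenerate : StrictlyDegenerate G T
    degenerate K with F.any? (λ v → SubgraphOf.VK K (v , zero) ≟B true)
    ... | yes (v , Kv) = (v , zero) , Kv , s≤s (≤-reflexive (cong₂ _+_ (count0 _ a) (count0 _ b)))
      where
      open SubgraphOf K
      a : ∀ u → EK (v , zero) (u , zero) ≢ true
      a u e with EK⊆H _ _ e
      ... | (vu , _) , _ , Ku = Valid.ind valid v u vu (I-of v (VK⊆T _ Kv)) (I-of u (VK⊆T _ Ku))
      b : ∀ u → EK (v , zero) (u , suc zero) ≢ true
      b u e with EK⊆H _ _ e
      ... | (_ , ()) , _
    ... | no no0 = go (SubgraphOf.nonempty K)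
      where
      open SubgraphOf K
      K₁ : V → Bool
      K₁ v = VK (v , suc zero)
      a : ∀ v u → EK (v , suc zero) (u , zero) ≢ true
      a v u e with EK⊆H _ _ e
      ... | (_ , ()) , _
      Two : V → Set
      Two v = ∃ λ x → ∃ λ y → (x ≢ y) × (EK (v , suc zero) (x , suc zero) ≡ true) × (EK (v , suc zero) (y , suc zero) ≡ true)
      two? : ∀ v → Dec (Two v)
      two? v = F.any? λ x → F.any? λ y → ¬? (x ≟F y) ×-dec ((EK (v , suc zero) (x , suc zero) ≟B true) ×-dec (EK (v , suc zero) (y , suc zero) ≟B true))
      leaf : Dec (∃ λ v → K₁ v ≡ true × ¬ Two v)
      leaf = F.any? λ v → (K₁ v ≟B true) ×-dec ¬? (two? v)
      Ans : Set
      Ans = ∃ λ x → VK x ≡ true × degK x < fH G x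
      go : (∃ λ x → VK x ≡ true) → Ans
      go ((v , zero) , Kv) = ⊥-elim (no0 (v , Kv))
      go ((v , suc zero) , Kv) with leaf
      ... | yes (z , Kz , nt) = (z , suc zero) , Kz , s≤s (≤-trans (≤-reflexive (cong (_+ countB (λ u → EK (z , suc zero) (u , suc zero))) (count0 _ (a z)))) (count≤1 _ uniq))
        where
        uniq : ∀ x y → EK (z , suc zero) (x , suc zero) ≡ true → EK (z , suc zero) (y , suc zero) ≡ true → x ≡ y
        uniq x y p q with x ≟F y
        ... | yes e = e
        ... | no ne = ⊥-elim (nt (x , y , ne , p , q))
      ... | no nl = ⊥-elim (Valid.forest valid K₁ v Kv (λ y Ky → F-of y (VK⊆T _ Ky)) lf)
        where
        lf : Leafless K₁
        lf z Kz with two? z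
        ... | no nt = ⊥-elim (nl (z , Kz , nt))
        ... | yes (x , y , ne , p , q) with EK⊆H _ _ p | EK⊆H _ _ q
        ...   | (zx , _) , _ , Kx | (zy , _) , _ , Ky = x , y , ne , (zx , Kx) , (zy , Ky)

  result : ∃ λ T → IsTransversal G T × StrictlyDegenerate G T
  result with colour-all (suc (countB {n} (λ _ → true))) (λ _ → true) ≤-refl
  ... | κ , c = Transversal.T κ c , Transversal.transversal κ c , Transversal.degenerate κ c

theorem3p4 : (G : PlaneGraph) →
    ¬ Cycle G 4 → ¬ Cycle G 7 → ¬ Cycle G 9 →
    ((C : Cycle G 5) → (D : Cycle G 3) → ¬ NormallyAdjacent G C D) →
    ∃ λ T → IsTransversal G T × StrictlyDegenerate G T
theorem3p4 G no4 no7 no9 no53 = Conclude.result G λ S ne sub bad → Critical.contradiction G no4 no7 no9 no53 S sub bad ne
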